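{- For every positive integer $n$, $C_1(\mathbb{Q}^n) - c_1(\mathbb{Q}^n) \leq 3$.
   Context: For a positive integer $n$ and $d>0$, $G(\mathbb{Q}^n,d)$ denotes the graph with vertex set $\mathbb{Q}^n$ in which two points are adjacent if and only if their Euclidean distance is exactly $d$, and $\omega(\mathbb{Q}^n,d)$ denotes its clique number, i.e. the largest $m$ such that there are $m$ points of $\mathbb{Q}^n$ pairwise at Euclidean distance exactly $d$. The clique number of $\mathbb{Q}^n$ is $C_1(\mathbb{Q}^n)=\max\{\omega(\mathbb{Q}^n,d): d>0\}$, and the lower clique number is $c_1(\mathbb{Q}^n)=\min\{\omega(\mathbb{Q}^n,d): d>0 \text{ and } d \text{ is realized as the distance between two points of } \mathbb{Q}^n\}$. -}

module Defs where

open import Data.Nat using (ℕ; suc; _≤_)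
open import Data.Fin using (Fin; zero; suc)
open import Data.Rational using (ℚ; 0ℚ; _+_; _-_; _*_; _<_)
open import Data.Product using (Σ; ∃; _×_)
open import Relation.Binary.PropositionalEquality using (_≡_; _≢_)

Point : ℕ → Set
Point n = Fin n → ℚ

sumFin : ∀ {n} → (Fin n → ℚ) → ℚ
sumFin {ℕ.zero} f = 0ℚ
sumFin {suc n} f = f zero + sumFin (λ i → f (suc i))

sqDist : ∀ {n} → Point n → Point n → ℚ
sqDist p q = sumFin (λ i → (p i - q i) * (p i - q i))

-- A distance d > 0 is encoded by its square D = d² (so d = √D).
-- Two points are at distance d iff their squared distance is D.

HasClique : (n : ℕ) → ℚ → ℕ → Set
HasClique n D m = Σ (Fin m → Point n) λ f → ∀ i j → i ≢ j → sqDist (f i) (f j) ≡ D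

IsCliqueNumber : (n : ℕ) → ℚ → ℕ → Set
IsCliqueNumber n D m = HasClique n D m × (∀ k → HasClique n D k → k ≤ m)

Realized : (n : ℕ) → ℚ → Set
Realized n D = ∃ λ p → ∃ λ q → sqDist {n} p q ≡ D

IsUpperCliqueNumber : ℕ → ℕ → Set
IsUpperCliqueNumber n M =
  (∃ λ D → 0ℚ < D × IsCliqueNumber n D M) ×
  (∀ D k → 0ℚ < D → IsCliqueNumber n D k → k ≤ M)

IsLowerCliqueNumber : ℕ → ℕ → Set
IsLowerCliqueNumber n m =
  (∃ λ D → 0ℚ < D × Realized n D × IsCliqueNumber n D m) ×
  (∀ D k → 0ℚ < D → Realized n D → IsCliqueNumber n D k → m ≤ k)

{-# OPTIONS --safe #-}

-- Points at pairwise distance √D > 0 are affinely independent, so C₁(ℚⁿ) ≤ n + 1, and it suffices to find n − 2 points for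
-- every D. Write n = 4t + r with r < 4, and D = 2q. As q is a sum of four rational squares, quaternions give 4t orthogonal
-- vectors vᵢ of squared norm q in ℚ⁴ᵗ, which is enough unless r = 3. In that case a further point l Σ vᵢ + w with w ∈ ℚ³
-- is needed, i.e. q (1 + 2l − 4t l²) must be a sum of three squares; up to scaling, q (Z² − (4t + 1) X²) = a² + b² + c².
-- This is solved by means of Gauss's theorem that every number 8N + 3 is a sum of three squares.
--
-- For Gauss's theorem, let f(s) be either the number of (a, b, c) with a ≡ b ≡ c (mod 4) odd and positive and
-- ab + bc + ca = s, or the number of representations of s by three squares of odd positive numbers. In both cases
-- Σ (M − x²) f(4M − x²) = 0, the sum being over all odd x > 0. The recurrence determines f on the numbers 8N + 3 up to its
-- value at 3, which is 1 in both cases, so the two numbers agree; the first one is positive since 8N + 3 = 1·b + b·1 + 1·1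
-- for b = 4N + 1. The recurrence is obvious for squares by symmetry. In the other case it is proved in the style of Liouville,
-- by cutting the sum over x² + ab + bc + ca = 4M into pieces parametrised by the solutions of pq + yw = M, of
-- ab + bc + cd = M and of q(p + y) = M, and comparing the pieces by bijections.
module Submission where

open import Defs
open import Data.Nat as ℕ using (ℕ; zero; suc; z≤n; s≤s)
import Data.Nat.Properties as ℕ
open import Data.Integer as ℤ using (ℤ; 0ℤ; 1ℤ)
import Data.Integer.Properties as ℤ
open import Data.Integer.Tactic.RingSolver using () renaming (solve-∀ to ℤ-solve-∀)
open import Data.Product using (∃; _×_; _,_; proj₂)
open import Data.Sum using (inj₁; inj₂; [_,_]′)
open import Data.Empty using (⊥-elim)
open import Relation.Nullary using (yes; no; ¬_)
open import Function using (_∘_)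
open import Relation.Binary.PropositionalEquality

-- The link between the forms is p = (a + c)/2, q = (b + c)/2, y = (x - c)/2, w = (x + c)/2, for
-- which x² + ab + bc + ca = 4 (pq + yw), and a ≡ b ≡ c (mod 4) says that p and q are odd. The
-- obstacle is signs: positive p, q, y, w only give a + c > 0, b + c > 0 and |c| < x, whereas the
-- wanted sum has a, b, c > 0 and allows c ≥ x. Hence the pieces are separated by the signs of a, b,
-- c and a + b, and those with a negative entry are matched by exchanging entries. This half of the
-- argument holds for any weight that depends on the form and on x. For the weight M - x², M may be
-- replaced by the value of the form, so that the weight becomes a polynomial and the remaining path
-- sums cancel by polynomial identities, one for each parity pattern. What is left lives on
-- factorisations qm = M and is antisymmetric there. In the ternary equation, n (Z² - (4t + 1) X²)
-- is even for even n, out of direct reach of the theorem on 8N + 3. The number n z² - (4t + 1) can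
-- often be steered to 3 mod 8, and a similitude of quadratic forms leads from it back to the
-- desired shape.

FourSquares : ℕ → Set
FourSquares n = ∃ λ k → ∃ λ r → ∃ λ a → ∃ λ b → ∃ λ c → k ≢ 0ℤ × r ≢ 0ℤ ×
  k ℤ.* k ℤ.* ℤ.+ n ≡ r ℤ.* r ℤ.+ a ℤ.* a ℤ.+ b ℤ.* b ℤ.+ c ℤ.* c

-- Homogeneous version of the condition on l, with l = X/(Z - X). The requirement on X is what
-- allows Z - X to be made nonzero.
Ternary : ℕ → ℕ → Set
Ternary t n = ∃ λ Z → ∃ λ X → ∃ λ a → ∃ λ b → ∃ λ c → X ≢ 0ℤ ×
  ℤ.+ n ℤ.* (Z ℤ.* Z ℤ.- ℤ.+ (1 ℕ.+ 4 ℕ.* t) ℤ.* (X ℤ.* X)) ≡ a ℤ.* a ℤ.+ b ℤ.* b ℤ.+ c ℤ.* c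

-- Cliques in rational space, given the two arithmetic statements

module Cliques (four-squares : ∀ n → FourSquares (suc n)) (ternary : ∀ t n → Ternary t (suc n)) where

  open import Data.Nat.DivMod using (_/_; _%_; m≡m%n+[m/n]*n; m%n<n)
  open import Data.Fin using (Fin; zero; suc; punchIn; inject≤; splitAt)
  import Data.Fin.Properties as Fin
  open import Data.Rational using (ℚ; mkℚ; 0ℚ; 1ℚ; ½; _+_; _*_; _-_; -_; 1/_; _<_; NonZero; ≢-nonZero; toℚᵘ; fromℚᵘ; *<*)
  import Data.Rational.Properties as ℚ
  open import Data.Rational.Unnormalised as ℚᵘ using (mkℚᵘ; *≡*)
  import Data.Rational.Unnormalised.Properties as ℚᵘ
  open import Data.Rational.Solver using (module +-*-Solver)
  open +-*-Solver using (solve; _:+_; _:*_; _:-_; :-_; _:=_; con)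
  open import Data.Vec.Functional using (insertAt)
  open import Data.Vec.Functional.Properties using (insertAt-lookup; insertAt-punchIn)
  open import Relation.Nullary using (¬?)
  open import Relation.Nullary.Decidable using (decidable-stable)
  open import Relation.Binary.Definitions using (tri<; tri≈; tri>)

  fromℤ : ℤ → ℚ
  fromℤ i = fromℚᵘ (mkℚᵘ i 0)

  fromℤ-+ : ∀ i j → fromℤ (i ℤ.+ j) ≡ fromℤ i + fromℤ j
  fromℤ-+ i j = ℚ.toℚᵘ-injective (begin
    toℚᵘ (fromℤ (i ℤ.+ j))             ≈⟨ ℚ.toℚᵘ-fromℚᵘ (mkℚᵘ (i ℤ.+ j) 0) ⟩
    mkℚᵘ (i ℤ.+ j) 0                   ≈⟨ *≡* (lem i j) ⟩
    mkℚᵘ i 0 ℚᵘ.+ mkℚᵘ j 0             ≈⟨ ℚᵘ.+-cong (ℚ.toℚᵘ-fromℚᵘ (mkℚᵘ i 0)) (ℚ.toℚᵘ-fromℚᵘ (mkℚᵘ j 0)) ⟨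
    toℚᵘ (fromℤ i) ℚᵘ.+ toℚᵘ (fromℤ j) ≈⟨ ℚ.toℚᵘ-homo-+ (fromℤ i) (fromℤ j) ⟨
    toℚᵘ (fromℤ i + fromℤ j) ∎)
    where
    open import Relation.Binary.Reasoning.Setoid ℚᵘ.≃-setoid
    lem : ∀ i j → (i ℤ.+ j) ℤ.* ℤ.1ℤ ≡ (i ℤ.* ℤ.1ℤ ℤ.+ j ℤ.* ℤ.1ℤ) ℤ.* ℤ.1ℤ
    lem = ℤ-solve-∀

  fromℤ-* : ∀ i j → fromℤ (i ℤ.* j) ≡ fromℤ i * fromℤ j
  fromℤ-* i j = ℚ.toℚᵘ-injective (begin
    toℚᵘ (fromℤ (i ℤ.* j))             ≈⟨ ℚ.toℚᵘ-fromℚᵘ (mkℚᵘ (i ℤ.* j) 0) ⟩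
    mkℚᵘ (i ℤ.* j) 0                   ≈⟨ *≡* refl ⟩
    mkℚᵘ i 0 ℚᵘ.* mkℚᵘ j 0             ≈⟨ ℚᵘ.*-cong (ℚ.toℚᵘ-fromℚᵘ (mkℚᵘ i 0)) (ℚ.toℚᵘ-fromℚᵘ (mkℚᵘ j 0)) ⟨
    toℚᵘ (fromℤ i) ℚᵘ.* toℚᵘ (fromℤ j) ≈⟨ ℚ.toℚᵘ-homo-* (fromℤ i) (fromℤ j) ⟨
    toℚᵘ (fromℤ i * fromℤ j) ∎)
    where open import Relation.Binary.Reasoning.Setoid ℚᵘ.≃-setoid

  fromℤ-injective : ∀ i j → fromℤ i ≡ fromℤ j → i ≡ j
  fromℤ-injective i j e with ℚ.fromℚᵘ-injective {mkℚᵘ i 0} {mkℚᵘ j 0} e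
  ... | *≡* e′ = trans (sym (ℤ.*-identityʳ i)) (trans e′ (ℤ.*-identityʳ j))

  opaque
    -- A fraction p/d equals pd/d², and a square factor is harmless in the quadratic equations to be
    -- solved.
    clear-denominator : ∀ c → 0ℚ < c → ∃ λ n → ∃ λ d → d ≢ 0ℤ × c * (fromℤ d * fromℤ d) ≡ fromℤ (ℤ.+ suc n)
    -- The first witness is the predecessor of the product of numerator and denominator.
    clear-denominator c@(mkℚ (ℤ.+ suc n) d-1 _) _ = d-1 ℕ.+ n ℕ.* suc d-1 , d , (λ ()) , (begin
      c * (fromℤ d * fromℤ d)  ≡⟨ sym (ℚ.*-assoc c (fromℤ d) (fromℤ d)) ⟩
      c * fromℤ d * fromℤ d  ≡⟨ cong (_* fromℤ d) c*d ⟩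
      fromℤ (ℤ.+ suc n) * fromℤ d ≡⟨ sym (fromℤ-* (ℤ.+ suc n) d) ⟩
      fromℤ (ℤ.+ suc n ℤ.* d) ∎)
      where
      open ≡-Reasoning
      d : ℤ
      d = ℤ.+ suc d-1
      c*d : c * fromℤ d ≡ fromℤ (ℤ.+ suc n)
      c*d = ℚ.toℚᵘ-injective (ℚᵘ.≃-trans (ℚ.toℚᵘ-homo-* c (fromℤ d))
        (ℚᵘ.≃-trans (ℚᵘ.*-congˡ {toℚᵘ c} (ℚ.toℚᵘ-fromℚᵘ (mkℚᵘ d 0)))
          (ℚᵘ.≃-trans (*≡* (lem (ℤ.+ suc n) d)) (ℚᵘ.≃-sym (ℚ.toℚᵘ-fromℚᵘ (mkℚᵘ (ℤ.+ suc n) 0))))))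
        where
        lem : ∀ i j → i ℤ.* j ℤ.* ℤ.1ℤ ≡ i ℤ.* (j ℤ.* ℤ.1ℤ)
        lem = ℤ-solve-∀
    clear-denominator (mkℚ (ℤ.+ zero) _ _) (*<* (ℤ.+<+ ()))
    clear-denominator (mkℚ (ℤ.-[1+ _ ]) _ _) (*<* ())

  inverse : ∀ x → x ≢ 0ℚ → ∃ λ y → x * y ≡ 1ℚ
  inverse x x≢0 = 1/ x , ℚ.*-inverseʳ x
    where
    instance
      _ : NonZero x
      _ = ≢-nonZero x≢0

  fromℤ≢0 : ∀ {i} → i ≢ 0ℤ → fromℤ i ≢ 0ℚ
  fromℤ≢0 {i} i≢0 e = i≢0 (fromℤ-injective i 0ℤ e)

  opaque
    rational-four-squares : ∀ c → 0ℚ < c → ∃ λ a → ∃ λ b → ∃ λ g → ∃ λ h → a * a + b * b + g * g + h * h ≡ c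
    rational-four-squares c c>0 with clear-denominator c c>0
    ... | n , d , d≢0 , cd with four-squares n
    ...   | k , r , a , b , g , k≢0 , _ , e with inverse (fromℤ d) (fromℤ≢0 d≢0) | inverse (fromℤ k) (fromℤ≢0 k≢0)
    ...     | y , dy | z , kz = fromℤ r * u , fromℤ a * u , fromℤ b * u , fromℤ g * u , (begin
      fromℤ r * u * (fromℤ r * u) + fromℤ a * u * (fromℤ a * u) + fromℤ b * u * (fromℤ b * u) + fromℤ g * u * (fromℤ g * u)
        ≡⟨ solve 5 (λ r a b g u → r :* u :* (r :* u) :+ a :* u :* (a :* u) :+ b :* u :* (b :* u) :+ g :* u :* (g :* u) :=
             (r :* r :+ a :* a :+ b :* b :+ g :* g) :* (u :* u)) refl (fromℤ r) (fromℤ a) (fromℤ b) (fromℤ g) u ⟩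
      (fromℤ r * fromℤ r + fromℤ a * fromℤ a + fromℤ b * fromℤ b + fromℤ g * fromℤ g) * (u * u)
        ≡⟨ cong (_* (u * u)) (trans (sym sum) (trans (cong fromℤ (sym e)) product)) ⟩
      fromℤ k * fromℤ k * (c * (fromℤ d * fromℤ d)) * (u * u)
        ≡⟨ solve 5 (λ k c d y z → k :* k :* (c :* (d :* d)) :* (y :* z :* (y :* z)) := c :* ((d :* y) :* (d :* y)) :* ((k :* z) :* (k :* z)))
             refl (fromℤ k) c (fromℤ d) y z ⟩
      c * ((fromℤ d * y) * (fromℤ d * y)) * ((fromℤ k * z) * (fromℤ k * z))
        ≡⟨ cong₂ (λ p q → c * (p * p) * (q * q)) dy kz ⟩
      c * (1ℚ * 1ℚ) * (1ℚ * 1ℚ)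
        ≡⟨ trans (ℚ.*-identityʳ _) (ℚ.*-identityʳ c) ⟩
      c ∎)
      where
      open ≡-Reasoning
      u : ℚ
      u = y * z
      sum : fromℤ (r ℤ.* r ℤ.+ a ℤ.* a ℤ.+ b ℤ.* b ℤ.+ g ℤ.* g) ≡
        fromℤ r * fromℤ r + fromℤ a * fromℤ a + fromℤ b * fromℤ b + fromℤ g * fromℤ g
      sum = trans (fromℤ-+ (r ℤ.* r ℤ.+ a ℤ.* a ℤ.+ b ℤ.* b) (g ℤ.* g)) (cong₂ _+_
        (trans (fromℤ-+ (r ℤ.* r ℤ.+ a ℤ.* a) (b ℤ.* b)) (cong₂ _+_
          (trans (fromℤ-+ (r ℤ.* r) (a ℤ.* a)) (cong₂ _+_ (fromℤ-* r r) (fromℤ-* a a))) (fromℤ-* b b))) (fromℤ-* g g))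
      product : fromℤ (k ℤ.* k ℤ.* ℤ.+ suc n) ≡ fromℤ k * fromℤ k * (c * (fromℤ d * fromℤ d))
      product = trans (fromℤ-* (k ℤ.* k) (ℤ.+ suc n)) (cong₂ _*_ (fromℤ-* k k) (sym cd))

  opaque
    -- If Z = X, then changing the sign of X preserves the equation, and the new difference is 2X,
    -- which is nonzero.
    ternary-distinct : ∀ t n → ∃ λ Z → ∃ λ X → ∃ λ a → ∃ λ b → ∃ λ c → Z ℤ.- X ≢ 0ℤ ×
      ℤ.+ suc n ℤ.* (Z ℤ.* Z ℤ.- ℤ.+ (1 ℕ.+ 4 ℕ.* t) ℤ.* (X ℤ.* X)) ≡ a ℤ.* a ℤ.+ b ℤ.* b ℤ.+ c ℤ.* c
    ternary-distinct t n with ternary t n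
    ... | Z , X , a , b , c , X≢0 , e with Z ℤ.- X ℤ.≟ 0ℤ
    ...   | no Z-X≢0  = Z , X , a , b , c , Z-X≢0 , e
    ...   | yes Z-X≡0 = Z , ℤ.- X , a , b , c , Z+X≢0 ,
      trans (cong (λ s → ℤ.+ suc n ℤ.* (Z ℤ.* Z ℤ.- ℤ.+ (1 ℕ.+ 4 ℕ.* t) ℤ.* s)) (lem X)) e
      where
      lem : ∀ X → (ℤ.- X) ℤ.* (ℤ.- X) ≡ X ℤ.* X
      lem = ℤ-solve-∀
      lem′ : ∀ Z X → ℤ.+ 2 ℤ.* X ≡ (Z ℤ.- (ℤ.- X)) ℤ.- (Z ℤ.- X)
      lem′ = ℤ-solve-∀
      Z+X≢0 : Z ℤ.- (ℤ.- X) ≢ 0ℤ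
      Z+X≢0 z = X≢0 (ℤ.*-cancelˡ-≡ (ℤ.+ 2) X 0ℤ (trans (lem′ Z X) (cong₂ ℤ._-_ z Z-X≡0)))

  fromℤ-- : ∀ i j → fromℤ (i ℤ.- j) ≡ fromℤ i - fromℤ j
  fromℤ-- i j = trans (solve 2 (λ a b → a := (a :+ b) :- b) refl (fromℤ (i ℤ.- j)) (fromℤ j))
    (cong (_- fromℤ j) (trans (sym (fromℤ-+ (i ℤ.- j) j)) (cong fromℤ (lem i j))))
    where
    lem : ∀ i j → (i ℤ.- j) ℤ.+ j ≡ i
    lem = ℤ-solve-∀

  opaque
    -- Dividing by Z - X normalises the solution to X = l and Z = 1 + l, and (1 + l)² - (4t + 1) l²
    -- = 1 + 2l - 4t l².
    rational-ternary : ∀ t c → 0ℚ < c → ∃ λ l → ∃ λ a → ∃ λ b → ∃ λ g →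
      a * a + b * b + g * g ≡ c * (1ℚ + (l + l) - fromℤ (ℤ.+ (4 ℕ.* t)) * (l * l))
    rational-ternary t c c>0 with clear-denominator c c>0
    ... | n , d , d≢0 , cd with ternary-distinct t n
    ...   | Z , X , a , b , g , Z-X≢0 , e with inverse (fromℤ d) (fromℤ≢0 d≢0) | inverse (fromℤ (Z ℤ.- X)) (fromℤ≢0 Z-X≢0)
    ...     | y , dy | z , Z-Xz = fromℤ X * z , fromℤ a * u , fromℤ b * u , fromℤ g * u , (begin
      fromℤ a * u * (fromℤ a * u) + fromℤ b * u * (fromℤ b * u) + fromℤ g * u * (fromℤ g * u)
        ≡⟨ solve 4 (λ a b g u → a :* u :* (a :* u) :+ b :* u :* (b :* u) :+ g :* u :* (g :* u) :=
             (a :* a :+ b :* b :+ g :* g) :* (u :* u)) refl (fromℤ a) (fromℤ b) (fromℤ g) u ⟩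
      (fromℤ a * fromℤ a + fromℤ b * fromℤ b + fromℤ g * fromℤ g) * (u * u)
        ≡⟨ cong (_* (u * u)) (trans (sym sum) (trans (cong fromℤ (sym e)) product)) ⟩
      c * (fromℤ d * fromℤ d) * (fromℤ Z * fromℤ Z - (1ℚ + T) * (fromℤ X * fromℤ X)) * (u * u)
        ≡⟨ solve 7 (λ c d Z X T y z → c :* (d :* d) :* (Z :* Z :- (con 1ℚ :+ T) :* (X :* X)) :* (y :* z :* (y :* z)) :=
             c :* (((Z :- X) :* z :+ X :* z) :* ((Z :- X) :* z :+ X :* z) :- (con 1ℚ :+ T) :* (X :* z :* (X :* z))) :* ((d :* y) :* (d :* y)))
             refl c (fromℤ d) (fromℤ Z) (fromℤ X) T y z ⟩
      c * (((fromℤ Z - fromℤ X) * z + l) * ((fromℤ Z - fromℤ X) * z + l) - (1ℚ + T) * (l * l)) * ((fromℤ d * y) * (fromℤ d * y))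
        ≡⟨ cong₂ (λ p q → c * ((p + l) * (p + l) - (1ℚ + T) * (l * l)) * (q * q))
             (trans (cong (_* z) (sym (fromℤ-- Z X))) Z-Xz) dy ⟩
      c * ((1ℚ + l) * (1ℚ + l) - (1ℚ + T) * (l * l)) * (1ℚ * 1ℚ)
        ≡⟨ solve 3 (λ c l T → c :* ((con 1ℚ :+ l) :* (con 1ℚ :+ l) :- (con 1ℚ :+ T) :* (l :* l)) :* (con 1ℚ :* con 1ℚ) :=
             c :* (con 1ℚ :+ (l :+ l) :- T :* (l :* l))) refl c l T ⟩
      c * (1ℚ + (l + l) - T * (l * l)) ∎)
      where
      open ≡-Reasoning
      u l T : ℚ
      u = y * z
      l = fromℤ X * z
      T = fromℤ (ℤ.+ (4 ℕ.* t))
      sum : fromℤ (a ℤ.* a ℤ.+ b ℤ.* b ℤ.+ g ℤ.* g) ≡ fromℤ a * fromℤ a + fromℤ b * fromℤ b + fromℤ g * fromℤ g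
      sum = trans (fromℤ-+ (a ℤ.* a ℤ.+ b ℤ.* b) (g ℤ.* g)) (cong₂ _+_
          (trans (fromℤ-+ (a ℤ.* a) (b ℤ.* b)) (cong₂ _+_ (fromℤ-* a a) (fromℤ-* b b))) (fromℤ-* g g))
      product : fromℤ (ℤ.+ suc n ℤ.* (Z ℤ.* Z ℤ.- ℤ.+ (1 ℕ.+ 4 ℕ.* t) ℤ.* (X ℤ.* X))) ≡
        c * (fromℤ d * fromℤ d) * (fromℤ Z * fromℤ Z - (1ℚ + T) * (fromℤ X * fromℤ X))
      product = trans (fromℤ-* (ℤ.+ suc n) (Z ℤ.* Z ℤ.- ℤ.+ (1 ℕ.+ 4 ℕ.* t) ℤ.* (X ℤ.* X))) (cong₂ _*_ (sym cd)
        (trans (fromℤ-- (Z ℤ.* Z) (ℤ.+ (1 ℕ.+ 4 ℕ.* t) ℤ.* (X ℤ.* X))) (cong₂ _-_ (fromℤ-* Z Z)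
          (trans (fromℤ-* (ℤ.+ (1 ℕ.+ 4 ℕ.* t)) (X ℤ.* X)) (cong₂ _*_ (fromℤ-+ ℤ.1ℤ (ℤ.+ (4 ℕ.* t))) (fromℤ-* X X))))))

  sumFin-cong : ∀ {n} {f g : Fin n → ℚ} → (∀ i → f i ≡ g i) → sumFin f ≡ sumFin g
  sumFin-cong {zero}  e = refl
  sumFin-cong {suc n} e = cong₂ _+_ (e zero) (sumFin-cong (e ∘ suc))

  sumFin-zero : ∀ {n} {f : Fin n → ℚ} → (∀ i → f i ≡ 0ℚ) → sumFin f ≡ 0ℚ
  sumFin-zero {zero}  e = refl
  sumFin-zero {suc n} e = cong₂ _+_ (e zero) (sumFin-zero (e ∘ suc))

  sumFin-+ : ∀ {n} (f g : Fin n → ℚ) → sumFin (λ i → f i + g i) ≡ sumFin f + sumFin g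
  sumFin-+ {zero}  f g = refl
  sumFin-+ {suc n} f g = trans (cong (f zero + g zero +_) (sumFin-+ (f ∘ suc) (g ∘ suc)))
    (solve 4 (λ a b c d → (a :+ b) :+ (c :+ d) := (a :+ c) :+ (b :+ d)) refl (f zero) (g zero) (sumFin (f ∘ suc)) (sumFin (g ∘ suc)))

  sumFin-*ˡ : ∀ {n} c (f : Fin n → ℚ) → sumFin (λ i → c * f i) ≡ c * sumFin f
  sumFin-*ˡ {zero}  c f = sym (ℚ.*-zeroʳ c)
  sumFin-*ˡ {suc n} c f = trans (cong (c * f zero +_) (sumFin-*ˡ c (f ∘ suc))) (sym (ℚ.*-distribˡ-+ c (f zero) (sumFin (f ∘ suc))))

  sumFin-swap : ∀ {m n} (f : Fin m → Fin n → ℚ) → sumFin (λ i → sumFin (f i)) ≡ sumFin (λ j → sumFin (λ i → f i j))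
  sumFin-swap {zero} {n} f = sym (sumFin-zero {n} λ _ → refl)
  sumFin-swap {suc m} f = trans (cong (sumFin (f zero) +_) (sumFin-swap (f ∘ suc))) (sym (sumFin-+ (f zero) (λ j → sumFin (λ i → f (suc i) j))))

  sumFin-punchIn : ∀ {n} (f : Fin (suc n) → ℚ) k → sumFin f ≡ f k + sumFin (f ∘ punchIn k)
  sumFin-punchIn f zero = refl
  sumFin-punchIn {suc n} f (suc k) = trans (cong (f zero +_) (sumFin-punchIn (f ∘ suc) k))
    (solve 3 (λ a b c → a :+ (b :+ c) := b :+ (a :+ c)) refl (f zero) (f (suc k)) (sumFin (f ∘ suc ∘ punchIn k)))

  _·_ : ∀ {n} → Point n → Point n → ℚ
  p · q = sumFin λ i → p i * q i

  ·-comm : ∀ {n} (p q : Point n) → p · q ≡ q · p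
  ·-comm p q = sumFin-cong λ i → ℚ.*-comm (p i) (q i)

  sqDist-· : ∀ {n} (p q : Point n) → sqDist p q ≡ p · p + q · q - (p · q + p · q)
  sqDist-· {zero}  p q = refl
  sqDist-· {suc n} p q = trans (cong ((p zero - q zero) * (p zero - q zero) +_) (sqDist-· (p ∘ suc) (q ∘ suc)))
    (solve 5 (λ a b x y z → (a :- b) :* (a :- b) :+ (x :+ y :- (z :+ z)) := (a :* a :+ x) :+ (b :* b :+ y) :- ((a :* b :+ z) :+ (a :* b :+ z)))
      refl (p zero) (q zero) ((p ∘ suc) · (p ∘ suc)) ((q ∘ suc) · (q ∘ suc)) ((p ∘ suc) · (q ∘ suc)))

  cons₄ : ∀ {n} → ℚ → ℚ → ℚ → ℚ → Point n → Point (4 ℕ.+ n)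
  cons₄ a b c d p zero                         = a
  cons₄ a b c d p (suc zero)                   = b
  cons₄ a b c d p (suc (suc zero))             = c
  cons₄ a b c d p (suc (suc (suc zero)))       = d
  cons₄ a b c d p (suc (suc (suc (suc i))))    = p i

  origin : ∀ {n} → Point n
  origin _ = 0ℚ

  ·-originˡ : ∀ {n} (p : Point n) → origin · p ≡ 0ℚ
  ·-originˡ p = sumFin-zero λ i → ℚ.*-zeroˡ (p i)

  ·-originʳ : ∀ {n} (p : Point n) → p · origin ≡ 0ℚ
  ·-originʳ p = sumFin-zero λ i → ℚ.*-zeroʳ (p i)

  -- Multiplying a quaternion a + bi + cj + dk by units gives four orthogonal vectors of the same norm.
  module Frame (a b c d : ℚ) where

    s : ℚ
    s = a * a + b * b + c * c + d * d

    block : Fin 4 → ∀ {n} → Point (4 ℕ.+ n)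
    block zero                   = cons₄ a b c d origin
    block (suc zero)             = cons₄ (- b) a (- d) c origin
    block (suc (suc zero))       = cons₄ (- c) d a (- b) origin
    block (suc (suc (suc zero))) = cons₄ (- d) (- c) b a origin

    private
      o·o : ∀ n → _·_ {n} origin origin ≡ 0ℚ
      o·o n = ·-originˡ {n} origin

    block-norm : ∀ i {n} → block i · block i {n} ≡ s
    block-norm zero {n} rewrite o·o n =
      solve 4 (λ a b c d → a :* a :+ (b :* b :+ (c :* c :+ (d :* d :+ con 0ℚ))) := a :* a :+ b :* b :+ c :* c :+ d :* d) refl a b c d
    block-norm (suc zero) {n} rewrite o·o n =
      solve 4 (λ a b c d → (:- b) :* (:- b) :+ (a :* a :+ ((:- d) :* (:- d) :+ (c :* c :+ con 0ℚ))) := a :* a :+ b :* b :+ c :* c :+ d :* d) refl a b c d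
    block-norm (suc (suc zero)) {n} rewrite o·o n =
      solve 4 (λ a b c d → (:- c) :* (:- c) :+ (d :* d :+ (a :* a :+ ((:- b) :* (:- b) :+ con 0ℚ))) := a :* a :+ b :* b :+ c :* c :+ d :* d) refl a b c d
    block-norm (suc (suc (suc zero))) {n} rewrite o·o n =
      solve 4 (λ a b c d → (:- d) :* (:- d) :+ ((:- c) :* (:- c) :+ (b :* b :+ (a :* a :+ con 0ℚ))) := a :* a :+ b :* b :+ c :* c :+ d :* d) refl a b c d

    block-orthogonal< : ∀ i j → i Data.Fin.< j → ∀ {n} → block i · block j {n} ≡ 0ℚ
    block-orthogonal< zero zero ()
    block-orthogonal< zero (suc zero) _ {n} rewrite o·o n =
      solve 4 (λ a b c d → a :* (:- b) :+ (b :* a :+ (c :* (:- d) :+ (d :* c :+ con 0ℚ))) := con 0ℚ) refl a b c d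
    block-orthogonal< zero (suc (suc zero)) _ {n} rewrite o·o n =
      solve 4 (λ a b c d → a :* (:- c) :+ (b :* d :+ (c :* a :+ (d :* (:- b) :+ con 0ℚ))) := con 0ℚ) refl a b c d
    block-orthogonal< zero (suc (suc (suc zero))) _ {n} rewrite o·o n =
      solve 4 (λ a b c d → a :* (:- d) :+ (b :* (:- c) :+ (c :* b :+ (d :* a :+ con 0ℚ))) := con 0ℚ) refl a b c d
    block-orthogonal< (suc zero) (suc zero) (s≤s ())
    block-orthogonal< (suc zero) (suc (suc zero)) _ {n} rewrite o·o n =
      solve 4 (λ a b c d → (:- b) :* (:- c) :+ (a :* d :+ ((:- d) :* a :+ (c :* (:- b) :+ con 0ℚ))) := con 0ℚ) refl a b c d
    block-orthogonal< (suc zero) (suc (suc (suc zero))) _ {n} rewrite o·o n =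
      solve 4 (λ a b c d → (:- b) :* (:- d) :+ (a :* (:- c) :+ ((:- d) :* b :+ (c :* a :+ con 0ℚ))) := con 0ℚ) refl a b c d
    block-orthogonal< (suc (suc zero)) (suc zero) (s≤s ())
    block-orthogonal< (suc (suc zero)) (suc (suc zero)) (s≤s (s≤s ()))
    block-orthogonal< (suc (suc zero)) (suc (suc (suc zero))) _ {n} rewrite o·o n =
      solve 4 (λ a b c d → (:- c) :* (:- d) :+ (d :* (:- c) :+ (a :* b :+ ((:- b) :* a :+ con 0ℚ))) := con 0ℚ) refl a b c d
    block-orthogonal< (suc (suc (suc zero))) (suc zero) (s≤s ())
    block-orthogonal< (suc (suc (suc zero))) (suc (suc zero)) (s≤s (s≤s ()))
    block-orthogonal< (suc (suc (suc zero))) (suc (suc (suc zero))) (s≤s (s≤s (s≤s ())))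

    block-orthogonal : ∀ i j → i ≢ j → ∀ {n} → block i · block j {n} ≡ 0ℚ
    block-orthogonal i j i≢j {n} with Fin.<-cmp i j
    ... | tri< i<j _ _ = block-orthogonal< i j i<j
    ... | tri≈ _ i≡j _ = ⊥-elim (i≢j i≡j)
    ... | tri> _ _ j<i = trans (·-comm (block i {n}) (block j)) (block-orthogonal< j i j<i)

    pad : ∀ {n} → Point n → Point (4 ℕ.+ n)
    pad = cons₄ 0ℚ 0ℚ 0ℚ 0ℚ

    cons₄·pad : ∀ x y z w {n} (p q : Point n) → cons₄ x y z w p · pad q ≡ p · q
    cons₄·pad x y z w p q = solve 5 (λ x y z w r → x :* con 0ℚ :+ (y :* con 0ℚ :+ (z :* con 0ℚ :+ (w :* con 0ℚ :+ r))) := r)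
      refl x y z w (p · q)

    block·pad : ∀ i {n} (q : Point n) → block i · pad q ≡ 0ℚ
    block·pad zero                   q = trans (cons₄·pad a b c d origin q) (·-originˡ q)
    block·pad (suc zero)             q = trans (cons₄·pad (- b) a (- d) c origin q) (·-originˡ q)
    block·pad (suc (suc zero))       q = trans (cons₄·pad (- c) d a (- b) origin q) (·-originˡ q)
    block·pad (suc (suc (suc zero))) q = trans (cons₄·pad (- d) (- c) b a origin q) (·-originˡ q)

    -- The quaternion blocks sit along the diagonal. The last r coordinates stay zero and leave room
    -- for the vector `w` of the apex.
    frame : ∀ t r → Fin (t ℕ.* 4) → Point (t ℕ.* 4 ℕ.+ r)
    frame (suc t) r i = [ (λ j → block j) , (λ j → pad (frame t r j)) ]′ (splitAt 4 i)

    frame-norm : ∀ t r i → frame t r i · frame t r i ≡ s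
    frame-norm (suc t) r i with splitAt 4 i
    ... | inj₁ j = block-norm j
    ... | inj₂ j = trans (cons₄·pad 0ℚ 0ℚ 0ℚ 0ℚ (frame t r j) (frame t r j)) (frame-norm t r j)

    frame-orthogonal : ∀ t r i j → i ≢ j → frame t r i · frame t r j ≡ 0ℚ
    frame-orthogonal (suc t) r i j i≢j with splitAt 4 i in eᵢ | splitAt 4 j in eⱼ
    ... | inj₁ x | inj₁ y = block-orthogonal x y λ { refl → i≢j (trans (sym (Fin.splitAt⁻¹-↑ˡ eᵢ)) (Fin.splitAt⁻¹-↑ˡ eⱼ)) }
    ... | inj₁ x | inj₂ y = block·pad x (frame t r y)
    ... | inj₂ x | inj₁ y = trans (·-comm (pad (frame t r x)) (block y)) (block·pad y (frame t r x))
    ... | inj₂ x | inj₂ y = trans (cons₄·pad 0ℚ 0ℚ 0ℚ 0ℚ (frame t r x) (frame t r y))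
      (frame-orthogonal t r x y λ { refl → i≢j (trans (sym (Fin.splitAt⁻¹-↑ʳ {4} eᵢ)) (Fin.splitAt⁻¹-↑ʳ {4} eⱼ)) })

    -- Pythagoras: orthogonal vectors of squared norm s have squared distance 2s. This is why D is
    -- halved before it is written as a sum of four squares.
    frame-clique : ∀ t r → HasClique (t ℕ.* 4 ℕ.+ r) (s + s) (t ℕ.* 4)
    frame-clique t r = frame t r , λ i j i≢j → trans (sqDist-· (frame t r i) (frame t r j))
      (trans (cong₂ (λ x y → x - (y + y)) (cong₂ _+_ (frame-norm t r i) (frame-norm t r j)) (frame-orthogonal t r i j i≢j))
        (solve 1 (λ s → s :+ s :- (con 0ℚ :+ con 0ℚ) := s :+ s) refl s))

    -- The first coordinates of the apex are those of l Σᵢ frame i.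
    module Apex {r : ℕ} (l : ℚ) (w : Point r) where

      apex : ∀ t → Point (t ℕ.* 4 ℕ.+ r)
      apex zero    = w
      apex (suc t) = cons₄ (l * (a - b - c - d)) (l * (a + b - c + d)) (l * (a + b + c - d)) (l * (a - b + c + d)) (apex t)

      apex-block : ∀ t j → apex (suc t) · block j ≡ l * s
      apex-block t zero rewrite ·-originʳ (apex t) =
        solve 5 (λ a b c d l → l :* (a :- b :- c :- d) :* a :+ (l :* (a :+ b :- c :+ d) :* b :+ (l :* (a :+ b :+ c :- d) :* c :+ (l :* (a :- b :+ c :+ d) :* d :+ con 0ℚ))) :=
          l :* (a :* a :+ b :* b :+ c :* c :+ d :* d)) refl a b c d l
      apex-block t (suc zero) rewrite ·-originʳ (apex t) =
        solve 5 (λ a b c d l → l :* (a :- b :- c :- d) :* (:- b) :+ (l :* (a :+ b :- c :+ d) :* a :+ (l :* (a :+ b :+ c :- d) :* (:- d) :+ (l :* (a :- b :+ c :+ d) :* c :+ con 0ℚ))) :=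
          l :* (a :* a :+ b :* b :+ c :* c :+ d :* d)) refl a b c d l
      apex-block t (suc (suc zero)) rewrite ·-originʳ (apex t) =
        solve 5 (λ a b c d l → l :* (a :- b :- c :- d) :* (:- c) :+ (l :* (a :+ b :- c :+ d) :* d :+ (l :* (a :+ b :+ c :- d) :* a :+ (l :* (a :- b :+ c :+ d) :* (:- b) :+ con 0ℚ))) :=
          l :* (a :* a :+ b :* b :+ c :* c :+ d :* d)) refl a b c d l
      apex-block t (suc (suc (suc zero))) rewrite ·-originʳ (apex t) =
        solve 5 (λ a b c d l → l :* (a :- b :- c :- d) :* (:- d) :+ (l :* (a :+ b :- c :+ d) :* (:- c) :+ (l :* (a :+ b :+ c :- d) :* b :+ (l :* (a :- b :+ c :+ d) :* a :+ con 0ℚ))) :=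
          l :* (a :* a :+ b :* b :+ c :* c :+ d :* d)) refl a b c d l

      apex-frame : ∀ t i → apex t · frame t r i ≡ l * s
      apex-frame (suc t) i with splitAt 4 i
      ... | inj₁ j = apex-block t j
      ... | inj₂ j = trans (cons₄·pad (l * (a - b - c - d)) (l * (a + b - c + d)) (l * (a + b + c - d)) (l * (a - b + c + d)) (apex t) (frame t r j)) (apex-frame t j)

      apex-norm : ∀ t → apex t · apex t ≡ w · w + fromℤ (ℤ.+ (t ℕ.* 4)) * (l * l) * s
      apex-norm zero = solve 3 (λ x l s → x := x :+ con 0ℚ :* (l :* l) :* s) refl (w · w) l s
      apex-norm (suc t) = trans (cong (λ x → α * α + (β * β + (γ * γ + (δ * δ + x)))) (apex-norm t))
        (trans (solve 7 (λ a b c d l x T →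
            l :* (a :- b :- c :- d) :* (l :* (a :- b :- c :- d)) :+ (l :* (a :+ b :- c :+ d) :* (l :* (a :+ b :- c :+ d)) :+
            (l :* (a :+ b :+ c :- d) :* (l :* (a :+ b :+ c :- d)) :+ (l :* (a :- b :+ c :+ d) :* (l :* (a :- b :+ c :+ d)) :+
            (x :+ T :* (l :* l) :* (a :* a :+ b :* b :+ c :* c :+ d :* d))))) :=
            x :+ (con (fromℤ (ℤ.+ 4)) :+ T) :* (l :* l) :* (a :* a :+ b :* b :+ c :* c :+ d :* d))
            refl a b c d l (w · w) (fromℤ (ℤ.+ (t ℕ.* 4))))
          (cong (λ x → w · w + x * (l * l) * s) (sym (fromℤ-+ (ℤ.+ 4) (ℤ.+ (t ℕ.* 4))))))
        where
        α β γ δ : ℚ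
        α = l * (a - b - c - d)
        β = l * (a + b - c + d)
        γ = l * (a + b + c - d)
        δ = l * (a - b + c + d)

      simplex : ∀ t → Fin (suc (t ℕ.* 4)) → Point (t ℕ.* 4 ℕ.+ r)
      simplex t zero    = apex t
      simplex t (suc i) = frame t r i

      -- The squared norm of the apex is |w|² + 4t l² s and its product with every frame vector is l
      -- s. The hypothesis is the equation |w|² + 4t l² s + s - 2 l s = 2 s solved for |w|².
      apex-dist : ∀ t → w · w ≡ s * (1ℚ + (l + l) - fromℤ (ℤ.+ (t ℕ.* 4)) * (l * l)) → ∀ i → sqDist (apex t) (frame t r i) ≡ s + s
      apex-dist t e i = trans (sqDist-· (apex t) (frame t r i))
        (trans (cong₂ (λ x y → x - (y + y)) (cong₂ _+_ (trans (apex-norm t) (cong (_+ fromℤ (ℤ.+ (t ℕ.* 4)) * (l * l) * s) e)) (frame-norm t r i)) (apex-frame t i))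
          (solve 3 (λ s l T → s :* (con 1ℚ :+ (l :+ l) :- T :* (l :* l)) :+ T :* (l :* l) :* s :+ s :- (l :* s :+ l :* s) := s :+ s)
            refl s l (fromℤ (ℤ.+ (t ℕ.* 4)))))

      sqDist-sym : ∀ {n} (p q : Point n) → sqDist p q ≡ sqDist q p
      sqDist-sym p q = sumFin-cong λ i → solve 2 (λ a b → (a :- b) :* (a :- b) := (b :- a) :* (b :- a)) refl (p i) (q i)

      simplex-clique : ∀ t → w · w ≡ s * (1ℚ + (l + l) - fromℤ (ℤ.+ (t ℕ.* 4)) * (l * l)) →
        HasClique (t ℕ.* 4 ℕ.+ r) (s + s) (suc (t ℕ.* 4))
      simplex-clique t e = simplex t , dist
        where
        dist : ∀ i j → i ≢ j → sqDist (simplex t i) (simplex t j) ≡ s + s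
        dist zero    zero    0≢0 = ⊥-elim (0≢0 refl)
        dist zero    (suc j) _   = apex-dist t e j
        dist (suc i) zero    _   = trans (sqDist-sym (frame t r i) (apex t)) (apex-dist t e i)
        dist (suc i) (suc j) i≢j = proj₂ (frame-clique t r) i j (i≢j ∘ cong suc)

  half : ∀ D → 0ℚ < D → ∃ λ c → 0ℚ < c × c + c ≡ D
  half D D>0 = ½ * D , 0<½D , trans (sym (ℚ.*-distribʳ-+ D ½ ½)) (ℚ.*-identityˡ D)
    where
    0<½D : 0ℚ < ½ * D
    0<½D = subst (_< ½ * D) (ℚ.*-zeroʳ ½) (ℚ.*-monoʳ-<-pos ½ D>0)

  clique-frame : ∀ D → 0ℚ < D → ∀ t r → HasClique (t ℕ.* 4 ℕ.+ r) D (t ℕ.* 4)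
  clique-frame D D>0 t r with half D D>0
  ... | q , q>0 , refl with rational-four-squares q q>0
  ...   | a , b , c , d , refl = Frame.frame-clique a b c d t r

  clique-simplex : ∀ D → 0ℚ < D → ∀ t → HasClique (t ℕ.* 4 ℕ.+ 3) D (suc (t ℕ.* 4))
  clique-simplex D D>0 t with half D D>0
  ... | q , q>0 , refl with rational-four-squares q q>0
  ...   | a , b , c , d , refl with rational-ternary t (a * a + b * b + c * c + d * d) q>0
  ...     | l , x , y , z , e = Frame.Apex.simplex-clique a b c d l w t (trans
    (solve 3 (λ x y z → x :* x :+ (y :* y :+ (z :* z :+ con 0ℚ)) := x :* x :+ y :* y :+ z :* z) refl x y z)
    (trans e (cong (λ n → (a * a + b * b + c * c + d * d) * (1ℚ + (l + l) - fromℤ (ℤ.+ n) * (l * l))) (ℕ.*-comm 4 t))))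
    where
    w : Point 3
    w zero             = x
    w (suc zero)       = y
    w (suc (suc zero)) = z

  -- Linear dependence and the upper bound n + 1

  *-cancel-0 : ∀ {x} → x ≢ 0ℚ → ∀ y → x * y ≡ 0ℚ → y ≡ 0ℚ
  *-cancel-0 {x} x≢0 y e with inverse x x≢0
  ... | z , xz = begin
    y  ≡⟨ sym (ℚ.*-identityˡ y) ⟩
    1ℚ * y  ≡⟨ cong (_* y) (sym xz) ⟩
    x * z * y  ≡⟨ solve 3 (λ x y z → x :* z :* y := x :* y :* z) refl x y z ⟩
    x * y * z  ≡⟨ cong (_* z) e ⟩
    0ℚ * z  ≡⟨ ℚ.*-zeroˡ z ⟩
    0ℚ ∎
    where open ≡-Reasoning

  Dependence : ∀ {m n} → (Fin m → Point n) → Set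
  Dependence {m} v = ∃ λ (l : Fin m → ℚ) → (∃ λ i → l i ≢ 0ℚ) × (∀ x → sumFin (λ i → l i * v i x) ≡ 0ℚ)

  reduce : ∀ {m n} → (Fin (suc m) → Point n) → Fin (suc m) → (Fin m → ℚ) → Fin m → Point n
  reduce v k a i x = v (punchIn k i) x - a i * v k x

  -- Expanding the reduced vectors, the k-th vector collects the coefficient -Σ μᵢ aᵢ, and the other
  -- coefficients are unchanged, so a nonzero one survives.
  eliminate : ∀ {m n} (v : Fin (suc m) → Point n) k a → Dependence (reduce v k a) → Dependence v
  eliminate v k a (μ , (i₀ , μi₀) , e) = l , (punchIn k i₀ , λ z → μi₀ (trans (sym (insertAt-punchIn μ k c i₀)) z)) , λ x → begin
    sumFin (λ i → l i * v i x)
      ≡⟨ sumFin-punchIn (λ i → l i * v i x) k ⟩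
    l k * v k x + sumFin (λ i → l (punchIn k i) * v (punchIn k i) x)
      ≡⟨ cong₂ _+_ (cong (_* v k x) (insertAt-lookup μ k c)) (sumFin-cong λ i → cong (_* v (punchIn k i) x) (insertAt-punchIn μ k c i)) ⟩
    c * v k x + sumFin (λ i → μ i * v (punchIn k i) x)
      ≡⟨ cong (_+ sumFin (λ i → μ i * v (punchIn k i) x)) (solve 2 (λ s y → :- s :* y := (:- y) :* s) refl (sumFin (λ i → μ i * a i)) (v k x)) ⟩
    (- v k x) * sumFin (λ i → μ i * a i) + sumFin (λ i → μ i * v (punchIn k i) x)
      ≡⟨ cong (_+ sumFin (λ i → μ i * v (punchIn k i) x)) (sym (sumFin-*ˡ (- v k x) (λ i → μ i * a i))) ⟩
    sumFin (λ i → (- v k x) * (μ i * a i)) + sumFin (λ i → μ i * v (punchIn k i) x)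
      ≡⟨ sym (sumFin-+ (λ i → (- v k x) * (μ i * a i)) (λ i → μ i * v (punchIn k i) x)) ⟩
    sumFin (λ i → (- v k x) * (μ i * a i) + μ i * v (punchIn k i) x)
      ≡⟨ (sumFin-cong λ i → solve 4 (λ y m b z → (:- y) :* (m :* b) :+ m :* z := m :* (z :- b :* y)) refl (v k x) (μ i) (a i) (v (punchIn k i) x)) ⟩
    sumFin (λ i → μ i * (v (punchIn k i) x - a i * v k x))
      ≡⟨ e x ⟩
    0ℚ ∎
    where
    open ≡-Reasoning
    c : ℚ
    c = - sumFin (λ i → μ i * a i)
    l : Fin _ → ℚ
    l = insertAt μ k c

  dependence-tail : ∀ {m n} (v : Fin m → Point (suc n)) → (∀ i → v i zero ≡ 0ℚ) → Dependence (λ i → v i ∘ suc) → Dependence v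
  dependence-tail v z (l , nz , e) = l , nz , λ
    { zero    → sumFin-zero λ i → trans (cong (l i *_) (z i)) (ℚ.*-zeroʳ (l i))
    ; (suc x) → e x }

  -- Gaussian elimination: a vector with nonzero first coordinate clears that coordinate from the
  -- others, and induction applies to their tails.
  dependent : ∀ n (v : Fin (suc n) → Point n) → Dependence v
  dependent zero    v = (λ _ → 1ℚ) , (zero , λ ()) , λ ()
  dependent (suc n) v with Fin.any? (λ i → ¬? (v i zero ℚ.≟ 0ℚ))
  ... | yes (k , vk≢0) with inverse (v k zero) vk≢0
  ...   | y , vky = eliminate v k a (dependence-tail (reduce v k a) zeros (dependent n λ i → reduce v k a i ∘ suc))
    where
    a : Fin (suc n) → ℚ
    a i = v (punchIn k i) zero * y
    zeros : ∀ i → v (punchIn k i) zero - a i * v k zero ≡ 0ℚ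
    zeros i = trans (solve 3 (λ p q y → p :- p :* y :* q := p :* (con 1ℚ :- q :* y)) refl (v (punchIn k i) zero) (v k zero) y)
      (trans (cong (λ t → v (punchIn k i) zero * (1ℚ - t)) vky) (ℚ.*-zeroʳ (v (punchIn k i) zero)))
  -- Without a pivot all first coordinates vanish already. With a = 0 the reduction only discards
  -- one vector, as the induction requires.
  dependent (suc n) v | no none = eliminate v zero a
    (dependence-tail (reduce v zero a) (λ i → cong₂ (λ p q → p - 0ℚ * q) (zeros (suc i)) (zeros zero)) (dependent n λ i → reduce v zero a i ∘ suc))
    where
    a : Fin (suc n) → ℚ
    a _ = 0ℚ
    zeros : ∀ i → v i zero ≡ 0ℚ
    zeros i = decidable-stable (v i zero ℚ.≟ 0ℚ) λ ne → none (i , ne)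

  -- Stated for twice the inner product, which avoids a division by two in the Gram matrix of a
  -- clique.
  polarization : ∀ {n} (p q z : Point n) →
    (λ x → p x - z x) · (λ x → q x - z x) + (λ x → p x - z x) · (λ x → q x - z x) ≡ sqDist p z + sqDist q z - sqDist p q
  polarization {zero}  p q z = refl
  polarization {suc n} p q z = trans
    (solve 4 (λ p q z s → ((p :- z) :* (q :- z) :+ s) :+ ((p :- z) :* (q :- z) :+ s) := ((p :- z) :* (p :- z) :+ (q :- z) :* (q :- z) :- (p :- q) :* (p :- q)) :+ (s :+ s))
      refl (p zero) (q zero) (z zero) ((λ x → p (suc x) - z (suc x)) · (λ x → q (suc x) - z (suc x))))
    (trans (cong ((p zero - z zero) * (p zero - z zero) + (q zero - z zero) * (q zero - z zero) - (p zero - q zero) * (p zero - q zero) +_)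
        (polarization (p ∘ suc) (q ∘ suc) (z ∘ suc)))
      (solve 6 (λ a b c x y w → (a :+ b :- c) :+ (x :+ y :- w) := (a :+ x) :+ (b :+ y) :- (c :+ w)) refl
        ((p zero - z zero) * (p zero - z zero)) ((q zero - z zero) * (q zero - z zero)) ((p zero - q zero) * (p zero - q zero))
        (sqDist (p ∘ suc) (z ∘ suc)) (sqDist (q ∘ suc) (z ∘ suc)) (sqDist (p ∘ suc) (q ∘ suc))))

  sumFin-const : ∀ n c → sumFin {n} (λ _ → c) ≡ fromℤ (ℤ.+ n) * c
  sumFin-const zero    c = sym (ℚ.*-zeroˡ c)
  sumFin-const (suc n) c = trans (cong (c +_) (sumFin-const n c))
    (trans (solve 2 (λ c t → c :+ t :* c := (con 1ℚ :+ t) :* c) refl c (fromℤ (ℤ.+ n))) (cong (_* c) (sym (fromℤ-+ ℤ.1ℤ (ℤ.+ n)))))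

  -- Pairing a dependence Σ lᵢ uᵢ = 0 with uⱼ gives D (lⱼ + Λ) = 0 with Λ = Σ lᵢ, and summing over j gives (n + 2) Λ = 0.
  no-larger-clique : ∀ n D → D ≢ 0ℚ → ¬ HasClique n D (2 ℕ.+ n)
  no-larger-clique n D D≢0 (f , dist) with dependent n (λ i x → f (suc i) x - f zero x)
  ... | l , (i₀ , li₀) , e = li₀ (trans (sym (ℚ.+-identityʳ (l i₀))) (trans (cong (l i₀ +_) (sym Λ≡0)) (l+Λ i₀)))
    where
    open ≡-Reasoning
    u : Fin (suc n) → Point n
    u i x = f (suc i) x - f zero x
    Λ : ℚ
    Λ = sumFin l
    gram : ∀ i j → i ≢ j → u i · u j + u i · u j ≡ D
    gram i j i≢j = trans (polarization (f (suc i)) (f (suc j)) (f zero))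
      (trans (cong₂ _-_ (cong₂ _+_ (dist (suc i) zero λ ()) (dist (suc j) zero λ ())) (dist (suc i) (suc j) (i≢j ∘ Fin.suc-injective)))
        (solve 1 (λ D → D :+ D :- D := D) refl D))
    gram-diag : ∀ i → u i · u i + u i · u i ≡ D + D
    gram-diag i = trans (polarization (f (suc i)) (f (suc i)) (f zero))
      (trans (cong₂ _-_ (cong₂ _+_ (dist (suc i) zero λ ()) (dist (suc i) zero λ ()))
          (sumFin-zero λ x → solve 1 (λ a → (a :- a) :* (a :- a) := con 0ℚ) refl (f (suc i) x)))
        (solve 1 (λ D → D :+ D :- con 0ℚ := D :+ D) refl D))
    orthogonal : ∀ j → sumFin (λ i → l i * (u i · u j)) ≡ 0ℚ
    orthogonal j = begin
      sumFin (λ i → l i * sumFin (λ x → u i x * u j x))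
        ≡⟨ (sumFin-cong λ i → trans (sym (sumFin-*ˡ (l i) (λ x → u i x * u j x))) (sumFin-cong λ x → sym (ℚ.*-assoc (l i) (u i x) (u j x)))) ⟩
      sumFin (λ i → sumFin (λ x → l i * u i x * u j x))
        ≡⟨ sumFin-swap (λ i x → l i * u i x * u j x) ⟩
      sumFin (λ x → sumFin (λ i → l i * u i x * u j x))
        ≡⟨ (sumFin-zero λ x → trans (sumFin-cong λ i → ℚ.*-comm (l i * u i x) (u j x))
              (trans (sumFin-*ˡ (u j x) (λ i → l i * u i x)) (trans (cong (u j x *_) (e x)) (ℚ.*-zeroʳ (u j x))))) ⟩
      0ℚ ∎
    l+Λ : ∀ j → l j + Λ ≡ 0ℚ
    l+Λ j = *-cancel-0 D≢0 (l j + Λ) (begin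
      D * (l j + Λ)
        ≡⟨ cong (λ t → D * (l j + t)) (sumFin-punchIn l j) ⟩
      D * (l j + (l j + sumFin (l ∘ punchIn j)))
        ≡⟨ solve 3 (λ D a b → D :* (a :+ (a :+ b)) := a :* (D :+ D) :+ D :* b) refl D (l j) (sumFin (l ∘ punchIn j)) ⟩
      l j * (D + D) + D * sumFin (l ∘ punchIn j)
        ≡⟨ cong₂ _+_ (cong (l j *_) (sym (gram-diag j)))
             (trans (sym (sumFin-*ˡ D (l ∘ punchIn j))) (sumFin-cong λ i → trans (ℚ.*-comm D (l (punchIn j i)))
               (cong (l (punchIn j i) *_) (sym (gram (punchIn j i) j (Fin.punchInᵢ≢i j i)))))) ⟩
      l j * (u j · u j + u j · u j) + sumFin (λ i → l (punchIn j i) * (u (punchIn j i) · u j + u (punchIn j i) · u j))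
        ≡⟨ sym (sumFin-punchIn (λ i → l i * (u i · u j + u i · u j)) j) ⟩
      sumFin (λ i → l i * (u i · u j + u i · u j))
        ≡⟨ trans (sumFin-cong λ i → ℚ.*-distribˡ-+ (l i) (u i · u j) (u i · u j)) (sumFin-+ (λ i → l i * (u i · u j)) (λ i → l i * (u i · u j))) ⟩
      sumFin (λ i → l i * (u i · u j)) + sumFin (λ i → l i * (u i · u j))
        ≡⟨ cong₂ _+_ (orthogonal j) (orthogonal j) ⟩
      0ℚ ∎)
    Λ≡0 : Λ ≡ 0ℚ
    Λ≡0 = *-cancel-0 (fromℤ≢0 {ℤ.+ (2 ℕ.+ n)} λ ()) Λ (begin
      fromℤ (ℤ.+ (2 ℕ.+ n)) * Λ
        ≡⟨ sym (sumFin-const (2 ℕ.+ n) Λ) ⟩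
      Λ + sumFin {suc n} (λ _ → Λ)
        ≡⟨ sym (sumFin-+ l (λ _ → Λ)) ⟩
      sumFin (λ i → l i + Λ)
        ≡⟨ sumFin-zero l+Λ ⟩
      0ℚ ∎)

  clique-bound : ∀ n D k → 0ℚ < D → HasClique n D k → k ℕ.≤ suc n
  clique-bound n D k D>0 (f , dist) with k ℕ.≤? suc n
  ... | yes k≤ = k≤
  ... | no k≰ = ⊥-elim (no-larger-clique n D (λ { refl → ℚ.<-irrefl refl D>0 })
    (f ∘ inject , λ i j i≢j → dist (inject i) (inject j) (i≢j ∘ Fin.inject≤-injective (ℕ.≰⇒> k≰) (ℕ.≰⇒> k≰) i j)))
    where
    inject : Fin (2 ℕ.+ n) → Fin k
    inject i = inject≤ i (ℕ.≰⇒> k≰)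

  clique-exists : ∀ n D → 0ℚ < D → ∃ λ k → HasClique n D k × suc n ℕ.≤ k ℕ.+ 3
  clique-exists n D D>0 = subst (λ n → ∃ λ k → HasClique n D k × suc n ℕ.≤ k ℕ.+ 3)
      (sym (trans (m≡m%n+[m/n]*n n 4) (ℕ.+-comm (n % 4) (n / 4 ℕ.* 4)))) (go (n / 4) (n % 4) (m%n<n n 4))
    where
    small : ∀ t r → r ℕ.< 3 → suc (t ℕ.* 4 ℕ.+ r) ℕ.≤ t ℕ.* 4 ℕ.+ 3
    small t r r<3 = ℕ.≤-trans (ℕ.≤-reflexive (sym (ℕ.+-suc (t ℕ.* 4) r))) (ℕ.+-monoʳ-≤ (t ℕ.* 4) r<3)
    go : ∀ t r → r ℕ.< 4 → ∃ λ k → HasClique (t ℕ.* 4 ℕ.+ r) D k × suc (t ℕ.* 4 ℕ.+ r) ℕ.≤ k ℕ.+ 3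
    -- For r = 3 the frame alone falls one point short of the required bound, and the apex supplies
    -- this point.
    go t 3 _ = suc (t ℕ.* 4) , clique-simplex D D>0 t , ℕ.≤-refl
    go t r@0 _ = t ℕ.* 4 , clique-frame D D>0 t r , small t r (s≤s z≤n)
    go t r@1 _ = t ℕ.* 4 , clique-frame D D>0 t r , small t r (s≤s (s≤s z≤n))
    go t r@2 _ = t ℕ.* 4 , clique-frame D D>0 t r , small t r (s≤s (s≤s (s≤s z≤n)))
    go t (suc (suc (suc (suc r)))) (s≤s (s≤s (s≤s (s≤s ()))))

  clique-gap : ∀ n M m → IsUpperCliqueNumber n M → IsLowerCliqueNumber n m → M ℕ.≤ m ℕ.+ 3
  clique-gap n M m ((D , D>0 , clique , _) , _) ((D′ , D′>0 , _ , _ , maximal) , _) with clique-exists n D′ D′>0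
  ... | k , clique′ , n<k+3 = ℕ.≤-trans (clique-bound n D M D>0 clique)
    (ℕ.≤-trans n<k+3 (ℕ.+-monoˡ-≤ 3 (maximal k clique′)))

open import Data.Nat using (_+_; _*_; _∸_; _≤_; _<_; _≟_; _≤?_)
open import Data.Nat.Induction using (<-rec)
open import Data.Nat.Tactic.RingSolver using () renaming (solve-∀ to ℕ-solve-∀)
open import Data.Integer using () renaming (+_ to pos; _+_ to _+ᶻ_; _*_ to _*ᶻ_; _-_ to _-ᶻ_; -_ to -ᶻ_)
open import Data.Integer.Solver using (module +-*-Solver)
open import Data.Bool using (Bool; true; false; not; _xor_)
open import Data.Bool.Properties using (xor-comm; xor-same)
open import Algebra.Properties.CommutativeSemigroup ℤ.+-commutativeSemigroup using (interchange)
open import Algebra.Properties.AbelianGroup ℤ.+-0-abelianGroup using (∙-cancelˡ)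

-- Rearranging finite sums of integers

sumTo : ℕ → (ℕ → ℤ) → ℤ
sumTo zero    f = 0ℤ
sumTo (suc k) f = f 0 +ᶻ sumTo k (f ∘ suc)

sumTo-cong : ∀ k {f g} → (∀ n → f n ≡ g n) → sumTo k f ≡ sumTo k g
sumTo-cong zero    e = refl
sumTo-cong (suc k) e = cong₂ _+ᶻ_ (e 0) (sumTo-cong k (e ∘ suc))

sumTo-zero : ∀ k {f} → (∀ n → f n ≡ 0ℤ) → sumTo k f ≡ 0ℤ
sumTo-zero zero    e = refl
sumTo-zero (suc k) e = cong₂ _+ᶻ_ (e 0) (sumTo-zero k (e ∘ suc))

sumTo-+ : ∀ k f g → sumTo k (λ n → f n +ᶻ g n) ≡ sumTo k f +ᶻ sumTo k g
sumTo-+ zero    f g = refl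
sumTo-+ (suc k) f g = trans (cong (f 0 +ᶻ g 0 +ᶻ_) (sumTo-+ k (f ∘ suc) (g ∘ suc)))
  (interchange (f 0) (g 0) (sumTo k (f ∘ suc)) (sumTo k (g ∘ suc)))

sumTo-*ˡ : ∀ k c f → sumTo k (λ n → c *ᶻ f n) ≡ c *ᶻ sumTo k f
sumTo-*ˡ zero    c f = sym (ℤ.*-zeroʳ c)
sumTo-*ˡ (suc k) c f = trans (cong (c *ᶻ f 0 +ᶻ_) (sumTo-*ˡ k c (f ∘ suc)))
  (sym (ℤ.*-distribˡ-+ c (f 0) (sumTo k (f ∘ suc))))

sumTo-neg : ∀ k f → sumTo k (λ n → -ᶻ f n) ≡ -ᶻ sumTo k f
sumTo-neg zero    f = refl
sumTo-neg (suc k) f = trans (cong (-ᶻ f 0 +ᶻ_) (sumTo-neg k (f ∘ suc)))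
  (sym (ℤ.neg-distrib-+ (f 0) (sumTo k (f ∘ suc))))

sumTo-swap : ∀ m n (f : ℕ → ℕ → ℤ) →
  sumTo m (λ i → sumTo n (f i)) ≡ sumTo n (λ j → sumTo m (λ i → f i j))
sumTo-swap zero    n f = sym (sumTo-zero n λ _ → refl)
sumTo-swap (suc m) n f =
  trans (cong (sumTo n (f 0) +ᶻ_) (sumTo-swap m n (f ∘ suc)))
        (sym (sumTo-+ n (f 0) _))

sumTo-++ : ∀ m n f → sumTo (m + n) f ≡ sumTo m f +ᶻ sumTo n (λ i → f (m + i))
sumTo-++ zero    n f = sym (ℤ.+-identityˡ _)
sumTo-++ (suc m) n f =
  trans (cong (f 0 +ᶻ_) (sumTo-++ m n (f ∘ suc))) (sym (ℤ.+-assoc (f 0) _ _))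

sumTo-extend : ∀ m n f → (∀ i → m ≤ i → f i ≡ 0ℤ) → sumTo (m + n) f ≡ sumTo m f
sumTo-extend m n f v = trans (sumTo-++ m n f)
  (trans (cong (sumTo m f +ᶻ_) (sumTo-zero n λ i → v (m + i) (ℕ.m≤m+n m i))) (ℤ.+-identityʳ _))

sumTo-below-diag : ∀ n (f : ℕ → ℕ → ℤ) →
  sumTo n (λ w → sumTo w (λ p → f p w)) ≡
  sumTo n (λ p → sumTo (n ∸ suc p) (λ d → f p (suc (p + d))))
sumTo-below-diag zero    f = refl
sumTo-below-diag (suc n) f = trans (ℤ.+-identityˡ _)
  (trans (sumTo-+ n (λ w → f 0 (suc w)) _)
         (cong (sumTo n (λ w → f 0 (suc w)) +ᶻ_) (sumTo-below-diag n (λ p w → f (suc p) (suc w)))))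

sumTo-odd : ∀ k f → (∀ n → f (suc (n + n)) ≡ 0ℤ) → sumTo (k + k) f ≡ sumTo k (λ n → f (n + n))
sumTo-odd zero    f e = refl
sumTo-odd (suc k) f e rewrite ℕ.+-suc k k = cong (f 0 +ᶻ_)
  (trans (cong (_+ᶻ sumTo (k + k) (f ∘ suc ∘ suc)) (e 0)) (trans (ℤ.+-identityˡ _)
  (trans (sumTo-odd k (f ∘ suc ∘ suc) λ n → trans (cong (f ∘ suc ∘ suc) (sym (ℕ.+-suc n n))) (e (suc n)))
         (sumTo-cong k λ n → cong (f ∘ suc) (sym (ℕ.+-suc n n))))))

sumTo-last : ∀ k f → sumTo (suc k) f ≡ sumTo k f +ᶻ f k
sumTo-last zero    f = ℤ.+-comm (f 0) 0ℤ
sumTo-last (suc k) f = trans (cong (f 0 +ᶻ_) (sumTo-last k (f ∘ suc)))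
  (sym (ℤ.+-assoc (f 0) (sumTo k (f ∘ suc)) (f (suc k))))

-- The square is cut at k in both coordinates, and symmetry identifies the two mixed rectangles.
sumTo-square-++ : ∀ k l (g : ℕ → ℕ → ℤ) → (∀ p q → g p q ≡ g q p) →
  sumTo (k + l) (λ p → sumTo (k + l) (g p)) ≡
  sumTo l (λ α → sumTo l (λ β → g (k + α) (k + β))) +ᶻ
  ((sumTo k (λ p → sumTo l (λ β → g p (k + β))) +ᶻ sumTo k (λ p → sumTo l (λ β → g p (k + β)))) +ᶻ
   sumTo k (λ p → sumTo k (g p)))
sumTo-square-++ k l g g-sym = begin
  sumTo (k + l) (λ p → sumTo (k + l) (g p))
    ≡⟨ sumTo-cong (k + l) (λ p → sumTo-++ k l (g p)) ⟩
  sumTo (k + l) (λ p → sumTo k (g p) +ᶻ sumTo l (λ β → g p (k + β)))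
    ≡⟨ sumTo-++ k l _ ⟩
  sumTo k (λ p → sumTo k (g p) +ᶻ sumTo l (λ β → g p (k + β))) +ᶻ
  sumTo l (λ α → sumTo k (g (k + α)) +ᶻ sumTo l (λ β → g (k + α) (k + β)))
    ≡⟨ cong₂ _+ᶻ_ (sumTo-+ k (λ p → sumTo k (g p)) _) (sumTo-+ l (λ α → sumTo k (g (k + α))) _) ⟩
  (lower +ᶻ mixed) +ᶻ (sumTo l (λ α → sumTo k (g (k + α))) +ᶻ upper)
    ≡⟨ cong (λ t → (lower +ᶻ mixed) +ᶻ (t +ᶻ upper))
         (trans (sumTo-swap l k _) (sumTo-cong k λ p → sumTo-cong l λ α → g-sym (k + α) p)) ⟩
  (lower +ᶻ mixed) +ᶻ (mixed +ᶻ upper)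
    ≡⟨ rearrange lower mixed upper ⟩
  upper +ᶻ ((mixed +ᶻ mixed) +ᶻ lower) ∎
  where
  open ≡-Reasoning
  lower mixed upper : ℤ
  lower = sumTo k (λ p → sumTo k (g p))
  mixed = sumTo k (λ p → sumTo l (λ β → g p (k + β)))
  upper = sumTo l (λ α → sumTo l (λ β → g (k + α) (k + β)))
  rearrange : ∀ a b c → (a +ᶻ b) +ᶻ (b +ᶻ c) ≡ c +ᶻ ((b +ᶻ b) +ᶻ a)
  rearrange = ℤ-solve-∀

sumTo-sym-square : ∀ k (g : ℕ → ℕ → ℤ) → (∀ p q → g p q ≡ g q p) →
  sumTo k (λ p → sumTo k (g p)) ≡
  sumTo k (λ p → g p p) +ᶻ (sumTo k (λ q → sumTo q (λ p → g p q)) +ᶻ sumTo k (λ q → sumTo q (λ p → g p q)))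
sumTo-sym-square zero    g g-sym = refl
sumTo-sym-square (suc k) g g-sym = begin
  sumTo (suc k) (λ p → sumTo (suc k) (g p))
    ≡⟨ sumTo-last k _ ⟩
  sumTo k (λ p → sumTo (suc k) (g p)) +ᶻ sumTo (suc k) (g k)
    ≡⟨ cong₂ _+ᶻ_ (trans (sumTo-cong k λ p → sumTo-last k (g p)) (sumTo-+ k (λ p → sumTo k (g p)) (λ p → g p k)))
                  (trans (sumTo-last k (g k)) (cong (_+ᶻ g k k) (sumTo-cong k (g-sym k)))) ⟩
  (sumTo k (λ p → sumTo k (g p)) +ᶻ c) +ᶻ (c +ᶻ g k k)
    ≡⟨ cong (λ t → (t +ᶻ c) +ᶻ (c +ᶻ g k k)) (sumTo-sym-square k g g-sym) ⟩
  ((d +ᶻ (l +ᶻ l)) +ᶻ c) +ᶻ (c +ᶻ g k k)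
    ≡⟨ rearrange d l c (g k k) ⟩
  (d +ᶻ g k k) +ᶻ ((l +ᶻ c) +ᶻ (l +ᶻ c))
    ≡⟨ sym (cong₂ (λ a b → a +ᶻ (b +ᶻ b)) (sumTo-last k (λ p → g p p)) (sumTo-last k (λ q → sumTo q (λ p → g p q)))) ⟩
  sumTo (suc k) (λ p → g p p) +ᶻ
  (sumTo (suc k) (λ q → sumTo q (λ p → g p q)) +ᶻ sumTo (suc k) (λ q → sumTo q (λ p → g p q))) ∎
  where
  open ≡-Reasoning
  c d l : ℤ
  c = sumTo k (λ p → g p k)
  d = sumTo k (λ p → g p p)
  l = sumTo k (λ q → sumTo q (λ p → g p q))
  rearrange : ∀ d l c e → ((d +ᶻ (l +ᶻ l)) +ᶻ c) +ᶻ (c +ᶻ e) ≡ (d +ᶻ e) +ᶻ ((l +ᶻ c) +ᶻ (l +ᶻ c))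
  rearrange = ℤ-solve-∀

-- Sums over all natural numbers of functions supported below B.
module Box (B : ℕ) where

  Supp : (ℕ → ℤ) → Set
  Supp f = ∀ n → B ≤ n → f n ≡ 0ℤ

  ∑ : (ℕ → ℤ) → ℤ
  ∑ = sumTo B

  ∑² : (ℕ → ℕ → ℤ) → ℤ
  ∑² f = ∑ λ a → ∑ (f a)

  ∑³ : (ℕ → ℕ → ℕ → ℤ) → ℤ
  ∑³ f = ∑ λ a → ∑² (f a)

  ∑⁴ : (ℕ → ℕ → ℕ → ℕ → ℤ) → ℤ
  ∑⁴ f = ∑ λ a → ∑³ (f a)

  ∑-cong : ∀ {f g} → (∀ n → f n ≡ g n) → ∑ f ≡ ∑ g
  ∑-cong = sumTo-cong B

  ∑²-cong : ∀ {f g} → (∀ a b → f a b ≡ g a b) → ∑² f ≡ ∑² g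
  ∑²-cong e = ∑-cong λ a → ∑-cong (e a)

  ∑³-cong : ∀ {f g} → (∀ a b c → f a b c ≡ g a b c) → ∑³ f ≡ ∑³ g
  ∑³-cong e = ∑-cong λ a → ∑²-cong (e a)

  ∑⁴-cong : ∀ {f g} → (∀ a b c d → f a b c d ≡ g a b c d) → ∑⁴ f ≡ ∑⁴ g
  ∑⁴-cong e = ∑-cong λ a → ∑³-cong (e a)

  ∑-+ : ∀ f g → ∑ (λ n → f n +ᶻ g n) ≡ ∑ f +ᶻ ∑ g
  ∑-+ = sumTo-+ B

  ∑²-+ : ∀ f g → ∑² (λ a b → f a b +ᶻ g a b) ≡ ∑² f +ᶻ ∑² g
  ∑²-+ f g = trans (∑-cong λ a → ∑-+ (f a) (g a)) (∑-+ _ _)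

  ∑³-+ : ∀ f g → ∑³ (λ a b c → f a b c +ᶻ g a b c) ≡ ∑³ f +ᶻ ∑³ g
  ∑³-+ f g = trans (∑-cong λ a → ∑²-+ (f a) (g a)) (∑-+ _ _)

  ∑⁴-+ : ∀ f g → ∑⁴ (λ a b c d → f a b c d +ᶻ g a b c d) ≡ ∑⁴ f +ᶻ ∑⁴ g
  ∑⁴-+ f g = trans (∑-cong λ a → ∑³-+ (f a) (g a)) (∑-+ _ _)

  ∑-swap : ∀ f → ∑² f ≡ ∑² (λ b a → f a b)
  ∑-swap = sumTo-swap B B

  ∑³-swap₁₂ : ∀ f → ∑³ f ≡ ∑³ (λ b a c → f a b c)
  ∑³-swap₁₂ f = ∑-swap (λ a b → ∑ (f a b))

  ∑³-swap₂₃ : ∀ f → ∑³ f ≡ ∑³ (λ a c b → f a b c)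
  ∑³-swap₂₃ f = ∑-cong λ a → ∑-swap (f a)

  ∑⁴-swap₁₂ : ∀ f → ∑⁴ f ≡ ∑⁴ (λ b a c d → f a b c d)
  ∑⁴-swap₁₂ f = ∑-swap (λ a b → ∑² (f a b))

  ∑⁴-swap₂₃ : ∀ f → ∑⁴ f ≡ ∑⁴ (λ a c b d → f a b c d)
  ∑⁴-swap₂₃ f = ∑-cong λ a → ∑³-swap₁₂ (f a)

  ∑⁴-swap₃₄ : ∀ f → ∑⁴ f ≡ ∑⁴ (λ a b d c → f a b c d)
  ∑⁴-swap₃₄ f = ∑-cong λ a → ∑³-swap₂₃ (f a)

  -- The shifted sum may keep the limit B, because the terms that it adds lie outside the support.
  -- This makes substitutions possible without tracking limits.
  ∑-split : ∀ k f → Supp f → ∑ f ≡ sumTo k f +ᶻ ∑ (λ i → f (k + i))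
  ∑-split k f v = trans (sym (sumTo-extend B k f v))
    (trans (cong (λ n → sumTo n f) (ℕ.+-comm B k)) (sumTo-++ k B f))

  ∑-split₀ : ∀ f → Supp f → ∑ f ≡ f 0 +ᶻ ∑ (f ∘ suc)
  ∑-split₀ f v = trans (∑-split 1 f v) (cong (_+ᶻ ∑ (f ∘ suc)) (ℤ.+-identityʳ (f 0)))

  ∑-below-diag : ∀ f → (∀ p → Supp (f p)) →
    ∑ (λ w → sumTo w (λ p → f p w)) ≡ ∑² (λ p d → f p (suc (p + d)))
  ∑-below-diag f v = trans (sumTo-below-diag B f) (∑-cong λ p → lem p)
    where
    lem : ∀ p → sumTo (B ∸ suc p) (λ d → f p (suc (p + d))) ≡ ∑ (λ d → f p (suc (p + d)))
    lem p = trans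
      (sym (sumTo-extend (B ∸ suc p) (B ∸ (B ∸ suc p)) _ λ d le → v p _
        (ℕ.≤-trans (ℕ.m≤n+m∸n B (suc p)) (ℕ.+-monoʳ-≤ (suc p) le))))
      (cong (λ n → sumTo n (λ d → f p (suc (p + d)))) (ℕ.m+[n∸m]≡n (ℕ.m∸n≤m B (suc p))))

  ∑-odd : ∀ f → Supp f → (∀ n → f (suc (n + n)) ≡ 0ℤ) → ∑ f ≡ ∑ (λ n → f (n + n))
  ∑-odd f v e = trans (sym (sumTo-extend B B f v)) (sumTo-odd B f e)

  -- The elementary cut used throughout: either q ≥ w, with q = w + j, or q < w, with w = q + 1 + d.
  ∑²-compare : ∀ f → (∀ q → Supp (f q)) → (∀ w → Supp (λ q → f q w)) →
    ∑² f ≡ ∑² (λ w j → f (w + j) w) +ᶻ ∑² (λ q d → f q (suc (q + d)))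
  ∑²-compare f v v′ = trans (∑-swap f) (trans (∑-cong λ w → ∑-split w (λ q → f q w) (v′ w))
    (trans (∑-+ (λ w → sumTo w (λ q → f q w)) (λ w → ∑ (λ j → f (w + j) w)))
    (trans (ℤ.+-comm (∑ (λ w → sumTo w (λ q → f q w))) (∑² (λ w j → f (w + j) w))) (cong (∑² (λ w j → f (w + j) w) +ᶻ_) (∑-below-diag f v)))))

-- Parity and the form x² + ab + bc + ca

odd : ℕ → Bool
odd zero    = false
odd (suc n) = not (odd n)

odd-double : ∀ n → odd (n + n) ≡ false
odd-double zero    = refl
odd-double (suc n) rewrite ℕ.+-suc n n | odd-double n = refl

odd-+ : ∀ m n → odd (m + n) ≡ odd m xor odd n
odd-+ zero    n = refl
odd-+ (suc m) n rewrite odd-+ m n with odd m | odd n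
... | true  | true  = refl
... | true  | false = refl
... | false | true  = refl
... | false | false = refl

⟦_⟧ : Bool → ℤ
⟦ true ⟧  = 1ℤ
⟦ false ⟧ = 0ℤ

χ : ℕ → ℤ
χ n = ⟦ odd n ⟧

χ-even : ∀ n → χ (n + n) ≡ 0ℤ
χ-even n = cong ⟦_⟧ (odd-double n)

χ-odd : ∀ n → χ (suc (n + n)) ≡ 1ℤ
χ-odd n = cong (⟦_⟧ ∘ not) (odd-double n)

χ-shift : ∀ m n → χ (m + m + n) ≡ χ n
χ-shift m n rewrite odd-+ (m + m) n | odd-double m = refl

-- For odd p the number 1 + p is even and does not affect the parity; for even p both sides vanish.
χχ-shift : ∀ p q → χ p *ᶻ χ (suc p + q) ≡ χ p *ᶻ χ q
χχ-shift p q rewrite odd-+ p q with odd p | odd q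
... | true  | true  = refl
... | true  | false = refl
... | false | true  = refl
... | false | false = refl

χχ-even-shift : ∀ p q n {m} → m ≡ n + n + (suc p + q) → χ p *ᶻ χ m ≡ χ p *ᶻ χ q
χχ-even-shift p q n refl = trans (cong (χ p *ᶻ_) (χ-shift n (suc p + q))) (χχ-shift p q)

-- For a = 2α + 1, b = 2β + 1, c = 2γ + 1 the factors on the left say a ≡ c and b ≡ c (mod 4), those
-- on the right a ≡ b and c ≡ b.
χχ-class : ∀ α β γ → χ (suc (α + γ)) *ᶻ χ (suc (β + γ)) ≡ χ (suc (α + β)) *ᶻ χ (suc (γ + β))
χχ-class α β γ rewrite odd-+ α γ | odd-+ β γ | odd-+ α β | odd-+ γ β with odd α | odd β | odd γ
... | true  | true  | true  = refl
... | true  | true  | false = refl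
... | true  | false | true  = refl
... | true  | false | false = refl
... | false | true  | true  = refl
... | false | true  | false = refl
... | false | false | true  = refl
... | false | false | false = refl

-- This is x² + ab + bc + ca for the odd numbers x = 2ξ + 1, a = 2α + 1, b = 2β + 1, c = 2γ + 1.
form₄ : ℕ → ℕ → ℕ → ℕ → ℕ
form₄ ξ α β γ = suc (ξ + ξ) * suc (ξ + ξ) +
  (suc (α + α) * suc (β + β) + suc (β + β) * suc (γ + γ) + suc (α + α) * suc (γ + γ))

form₄-swap₁₂ : ∀ ξ α β γ → form₄ ξ α β γ ≡ form₄ ξ β α γ
form₄-swap₁₂ ξ α β γ = cong (suc (ξ + ξ) * suc (ξ + ξ) +_) (lem (suc (α + α)) (suc (β + β)) (suc (γ + γ)))
  where
  lem : ∀ a b c → a * b + b * c + a * c ≡ b * a + a * c + b * c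
  lem = ℕ-solve-∀

form₄-swap₂₃ : ∀ ξ α β γ → form₄ ξ α β γ ≡ form₄ ξ α γ β
form₄-swap₂₃ ξ α β γ = cong (suc (ξ + ξ) * suc (ξ + ξ) +_) (lem (suc (α + α)) (suc (β + β)) (suc (γ + γ)))
  where
  lem : ∀ a b c → a * b + b * c + a * c ≡ a * c + c * b + a * b
  lem = ℕ-solve-∀

-- Cutting up the sum over x² + ab + bc + ca for an arbitrary weight

module Decomposition (B : ℕ) (G₄ : ℕ → ℕ → ℤ) (G₄-supp : ∀ n x → 4 * B ≤ n → G₄ n x ≡ 0ℤ) where
  open Box B

  ∑-≡+ : ∀ {f g h} → (∀ n → f n ≡ g n +ᶻ h n) → ∑ f ≡ ∑ g +ᶻ ∑ h
  ∑-≡+ {f} {g} {h} e = trans (∑-cong e) (∑-+ g h)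

  ∑-≡+₃ : ∀ {f g h k} → (∀ n → f n ≡ g n +ᶻ (h n +ᶻ k n)) → ∑ f ≡ ∑ g +ᶻ (∑ h +ᶻ ∑ k)
  ∑-≡+₃ {f} {g} {h} {k} e =
    trans (∑-cong e) (trans (∑-+ g (λ n → h n +ᶻ k n)) (cong (∑ g +ᶻ_) (∑-+ h k)))

  G : ℕ → ℕ → ℤ
  G n x = G₄ (4 * n) x

  G-supp : ∀ n x → B ≤ n → G n x ≡ 0ℤ
  G-supp n x le = G₄-supp (4 * n) x (ℕ.*-monoʳ-≤ 4 le)

  opaque
    -- The summand in the coordinates p = (a + c)/2, q = (b + c)/2, y = (x - c)/2, w = (x + c)/2.
    -- Conversely x = y + w, c = w - y, a = 2p - c and b = 2q - c, so negative a, b and c occur as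
    -- well.
    u : ℕ → ℕ → ℕ → ℕ → ℤ
    u p q y w = χ p *ᶻ χ q *ᶻ (χ (y + w) *ᶻ G (p * q + y * w) (y + w))

    u-vanish : ∀ p q y w → B ≤ p * q + y * w → u p q y w ≡ 0ℤ
    u-vanish p q y w le rewrite G-supp (p * q + y * w) (y + w) le | ℤ.*-zeroʳ (χ (y + w)) =
      ℤ.*-zeroʳ (χ p *ᶻ χ q)

    u-≡ : ∀ {p q y w p′ q′ y′ w′} → p * q + y * w ≡ p′ * q′ + y′ * w′ → y + w ≡ y′ + w′ →
          χ p *ᶻ χ q ≡ χ p′ *ᶻ χ q′ → u p q y w ≡ u p′ q′ y′ w′
    u-≡ e₁ e₂ e₃ rewrite e₁ | e₂ | e₃ = refl

    u-even : ∀ p q y w → χ (y + w) ≡ 0ℤ → u p q y w ≡ 0ℤ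
    u-even p q y w e rewrite e = ℤ.*-zeroʳ (χ p *ᶻ χ q)

    u-opposite : ∀ p q y w → χ p *ᶻ χ q ≡ 0ℤ → u p q y w ≡ 0ℤ
    u-opposite p q y w e rewrite e = refl

  u-swapˡ : ∀ p q y w → u p q y w ≡ u q p y w
  u-swapˡ p q y w = u-≡ (cong (_+ y * w) (ℕ.*-comm p q)) refl (ℤ.*-comm (χ p) (χ q))

  u-swapʳ : ∀ p q y w → u p q y w ≡ u p q w y
  u-swapʳ p q y w = u-≡ {p} {q} (cong (p * q +_) (ℕ.*-comm y w)) (ℕ.+-comm y w) refl

  -- The summands are indexed by the predecessors of the positive numbers p, q, y, w.
  v : ℕ → ℕ → ℕ → ℕ → ℤ
  v p q y w = u (suc p) (suc q) (suc y) (suc w)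

  v-swapˡ : ∀ p q y w → v p q y w ≡ v q p y w
  v-swapˡ p q y w = u-swapˡ (suc p) (suc q) (suc y) (suc w)

  v-swapʳ : ∀ p q y w → v p q y w ≡ v p q w y
  v-swapʳ p q y w = u-swapʳ (suc p) (suc q) (suc y) (suc w)

  v-supp-p : ∀ q y w → Supp (λ p → v p q y w)
  v-supp-p q y w p le = u-vanish (suc p) (suc q) (suc y) (suc w)
    (ℕ.≤-trans (ℕ.≤-trans (ℕ.≤-trans le (ℕ.n≤1+n p)) (ℕ.m≤m*n (suc p) (suc q))) (ℕ.m≤m+n (suc p * suc q) (suc y * suc w)))

  v-supp-q : ∀ p y w → Supp (λ q → v p q y w)
  v-supp-q p y w q le = trans (v-swapˡ p q y w) (v-supp-p p y w q le)

  v-supp-y : ∀ p q w → Supp (λ y → v p q y w)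
  v-supp-y p q w y le = u-vanish (suc p) (suc q) (suc y) (suc w)
    (ℕ.≤-trans (ℕ.≤-trans (ℕ.≤-trans le (ℕ.n≤1+n y)) (ℕ.m≤m*n (suc y) (suc w))) (ℕ.m≤n+m (suc y * suc w) (suc p * suc q)))

  v-supp-w : ∀ p q y → Supp (v p q y)
  v-supp-w p q y w le = trans (v-swapʳ p q y w) (v-supp-y p q y w le)

  v-even : ∀ p q y w → χ (y + w) ≡ 0ℤ → v p q y w ≡ 0ℤ
  v-even p q y w e = u-even (suc p) (suc q) (suc y) (suc w)
    (trans (cong χ (cong suc (ℕ.+-suc y w))) (trans (χ-shift 1 (y + w)) e))

  ∑²-sym : ∀ g → (∀ p → Supp (g p)) → (∀ p q → g p q ≡ g q p) →
    ∑² g ≡ ∑ (λ p → g p p) +ᶻ (∑² (λ p f → g p (suc (p + f))) +ᶻ ∑² (λ p f → g p (suc (p + f))))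
  ∑²-sym g s g-sym = trans (∑²-compare g s s′)
    (trans (cong (_+ᶻ L) (trans (∑-≡+ λ w → trans (∑-split₀ (λ j → g (w + j) w)
        λ j l → s′ w (w + j) (ℕ.≤-trans l (ℕ.m≤n+m j w)))
        (cong₂ _+ᶻ_ (cong (λ t → g t w) (ℕ.+-identityʳ w))
          (∑-cong λ j → trans (g-sym (w + suc j) w) (cong (g w) (ℕ.+-suc w j))))) refl))
      (ℤ.+-assoc (∑ λ p → g p p) L L))
    where
    L : ℤ
    L = ∑² λ p f → g p (suc (p + f))
    s′ : ∀ w → Supp (λ q → g q w)
    s′ w q l = trans (g-sym q w) (s w q l)

  -- An odd y + w excludes y = w and makes the difference odd, so the two sums belong to y > w and y
  -- < w.
  ∑²-parity : ∀ f → (∀ y → Supp (f y)) → (∀ w → Supp (λ y → f y w)) →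
    (∀ y w → χ (y + w) ≡ 0ℤ → f y w ≡ 0ℤ) →
    ∑² f ≡ ∑² (λ w η → f (w + suc (η + η)) w) +ᶻ ∑² (λ y γ → f y (suc (y + (γ + γ))))
  ∑²-parity f s s′ e = trans (∑²-compare f s s′) (cong₂ _+ᶻ_ (∑-cong above) (∑-cong below))
    where
    above : ∀ w → ∑ (λ j → f (w + j) w) ≡ ∑ (λ η → f (w + suc (η + η)) w)
    above w = trans (∑-split₀ (λ j → f (w + j) w) λ j le → s′ w (w + j) (ℕ.≤-trans le (ℕ.m≤n+m j w)))
      (trans (cong (_+ᶻ ∑ (λ j → f (w + suc j) w)) (e (w + 0) w (trans (cong (λ t → χ (t + w)) (ℕ.+-identityʳ w)) (χ-even w))))
      (trans (ℤ.+-identityˡ _)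
        (∑-odd (λ j → f (w + suc j) w) (λ j le → s′ w _ (ℕ.≤-trans le (ℕ.≤-trans (ℕ.n≤1+n j) (ℕ.m≤n+m (suc j) w))))
          λ n → e _ w (trans (cong χ (lem w n)) (χ-even (w + suc n))))))
      where
      lem : ∀ w n → w + suc (suc (n + n)) + w ≡ w + suc n + (w + suc n)
      lem = ℕ-solve-∀
    below : ∀ y → ∑ (λ d → f y (suc (y + d))) ≡ ∑ (λ γ → f y (suc (y + (γ + γ))))
    below y = ∑-odd (λ d → f y (suc (y + d)))
      (λ d le → s y _ (ℕ.≤-trans le (ℕ.≤-trans (ℕ.m≤n+m d y) (ℕ.n≤1+n _))))
      λ n → e y _ (trans (cong χ (lem y n)) (χ-even (y + suc n)))
      where
      lem : ∀ y n → y + suc (y + suc (n + n)) ≡ y + suc n + (y + suc n)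
      lem = ℕ-solve-∀

  -- The three parts are q ≥ k, then p < k ≤ q, which stands for q < k ≤ p by symmetry, then p, q <
  -- k.
  square-split : ∀ k (g : ℕ → ℕ → ℤ) → (∀ p → Supp (g p)) → (∀ p q → g p q ≡ g q p) →
    ∑² g ≡ ∑² (λ p j → g p (k + j)) +ᶻ
           (∑ (λ j → sumTo k (λ p → g p (k + j))) +ᶻ sumTo k (λ p → sumTo k (g p)))
  square-split k g s g-sym = trans (∑-≡+ λ p → trans (∑-split k (g p) (s p)) (ℤ.+-comm (sumTo k (g p)) (∑ λ j → g p (k + j))))
    (cong (∑² (λ p j → g p (k + j)) +ᶻ_)
      (trans (∑-split k (λ p → sumTo k (g p)) λ p le → sumTo-zero k λ q → trans (g-sym p q) (s q p le))
      (trans (ℤ.+-comm (sumTo k (λ p → sumTo k (g p))) (∑ λ i → sumTo k (g (k + i))))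
        (cong (_+ᶻ sumTo k (λ p → sumTo k (g p))) (∑-cong λ i → sumTo-cong k λ q → g-sym (k + i) q)))))

  v-sym : ∀ y w p q → v p q y w ≡ v q p y w
  v-sym y w p q = v-swapˡ p q y w

  -- Here q is compared with w, which amounts to comparing b with x, and p < w amounts to a < x.
  E le′ τ′ gg′ : ℕ → ℕ → ℤ
  E   y w = ∑² λ p q → v p q y w
  le′ y w = ∑² λ p j → v p (w + j) y w
  τ′  y w = ∑ λ j → sumTo w λ p → v p (w + j) y w
  gg′ y w = sumTo w λ p → sumTo w λ q → v p q y w

  E-split : ∀ y w → E y w ≡ le′ y w +ᶻ (τ′ y w +ᶻ gg′ y w)
  E-split y w = square-split w (λ p q → v p q y w) (λ p → v-supp-q p y w) (v-sym y w)

  -- The first four sums allow both signs of c = w - y, the last four only y > w, which is c < 0.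
  U le τ gg N leN κ₂ κ₃ : ℤ
  U   = ∑² E
  le  = ∑² le′
  τ   = ∑² τ′
  gg  = ∑² gg′
  N   = ∑² λ w η → E (w + suc (η + η)) w
  leN = ∑² λ w η → le′ (w + suc (η + η)) w
  κ₂  = ∑² λ w η → τ′ (w + suc (η + η)) w
  κ₃  = ∑² λ w η → gg′ (w + suc (η + η)) w

  U-split : U ≡ le +ᶻ (τ +ᶻ gg)
  U-split = ∑-≡+₃ λ y → ∑-≡+₃ (E-split y)

  N-split : N ≡ leN +ᶻ (κ₂ +ᶻ κ₃)
  N-split = ∑-≡+₃ λ w → ∑-≡+₃ λ η → E-split (w + suc (η + η)) w

  E-supp-w : ∀ y → Supp (E y)
  E-supp-w y w le = sumTo-zero B λ p → sumTo-zero B λ q → v-supp-w p q y w le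

  E-sym : ∀ y w → E y w ≡ E w y
  E-sym y w = ∑²-cong λ p q → v-swapʳ p q y w

  U≡N+N : U ≡ N +ᶻ N
  U≡N+N = trans
    (∑²-parity E E-supp-w (λ w y le → trans (E-sym y w) (E-supp-w w y le))
      λ y w e → sumTo-zero B λ p → sumTo-zero B λ q → v-even p q y w e)
    (cong (N +ᶻ_) (∑²-cong λ y γ → trans (E-sym y (suc (y + (γ + γ)))) (cong (λ t → E t y) (sym (ℕ.+-suc y (γ + γ))))))

  -- The value of w when c = w - y is the positive odd number 2γ + 1.
  wᶜ : ℕ → ℕ → ℕ
  wᶜ y γ = suc (y + (γ + γ))

  leC ggC : ℤ
  leC = ∑² λ y γ → le′ y (wᶜ y γ)
  ggC = ∑² λ y γ → gg′ y (wᶜ y γ)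

  le-split : le ≡ leN +ᶻ leC
  le-split = ∑²-parity le′
    (λ y w l → sumTo-zero B λ p → sumTo-zero B λ j → v-supp-w p (w + j) y w l)
    (λ w y l → sumTo-zero B λ p → sumTo-zero B λ j → v-supp-y p (w + j) w y l)
    (λ y w e → sumTo-zero B λ p → sumTo-zero B λ j → v-even p (w + j) y w e)

  gg-split : gg ≡ κ₃ +ᶻ ggC
  gg-split = ∑²-parity gg′
    (λ y w l → sumTo-zero w λ p → sumTo-zero w λ q → v-supp-w p q y w l)
    (λ w y l → sumTo-zero w λ p → sumTo-zero w λ q → v-supp-y p q w y l)
    (λ y w e → sumTo-zero w λ p → sumTo-zero w λ q → v-even p q y w e)

  γ≤wᶜ : ∀ y γ → γ ≤ wᶜ y γ
  γ≤wᶜ y γ = ℕ.≤-trans (ℕ.m≤m+n γ γ) (ℕ.≤-trans (ℕ.m≤n+m (γ + γ) y) (ℕ.n≤1+n _))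

  ρ κ₂′ : ℤ
  ρ   = ∑⁴ λ y γ α j → v (γ + α) (wᶜ y γ + j) y (wᶜ y γ)
  κ₂′ = ∑⁴ λ y p η j → v p (wᶜ y (suc (p + η)) + j) y (wᶜ y (suc (p + η)))

  -- Since a = 2 (p - γ) + 1 in terms of the indices, comparing p with γ decides the sign of a: `ρ`
  -- has a > 0 and `κ₂′` has a < 0.
  leC-split : leC ≡ ρ +ᶻ κ₂′
  leC-split = ∑-≡+ λ y → trans (∑-swap (λ γ p → f y p γ))
    (∑²-compare (f y)
      (λ p γ l → sumTo-zero B λ j → v-supp-w p (wᶜ y γ + j) y (wᶜ y γ) (ℕ.≤-trans l (γ≤wᶜ y γ)))
      (λ γ p l → sumTo-zero B λ j → v-supp-p (wᶜ y γ + j) y (wᶜ y γ) p l))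
    where
    f : ℕ → ℕ → ℕ → ℤ
    f y p γ = ∑ λ j → v p (wᶜ y γ + j) y (wᶜ y γ)

  -- The reflection exchanging a and c in (x, a, b, c) identifies the two pieces.
  κ₂-≡ : κ₂ ≡ κ₂′
  κ₂-≡ = begin
    ∑² (λ w η → τ′ (w + suc (η + η)) w)  ≡⟨ ∑³-swap₁₂ (λ w η j → f η j w) ⟩
    ∑³ (λ η w j → f η j w)  ≡⟨ ∑³-swap₂₃ (λ η w j → f η j w) ⟩
    ∑³ (λ η j w → f η j w)  ≡⟨ (∑²-cong λ η j → ∑-below-diag (g η j)
            λ p w l → v-supp-w p (w + j) (w + suc (η + η)) w l) ⟩
    ∑⁴ (λ η j p d → g η j p (suc (p + d)))  ≡⟨ ∑⁴-swap₂₃ (λ η j p d → g η j p (suc (p + d))) ⟩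
    ∑⁴ (λ η p j d → g η j p (suc (p + d)))  ≡⟨ ∑⁴-swap₃₄ (λ η p j d → g η j p (suc (p + d))) ⟩
    ∑⁴ (λ η p d j → g η j p (suc (p + d)))  ≡⟨ ∑⁴-swap₂₃ (λ η p d j → g η j p (suc (p + d))) ⟩
    ∑⁴ (λ η d p j → g η j p (suc (p + d)))  ≡⟨ ∑⁴-swap₁₂ (λ η d p j → g η j p (suc (p + d))) ⟩
    ∑⁴ (λ d η p j → g η j p (suc (p + d)))  ≡⟨ ∑⁴-swap₂₃ (λ d η p j → g η j p (suc (p + d))) ⟩
    ∑⁴ (λ d p η j → g η j p (suc (p + d)))  ≡⟨ ∑⁴-cong (λ y p η j → match y p η j) ⟩
    κ₂′ ∎
    where
    open ≡-Reasoning
    f : ℕ → ℕ → ℕ → ℤ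
    f η j w = sumTo w λ p → v p (w + j) (w + suc (η + η)) w
    g : ℕ → ℕ → ℕ → ℕ → ℤ
    g η j p w = v p (w + j) (w + suc (η + η)) w
    e₁ : ∀ y p η j →
      suc p * suc (suc (p + y) + j) + suc (suc (p + y) + suc (η + η)) * suc (suc (p + y)) ≡
      suc p * suc (suc (y + (suc (p + η) + suc (p + η))) + j) + suc y * suc (suc (y + (suc (p + η) + suc (p + η))))
    e₁ = ℕ-solve-∀
    e₂ : ∀ y p η → suc (suc (p + y) + suc (η + η)) + suc (suc (p + y)) ≡
      suc y + suc (suc (y + (suc (p + η) + suc (p + η))))
    e₂ = ℕ-solve-∀
    e₃ : ∀ y p η j → suc (suc (y + (suc (p + η) + suc (p + η))) + j) ≡
      η + η + (suc (suc p) + suc (suc (p + y) + j))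
    e₃ = ℕ-solve-∀
    match : ∀ y p η j → g η j p (suc (p + y)) ≡ v p (wᶜ y (suc (p + η)) + j) y (wᶜ y (suc (p + η)))
    match y p η j = u-≡ (e₁ y p η j) (e₂ y p η) (sym (χχ-even-shift (suc p) _ η (e₃ y p η j)))

  le≡leN+ρ+κ₂ : le ≡ leN +ᶻ (ρ +ᶻ κ₂)
  le≡leN+ρ+κ₂ = trans le-split (cong (leN +ᶻ_) (trans leC-split (cong (ρ +ᶻ_) (sym κ₂-≡))))

  -- The index of x = y + w for w = y + c. As `wᶜ` is the sum of γ and `ξᶜ`, the bound w for γ + α
  -- becomes the bound x for a.
  ξᶜ : ℕ → ℕ → ℕ
  ξᶜ y γ = suc (y + γ)

  σ₃′ A₁ A₂ : ℤ
  σ₃′ = ∑² λ y γ → sumTo (ξᶜ y γ) λ α → sumTo (ξᶜ y γ) λ β → v (γ + α) (γ + β) y (wᶜ y γ)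
  A₁  = ∑² λ y γ → sumTo γ λ p → sumTo (ξᶜ y γ) λ β → v p (γ + β) y (wᶜ y γ)
  A₂  = ∑² λ y γ → sumTo γ λ p → sumTo γ λ q → v p q y (wᶜ y γ)

  -- The square p, q < w is cut at γ, which separates the signs of a and b: both positive, one of
  -- each sign (twice), both negative.
  ggC-split : ggC ≡ σ₃′ +ᶻ ((A₁ +ᶻ A₁) +ᶻ A₂)
  ggC-split = trans (∑-≡+₃ λ y → ∑-≡+₃ λ γ →
      trans (cong (λ k → sumTo k λ p → sumTo k λ q → v p q y (wᶜ y γ)) (e y γ))
            (sumTo-square-++ γ (ξᶜ y γ) (λ p q → v p q y (wᶜ y γ)) (v-sym y (wᶜ y γ))))
    (cong (λ t → σ₃′ +ᶻ (t +ᶻ A₂)) (∑-≡+ λ y → ∑-+ (a y) (a y)))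
    where
    a : ℕ → ℕ → ℤ
    a y γ = sumTo γ λ p → sumTo (ξᶜ y γ) λ β → v p (γ + β) y (wᶜ y γ)
    e : ∀ y γ → suc (y + (γ + γ)) ≡ γ + suc (y + γ)
    e = ℕ-solve-∀

  -- All of these have c > 0. `D₄` is the domain c > p + q, that is, a + b < 0. Within it, `D₄ᵃ` has
  -- a < 0 < b, `D₄ᵈ` has a = b and `D₄ⁿ` has a < b < 0. In `κ₃′`, a < 0 < b and a + b > 0.
  κ₃′ D₄ᵃ D₄ᵈ D₄ⁿ D₄ : ℤ
  κ₃′ = ∑³ λ y p η → sumTo (suc (y + p)) λ t → v p (suc (p + η) + (η + suc t)) y (wᶜ y (suc (p + η)))
  D₄ᵃ = ∑⁴ λ y p β t → v p (suc (p + suc (β + t)) + β) y (wᶜ y (suc (p + suc (β + t))))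
  D₄ᵈ = ∑³ λ y p μ → v p p y (wᶜ y (suc (p + μ)))
  D₄ⁿ = ∑⁴ λ y μ p f → v p (suc (p + f)) y (wᶜ y (suc (suc (p + f) + μ)))
  D₄  = ∑⁴ λ y t p q → v p q y (suc (suc (suc (p + q + y + t))))

  -- For a = -(2η + 1) and b = 2β + 1, comparing β with η gives the sign of a + b. The case a + b =
  -- 0 contributes nothing, since odd numbers a ≡ b (mod 4) are not opposite.
  A₁-split : A₁ ≡ D₄ᵃ +ᶻ κ₃′
  A₁-split = ∑-≡+ λ y → trans
      (∑-below-diag (λ p γ → sumTo (ξᶜ y γ) λ β → v p (γ + β) y (wᶜ y γ))
        λ p γ l → sumTo-zero (ξᶜ y γ) λ β → v-supp-w p (γ + β) y (wᶜ y γ) (ℕ.≤-trans l (γ≤wᶜ y γ)))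
      (∑-≡+ λ p → trans (∑-≡+ λ η → inner y p η)
        (cong (_+ᶻ ∑ λ η → sumTo (suc (y + p)) λ t → h y p η (η + suc t)) (∑-below-diag (λ β η → h y p η β)
          λ β η l → v-supp-w p _ y _ (ℕ.≤-trans l (ℕ.≤-trans (ℕ.≤-trans (ℕ.m≤n+m η p) (ℕ.n≤1+n _)) (γ≤wᶜ y (suc (p + η))))))))
    where
    h : ℕ → ℕ → ℕ → ℕ → ℤ
    h y p η β = v p (suc (p + η) + β) y (wᶜ y (suc (p + η)))
    e : ∀ y p η → suc (y + suc (p + η)) ≡ η + suc (suc (y + p))
    e = ℕ-solve-∀
    e′ : ∀ p η → suc (suc (p + η) + (η + 0)) ≡ η + η + (suc (suc p) + 0)
    e′ = ℕ-solve-∀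
    tie : ∀ y p η → h y p η (η + 0) ≡ 0ℤ
    tie y p η = u-opposite (suc p) _ (suc y) _
      (trans (χχ-even-shift (suc p) 0 η (e′ p η)) (ℤ.*-zeroʳ (χ (suc p))))
    inner : ∀ y p η → sumTo (ξᶜ y (suc (p + η))) (h y p η) ≡
      sumTo η (h y p η) +ᶻ sumTo (suc (y + p)) (λ t → h y p η (η + suc t))
    inner y p η = trans (cong (λ k → sumTo k (h y p η)) (e y p η))
      (trans (sumTo-++ η (suc (suc (y + p))) (h y p η))
        (cong (sumTo η (h y p η) +ᶻ_)
          (trans (cong (_+ᶻ sumTo (suc (y + p)) (λ t → h y p η (η + suc t))) (tie y p η)) (ℤ.+-identityˡ _))))

  -- Exchanging a and c fixes p, b and x, and carries the pieces with negative c to pieces with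
  -- negative a.
  κ₃-≡ : κ₃ ≡ κ₃′
  κ₃-≡ = begin
    ∑² (λ w η → gg′ (w + suc (η + η)) w)  ≡⟨ ∑-swap (λ w η → gg′ (w + suc (η + η)) w) ⟩
    ∑² (λ η w → gg′ (w + suc (η + η)) w)  ≡⟨ (∑-cong λ η → ∑-below-diag (f η)
            λ p w l → sumTo-zero w λ q → v-supp-w p q _ w l) ⟩
    ∑³ (λ η p d → f η p (suc (p + d)))  ≡⟨ ∑³-swap₂₃ (λ η p d → f η p (suc (p + d))) ⟩
    ∑³ (λ η d p → f η p (suc (p + d)))  ≡⟨ ∑³-swap₁₂ (λ η d p → f η p (suc (p + d))) ⟩
    ∑³ (λ d η p → f η p (suc (p + d)))  ≡⟨ ∑³-swap₂₃ (λ d η p → f η p (suc (p + d))) ⟩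
    ∑³ (λ d p η → f η p (suc (p + d)))  ≡⟨ (∑³-cong λ y p η → trans
            (cong (λ k → sumTo (suc k) λ q → v p q (suc (p + y) + suc (η + η)) (suc (p + y))) (ℕ.+-comm p y))
            (sumTo-cong (suc (y + p)) λ t → match y p η t)) ⟩
    κ₃′ ∎
    where
    open ≡-Reasoning
    f : ℕ → ℕ → ℕ → ℤ
    f η p w = sumTo w λ q → v p q (w + suc (η + η)) w
    e₁ : ∀ y p η t →
      suc p * suc t + suc (suc (p + y) + suc (η + η)) * suc (suc (p + y)) ≡
      suc p * suc (suc (p + η) + (η + suc t)) + suc y * suc (suc (y + (suc (p + η) + suc (p + η))))
    e₁ = ℕ-solve-∀
    e₂ : ∀ y p η → suc (suc (p + y) + suc (η + η)) + suc (suc (p + y)) ≡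
      suc y + suc (suc (y + (suc (p + η) + suc (p + η))))
    e₂ = ℕ-solve-∀
    e₃ : ∀ p η t → suc (suc (p + η) + (η + suc t)) ≡ η + η + (suc (suc p) + suc t)
    e₃ = ℕ-solve-∀
    match : ∀ y p η t → v p t (suc (p + y) + suc (η + η)) (suc (p + y)) ≡
      v p (suc (p + η) + (η + suc t)) y (wᶜ y (suc (p + η)))
    match y p η t = u-≡ (e₁ y p η t) (e₂ y p η) (sym (χχ-even-shift (suc p) (suc t) η (e₃ p η t)))

  A₂-split : A₂ ≡ D₄ᵈ +ᶻ (D₄ⁿ +ᶻ D₄ⁿ)
  A₂-split = ∑-≡+₃ λ y → trans (∑-≡+₃ λ γ → sumTo-sym-square γ (λ p q → v p q y (wᶜ y γ)) (v-sym y (wᶜ y γ)))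
    (cong₂ (λ a b → a +ᶻ (b +ᶻ b))
      (∑-below-diag (λ p γ → v p p y (wᶜ y γ)) λ p γ l → v-supp-w p p y _ (ℕ.≤-trans l (γ≤wᶜ y γ)))
      (trans (∑-below-diag (λ q γ → sumTo q λ p → v p q y (wᶜ y γ))
               λ q γ l → sumTo-zero q λ p → v-supp-w p q y _ (ℕ.≤-trans l (γ≤wᶜ y γ)))
        (trans (∑-swap (λ q μ → sumTo q λ p → v p q y (wᶜ y (suc (q + μ)))))
          (∑-cong λ μ → ∑-below-diag (λ p q → v p q y (wᶜ y (suc (q + μ))))
            λ p q l → v-supp-q p y _ q l))))

  -- By symmetry in p and q only p = q and p < q matter. For q = p + 1 + f one has b = f - t, so
  -- comparing f with t gives the sign of b.
  D₄-split : D₄ ≡ D₄ᵈ +ᶻ ((D₄ᵃ +ᶻ D₄ⁿ) +ᶻ (D₄ᵃ +ᶻ D₄ⁿ))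
  D₄-split = trans
      (∑-≡+₃ {h = λ y → a y +ᶻ n y} {k = λ y → a y +ᶻ n y} λ y →
        trans (∑-≡+₃ λ t → ∑²-sym (g y t) (λ p q l → v-supp-q p y _ q l) (g-sym y t))
              (cong₂ (λ a b → a +ᶻ (b +ᶻ b)) (diag y) (off y)))
      (cong (λ t → D₄ᵈ +ᶻ (t +ᶻ t)) (∑-+ a n))
    where
    a n : ℕ → ℤ
    a y = ∑³ λ p β t → v p (suc (p + suc (β + t)) + β) y (wᶜ y (suc (p + suc (β + t))))
    n y = ∑³ λ μ p f → v p (suc (p + f)) y (wᶜ y (suc (suc (p + f) + μ)))
    g : ℕ → ℕ → ℕ → ℕ → ℤ
    g y t p q = v p q y (suc (suc (suc (p + q + y + t))))
    g-sym : ∀ y t p q → g y t p q ≡ g y t q p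
    g-sym y t p q = trans (v-swapˡ p q y _) (cong (λ k → v q p y (suc (suc (suc (k + y + t))))) (ℕ.+-comm p q))
    t≤ : ∀ k t → t ≤ suc (suc (suc (k + t)))
    t≤ k t = ℕ.≤-trans (ℕ.m≤n+m t k) (ℕ.m≤n+m (k + t) 3)
    e₀ : ∀ y p t → y + suc (suc (suc (p + p + y + suc (t + t)))) ≡ suc (suc (y + p + t)) + suc (suc (y + p + t))
    e₀ = ℕ-solve-∀
    e₁ : ∀ y p t → suc (suc (suc (p + p + y + (t + t)))) ≡ suc (y + (suc (p + t) + suc (p + t)))
    e₁ = ℕ-solve-∀
    diag : ∀ y → ∑² (λ t p → g y t p p) ≡ ∑² (λ p μ → v p p y (wᶜ y (suc (p + μ))))
    diag y = trans (∑-swap (λ t p → g y t p p)) (∑-cong λ p →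
      trans (∑-odd (λ t → g y t p p) (λ t l → v-supp-w p p y _ (ℕ.≤-trans l (t≤ _ t)))
              λ t → v-even p p y _ (trans (cong χ (e₀ y p t)) (χ-even (suc (suc (y + p + t))))))
        (∑-cong λ t → cong (v p p y) (e₁ y p t)))
    e₂ : ∀ y p f t → y + suc (suc (suc (p + suc (p + f) + y + t))) ≡ suc (suc (y + p)) + suc (suc (y + p)) + (f + t)
    e₂ = ℕ-solve-∀
    e₃ : ∀ p β t → suc (p + (t + suc (β + β))) ≡ suc (p + suc (β + t)) + β
    e₃ = ℕ-solve-∀
    e₄ : ∀ y p β t → suc (suc (suc (p + suc (p + (t + suc (β + β))) + y + t))) ≡
      suc (y + (suc (p + suc (β + t)) + suc (p + suc (β + t))))
    e₄ = ℕ-solve-∀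
    e₅ : ∀ y μ p f → suc (suc (suc (p + suc (p + f) + y + suc (f + (μ + μ))))) ≡
      suc (y + (suc (suc (p + f) + μ) + suc (suc (p + f) + μ)))
    e₅ = ℕ-solve-∀
    G′ : ℕ → ℕ → ℕ → ℕ → ℤ
    G′ y p f t = g y t p (suc (p + f))
    off : ∀ y → ∑³ (λ t p f → g y t p (suc (p + f))) ≡
      ∑³ (λ p β t → v p (suc (p + suc (β + t)) + β) y (wᶜ y (suc (p + suc (β + t))))) +ᶻ
      ∑³ (λ μ p f → v p (suc (p + f)) y (wᶜ y (suc (suc (p + f) + μ))))
    off y = begin
      ∑³ (λ t p f → G′ y p f t)  ≡⟨ ∑³-swap₁₂ (λ t p f → G′ y p f t) ⟩
      ∑³ (λ p t f → G′ y p f t)  ≡⟨ ∑³-swap₂₃ (λ p t f → G′ y p f t) ⟩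
      ∑³ (λ p f t → G′ y p f t)
        ≡⟨ (∑-≡+ λ p → ∑²-parity (G′ y p)
              (λ f t l → v-supp-w p _ y _ (ℕ.≤-trans l (t≤ _ t)))
              (λ t f l → v-supp-q p y _ _ (ℕ.≤-trans l (ℕ.≤-trans (ℕ.m≤n+m f p) (ℕ.n≤1+n _))))
              (λ f t e → v-even p _ y _ (trans (cong χ (e₂ y p f t)) (trans (χ-shift (suc (suc (y + p))) (f + t)) e)))) ⟩
      ∑³ (λ p t β → G′ y p (t + suc (β + β)) t) +ᶻ ∑³ (λ p f μ → G′ y p f (suc (f + (μ + μ))))
        ≡⟨ cong₂ _+ᶻ_
             (trans (∑³-swap₂₃ (λ p t β → G′ y p (t + suc (β + β)) t))
                    (∑³-cong λ p β t → cong₂ (λ q w → v p q y w) (e₃ p β t) (e₄ y p β t)))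
             (trans (∑³-swap₂₃ (λ p f μ → G′ y p f (suc (f + (μ + μ)))))
               (trans (∑³-swap₁₂ (λ p μ f → G′ y p f (suc (f + (μ + μ)))))
                 (∑³-cong λ μ p f → cong (v p (suc (p + f)) y) (e₅ y μ p f)))) ⟩
      ∑³ (λ p β t → v p (suc (p + suc (β + t)) + β) y (wᶜ y (suc (p + suc (β + t))))) +ᶻ
      ∑³ (λ μ p f → v p (suc (p + f)) y (wᶜ y (suc (suc (p + f) + μ)))) ∎
      where open ≡-Reasoning

  gg≡ : gg ≡ κ₃ +ᶻ (σ₃′ +ᶻ ((κ₃ +ᶻ κ₃) +ᶻ D₄))
  gg≡ = trans gg-split (cong (κ₃ +ᶻ_) (trans ggC-split (cong (σ₃′ +ᶻ_)
    (trans (cong₂ (λ a b → (a +ᶻ a) +ᶻ b) (trans A₁-split (cong (D₄ᵃ +ᶻ_) (sym κ₃-≡))) A₂-split)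
      (trans (rearrange D₄ᵃ κ₃ D₄ᵈ D₄ⁿ) (cong ((κ₃ +ᶻ κ₃) +ᶻ_) (sym D₄-split)))))))
    where
    rearrange : ∀ a k d n → ((a +ᶻ k) +ᶻ (a +ᶻ k)) +ᶻ (d +ᶻ (n +ᶻ n)) ≡
      (k +ᶻ k) +ᶻ (d +ᶻ ((a +ᶻ n) +ᶻ (a +ᶻ n)))
    rearrange = ℤ-solve-∀

  -- By symmetry there are three copies each of the types high-high-low and high-low-low. A free
  -- third variable collects one copy of either type, so R occurs three times.
  cube-split : ∀ k (f : ℕ → ℕ → ℕ → ℤ) → (∀ α β → Supp (f α β)) →
    (∀ α β γ → f α β γ ≡ f β α γ) → (∀ α β γ → f α β γ ≡ f α γ β) →
    ∑³ f ≡ ∑³ (λ i j l → f (k + i) (k + j) (k + l)) +ᶻ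
      ((∑² (λ α j → sumTo k (f α (k + j))) +ᶻ
        (∑² (λ α j → sumTo k (f α (k + j))) +ᶻ ∑² (λ α j → sumTo k (f α (k + j))))) +ᶻ
       sumTo k (λ α → sumTo k λ β → sumTo k (f α β)))
  cube-split k f s s₁₂ s₂₃ = begin
    ∑³ f
      ≡⟨ (∑-cong λ α → trans (∑-cong λ β → ∑-split k (f α β) (s α β)) (∑-+ (λ β → sumTo k (f α β)) (λ β → ∑ λ l → f α β (k + l)))) ⟩
    ∑ (λ α → ∑ (λ β → sumTo k (f α β)) +ᶻ ∑² (λ β l → f α β (k + l)))
      ≡⟨ ∑-+ (λ α → ∑ λ β → sumTo k (f α β)) (λ α → ∑² λ β l → f α β (k + l)) ⟩
    ∑² (λ α β → sumTo k (f α β)) +ᶻ ∑³ (λ α β l → f α β (k + l))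
      ≡⟨ cong₂ _+ᶻ_
           (∑-≡+ λ α → ∑-split k (λ β → sumTo k (f α β)) λ β l → sumTo-zero k λ γ → sup₂ α γ β l)
           (∑-≡+ λ α → ∑-split k (λ β → ∑ λ l → f α β (k + l)) λ β l → sumTo-zero B λ i → sup₂ α (k + i) β l) ⟩
    (∑ (λ α → sumTo k λ β → sumTo k (f α β)) +ᶻ R) +ᶻ
    (∑ (λ α → sumTo k λ β → ∑ λ l → f α β (k + l)) +ᶻ ∑³ (λ α j l → f α (k + j) (k + l)))
      ≡⟨ cong₂ (λ a b → (a +ᶻ R) +ᶻ (b +ᶻ ∑³ (λ α j l → f α (k + j) (k + l))))
           (∑-split k (λ α → sumTo k λ β → sumTo k (f α β)) λ α l → sumTo-zero k λ β → sumTo-zero k λ γ → sup₁ β γ α l)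
           (∑-cong λ α → trans (sym (sumTo-swap B k λ l β → f α β (k + l)))
                               (∑-cong λ l → sumTo-cong k λ β → s₂₃ α β (k + l))) ⟩
    ((LLL +ᶻ X₁) +ᶻ R) +ᶻ (R +ᶻ ∑³ (λ α j l → f α (k + j) (k + l)))
      ≡⟨ cong (λ t → ((LLL +ᶻ X₁) +ᶻ R) +ᶻ (R +ᶻ t))
           (∑-split k (λ α → ∑² λ j l → f α (k + j) (k + l)) λ α l → sumTo-zero B λ j → sumTo-zero B λ i → sup₁ (k + j) (k + i) α l) ⟩
    ((LLL +ᶻ X₁) +ᶻ R) +ᶻ (R +ᶻ (X₂ +ᶻ HHH))
      ≡⟨ rearrange LLL X₁ R X₂ HHH ⟩
    HHH +ᶻ ((R +ᶻ (R +ᶻ (X₁ +ᶻ X₂))) +ᶻ LLL)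
      ≡⟨ cong (λ t → HHH +ᶻ ((R +ᶻ (R +ᶻ t)) +ᶻ LLL)) (sym R-split) ⟩
    HHH +ᶻ ((R +ᶻ (R +ᶻ R)) +ᶻ LLL) ∎
    where
    open ≡-Reasoning
    sup₂ : ∀ α γ → Supp (λ β → f α β γ)
    sup₂ α γ β l = trans (s₂₃ α β γ) (s α γ β l)
    sup₁ : ∀ β γ → Supp (λ α → f α β γ)
    sup₁ β γ α l = trans (s₁₂ α β γ) (sup₂ β γ α l)
    LLL X₁ X₂ HHH R : ℤ
    LLL = sumTo k λ α → sumTo k λ β → sumTo k (f α β)
    X₁  = ∑ λ i → sumTo k λ β → sumTo k (f (k + i) β)
    X₂  = sumTo k λ α → ∑² λ j l → f α (k + j) (k + l)
    HHH = ∑³ λ i j l → f (k + i) (k + j) (k + l)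
    R   = ∑² λ α j → sumTo k (f α (k + j))
    R-split : R ≡ X₁ +ᶻ X₂
    R-split = trans (∑-split k (λ α → ∑ λ j → sumTo k (f α (k + j)))
        λ α l → sumTo-zero B λ j → sumTo-zero k λ γ → sup₁ (k + j) γ α l)
      (cong₂ _+ᶻ_
        (trans (sym (sumTo-swap B k λ j α → sumTo k (f α (k + j))))
               (∑-cong λ j → sumTo-cong k λ α → sumTo-cong k λ γ → s₁₂ α (k + j) γ))
        (trans (∑-cong λ i → trans (sumTo-swap B k λ j γ → f (k + i) (k + j) γ)
                 (sumTo-cong k λ γ → ∑-cong λ j → trans (s₂₃ (k + i) (k + j) γ) (s₁₂ (k + i) γ (k + j))))
               (sumTo-swap B k λ i γ → ∑ λ j → f γ (k + i) (k + j))))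
    rearrange : ∀ a b r c d → ((a +ᶻ b) +ᶻ r) +ᶻ (r +ᶻ (c +ᶻ d)) ≡ d +ᶻ ((r +ᶻ (r +ᶻ (b +ᶻ c))) +ᶻ a)
    rearrange = ℤ-solve-∀

  -- The summand for x = 2ξ+1, a = 2α+1, b = 2β+1, c = 2γ+1; the characters say a ≡ b ≡ c (mod 4).
  opaque
    unfolding u

    s : ℕ → ℕ → ℕ → ℕ → ℤ
    s ξ α β γ = χ (suc (α + γ)) *ᶻ χ (suc (β + γ)) *ᶻ G₄ (form₄ ξ α β γ) (suc (ξ + ξ))

    s-vanish : ∀ ξ α β γ → 4 * B ≤ form₄ ξ α β γ → s ξ α β γ ≡ 0ℤ
    s-vanish ξ α β γ l rewrite G₄-supp (form₄ ξ α β γ) (suc (ξ + ξ)) l = ℤ.*-zeroʳ (χ (suc (α + γ)) *ᶻ χ (suc (β + γ)))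

    s-swap₁₂ : ∀ ξ α β γ → s ξ α β γ ≡ s ξ β α γ
    s-swap₁₂ ξ α β γ = cong₂ _*ᶻ_ (ℤ.*-comm (χ (suc (α + γ))) (χ (suc (β + γ))))
      (cong (λ n → G₄ n (suc (ξ + ξ))) (form₄-swap₁₂ ξ α β γ))

    s-swap₂₃ : ∀ ξ α β γ → s ξ α β γ ≡ s ξ α γ β
    s-swap₂₃ ξ α β γ = cong₂ _*ᶻ_ (χχ-class α β γ) (cong (λ n → G₄ n (suc (ξ + ξ))) (form₄-swap₂₃ ξ α β γ))

    s≡u : ∀ ξ α β γ {p q y w} → form₄ ξ α β γ ≡ 4 * (p * q + y * w) → suc (ξ + ξ) ≡ y + w →
      suc (α + γ) ≡ p → suc (β + γ) ≡ q → s ξ α β γ ≡ u p q y w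
    s≡u ξ α β γ {p} {q} {y} {w} e₁ e₂ refl refl rewrite e₁ | sym e₂ | χ-odd ξ =
      cong (χ p *ᶻ χ q *ᶻ_) (sym (ℤ.*-identityˡ _))

  s-supp-ξ : ∀ α β γ → Supp (λ ξ → s ξ α β γ)
  s-supp-ξ α β γ ξ l = s-vanish ξ α β γ (ℕ.≤-trans (ℕ.*-monoʳ-≤ 4 l)
    (subst (4 * ξ ≤_) (sym (e ξ _)) (ℕ.m≤m+n (4 * ξ) _)))
    where
    e : ∀ ξ r → suc (ξ + ξ) * suc (ξ + ξ) + r ≡ 4 * ξ + (4 * (ξ * ξ) + 1 + r)
    e = ℕ-solve-∀

  s-supp-α : ∀ ξ β γ → Supp (λ α → s ξ α β γ)
  s-supp-α ξ β γ α l = s-vanish ξ α β γ (ℕ.≤-trans (ℕ.*-monoʳ-≤ 4 l)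
    (subst (4 * α ≤_) (sym (e ξ α β γ)) (ℕ.m≤m+n (4 * α) _)))
    where
    e : ∀ ξ α β γ → suc (ξ + ξ) * suc (ξ + ξ) +
        (suc (α + α) * suc (β + β) + suc (β + β) * suc (γ + γ) + suc (α + α) * suc (γ + γ)) ≡
      4 * α + (suc (ξ + ξ) * suc (ξ + ξ) + suc (β + β) * suc (γ + γ) + 2 + 2 * β + 4 * α * β + 2 * γ + 4 * α * γ)
    e = ℕ-solve-∀

  s-supp-γ : ∀ ξ α β → Supp (s ξ α β)
  s-supp-γ ξ α β γ l = trans (s-swap₂₃ ξ α β γ) (trans (s-swap₁₂ ξ α γ β) (s-supp-α ξ α β γ l))

  S S₀ R₃ σ₃ : ℤ
  S  = ∑⁴ s
  S₀ = ∑⁴ λ ξ i j l → s ξ (ξ + i) (ξ + j) (ξ + l)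
  R₃ = ∑³ λ ξ α j → sumTo ξ (s ξ α (ξ + j))
  σ₃ = ∑ λ ξ → sumTo ξ λ α → sumTo ξ λ β → sumTo ξ (s ξ α β)

  -- The threshold for a, b and c is x.
  S-split : S ≡ S₀ +ᶻ ((R₃ +ᶻ (R₃ +ᶻ R₃)) +ᶻ σ₃)
  S-split = trans (∑-≡+₃ λ ξ → cube-split ξ (s ξ) (s-supp-γ ξ) (s-swap₁₂ ξ) (s-swap₂₃ ξ))
    (cong (λ t → S₀ +ᶻ (t +ᶻ σ₃)) (∑-≡+₃ λ ξ → refl))

  -- The conditions c < x ≤ b and a, c > 0 describe `ρ` in the other coordinates: y is positive
  -- because c < x.
  R₃≡ρ : R₃ ≡ ρ
  R₃≡ρ = begin
    ∑³ (λ ξ α j → sumTo ξ (s ξ α (ξ + j)))  ≡⟨ ∑³-swap₁₂ (λ ξ α j → sumTo ξ (s ξ α (ξ + j))) ⟩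
    ∑³ (λ α ξ j → sumTo ξ (s ξ α (ξ + j)))  ≡⟨ ∑³-swap₂₃ (λ α ξ j → sumTo ξ (s ξ α (ξ + j))) ⟩
    ∑³ (λ α j ξ → sumTo ξ (s ξ α (ξ + j)))  ≡⟨ (∑²-cong λ α j → ∑-below-diag (λ γ ξ → s ξ α (ξ + j) γ)
            λ γ ξ l → s-supp-ξ α (ξ + j) γ ξ l) ⟩
    ∑⁴ (λ α j γ y → f α j γ y)  ≡⟨ ∑⁴-swap₂₃ (λ α j γ y → f α j γ y) ⟩
    ∑⁴ (λ α γ j y → f α j γ y)  ≡⟨ ∑⁴-swap₃₄ (λ α γ j y → f α j γ y) ⟩
    ∑⁴ (λ α γ y j → f α j γ y)  ≡⟨ ∑⁴-swap₁₂ (λ α γ y j → f α j γ y) ⟩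
    ∑⁴ (λ γ α y j → f α j γ y)  ≡⟨ ∑⁴-swap₂₃ (λ γ α y j → f α j γ y) ⟩
    ∑⁴ (λ γ y α j → f α j γ y)  ≡⟨ ∑⁴-swap₁₂ (λ γ y α j → f α j γ y) ⟩
    ∑⁴ (λ y γ α j → f α j γ y)  ≡⟨ (∑⁴-cong λ y γ α j → s≡u (suc (γ + y)) α (suc (γ + y) + j) γ
            (e₁ y γ α j) (e₂ y γ) (cong suc (ℕ.+-comm α γ)) (e₃ y γ j)) ⟩
    ρ ∎
    where
    open ≡-Reasoning
    f : ℕ → ℕ → ℕ → ℕ → ℤ
    f α j γ y = s (suc (γ + y)) α (suc (γ + y) + j) γ
    e₁ : ∀ y γ α j → form₄ (suc (γ + y)) α (suc (γ + y) + j) γ ≡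
      4 * (suc (γ + α) * suc (suc (y + (γ + γ)) + j) + suc y * suc (suc (y + (γ + γ))))
    e₁ y γ α j = lem y γ α j
      where
      lem : ∀ y γ α j → suc (suc (γ + y) + suc (γ + y)) * suc (suc (γ + y) + suc (γ + y)) +
        (suc (α + α) * suc ((suc (γ + y) + j) + (suc (γ + y) + j)) + suc ((suc (γ + y) + j) + (suc (γ + y) + j)) * suc (γ + γ) + suc (α + α) * suc (γ + γ)) ≡
        4 * (suc (γ + α) * suc (suc (y + (γ + γ)) + j) + suc y * suc (suc (y + (γ + γ))))
      lem = ℕ-solve-∀
    e₂ : ∀ y γ → suc (suc (γ + y) + suc (γ + y)) ≡ suc y + suc (suc (y + (γ + γ)))
    e₂ = ℕ-solve-∀
    e₃ : ∀ y γ j → suc (suc (γ + y) + j + γ) ≡ suc (suc (y + (γ + γ)) + j)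
    e₃ = ℕ-solve-∀

  σ₃≡σ₃′ : σ₃ ≡ σ₃′
  σ₃≡σ₃′ = begin
    ∑ (λ ξ → sumTo ξ λ α → sumTo ξ λ β → sumTo ξ (s ξ α β))
      ≡⟨ (∑-cong λ ξ → sumTo-cong ξ λ γ → sumTo-cong ξ λ α → sumTo-cong ξ λ β →
            trans (s-swap₁₂ ξ γ α β) (s-swap₂₃ ξ α γ β)) ⟩
    ∑ (λ ξ → sumTo ξ λ γ → sumTo ξ λ α → sumTo ξ λ β → s ξ α β γ)
      ≡⟨ (∑-below-diag (λ γ ξ → sumTo ξ λ α → sumTo ξ λ β → s ξ α β γ)
            λ γ ξ l → sumTo-zero ξ λ α → sumTo-zero ξ λ β → s-supp-ξ α β γ ξ l) ⟩
    ∑² (λ γ y → sumTo (suc (γ + y)) λ α → sumTo (suc (γ + y)) λ β → s (suc (γ + y)) α β γ)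
      ≡⟨ ∑-swap (λ γ y → sumTo (suc (γ + y)) λ α → sumTo (suc (γ + y)) λ β → s (suc (γ + y)) α β γ) ⟩
    ∑² (λ y γ → sumTo (suc (γ + y)) λ α → sumTo (suc (γ + y)) λ β → s (suc (γ + y)) α β γ)
      ≡⟨ (∑²-cong λ y γ → trans (cong (λ ξ → sumTo (suc ξ) λ α → sumTo (suc ξ) λ β → s (suc ξ) α β γ) (ℕ.+-comm γ y))
            (sumTo-cong (ξᶜ y γ) λ α → sumTo-cong (ξᶜ y γ) λ β → s≡u (ξᶜ y γ) α β γ {y = suc y} {w = suc (wᶜ y γ)}
              (e₁ y γ α β) (e₂ y γ) (cong suc (ℕ.+-comm α γ)) (cong suc (ℕ.+-comm β γ)))) ⟩
    σ₃′ ∎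
    where
    open ≡-Reasoning
    e₁ : ∀ y γ α β → form₄ (suc (y + γ)) α β γ ≡ 4 * (suc (γ + α) * suc (γ + β) + suc y * suc (suc (y + (γ + γ))))
    e₁ y γ α β = lem y γ α β
      where
      lem : ∀ y γ α β → suc (suc (y + γ) + suc (y + γ)) * suc (suc (y + γ) + suc (y + γ)) +
        (suc (α + α) * suc (β + β) + suc (β + β) * suc (γ + γ) + suc (α + α) * suc (γ + γ)) ≡
        4 * (suc (γ + α) * suc (γ + β) + suc y * suc (suc (y + (γ + γ))))
      lem = ℕ-solve-∀
    e₂ : ∀ y γ → suc (suc (y + γ) + suc (y + γ)) ≡ suc y + suc (suc (y + (γ + γ)))
    e₂ = ℕ-solve-∀

  opaque
    unfolding u s

    -- The pieces with x ≤ a, b and c > −x, in the coordinates x, w = (x + c)/2, i = (a − x)/2, j = (b − x)/2.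
    g : ℕ → ℕ → ℕ → ℕ → ℤ
    g x w i j = χ (suc w + i) *ᶻ χ (suc w + j) *ᶻ (χ (suc x) *ᶻ G (i * j + suc w * (suc x + i + j)) (suc x))

    g-vanish : ∀ x w i j → B ≤ i * j + suc w * (suc x + i + j) → g x w i j ≡ 0ℤ
    g-vanish x w i j l rewrite G-supp (i * j + suc w * (suc x + i + j)) (suc x) l | ℤ.*-zeroʳ (χ (suc x)) =
      ℤ.*-zeroʳ (χ (suc w + i) *ᶻ χ (suc w + j))

    g-even : ∀ n w i j → g (suc (n + n)) w i j ≡ 0ℤ
    g-even n w i j rewrite odd-double n = ℤ.*-zeroʳ (χ (suc w + i) *ᶻ χ (suc w + j))

    g-swap : ∀ x w i j → g x w i j ≡ g x w j i
    g-swap x w i j = cong₂ _*ᶻ_ (ℤ.*-comm (χ (suc w + i)) (χ (suc w + j)))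
      (cong (λ n → χ (suc x) *ᶻ G n (suc x)) (e x w i j))
      where
      e : ∀ x w i j → i * j + suc w * (suc x + i + j) ≡ j * i + suc w * (suc x + j + i)
      e = ℕ-solve-∀

    g≡v : ∀ w y i j → g (suc (w + y)) w i j ≡ v (w + i) (w + j) y w
    g≡v w y i j = cong (χ (suc w + i) *ᶻ χ (suc w + j) *ᶻ_)
      (cong₂ (λ n x → χ x *ᶻ G n x) (e₁ w y i j) (e₂ w y))
      where
      e₁ : ∀ w y i j → i * j + suc w * (suc (suc (w + y)) + i + j) ≡ suc (w + i) * suc (w + j) + suc y * suc w
      e₁ = ℕ-solve-∀
      e₂ : ∀ w y → suc (suc (w + y)) ≡ suc y + suc w
      e₂ = ℕ-solve-∀

    g≡s : ∀ ξ i j l → g (ξ + ξ) (ξ + ξ + l) i j ≡ s ξ (ξ + i) (ξ + j) (ξ + l)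
    g≡s ξ i j l = cong₂ _*ᶻ_ (cong₂ (λ m n → χ (suc m) *ᶻ χ (suc n)) (e₁ ξ i l) (e₁ ξ j l))
      (trans (cong₂ (λ a n → a *ᶻ G₄ n (suc (ξ + ξ))) (χ-odd ξ) (e₂ ξ i j l)) (ℤ.*-identityˡ _))
      where
      e₁ : ∀ ξ i l → ξ + ξ + l + i ≡ ξ + i + (ξ + l)
      e₁ = ℕ-solve-∀
      e₂ : ∀ ξ i j l → 4 * (i * j + suc (ξ + ξ + l) * (suc (ξ + ξ) + i + j)) ≡ form₄ ξ (ξ + i) (ξ + j) (ξ + l)
      e₂ ξ i j l = lem ξ i j l
        where
        lem : ∀ ξ i j l → 4 * (i * j + suc (ξ + ξ + l) * (suc (ξ + ξ) + i + j)) ≡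
          suc (ξ + ξ) * suc (ξ + ξ) + (suc ((ξ + i) + (ξ + i)) * suc ((ξ + j) + (ξ + j)) +
          suc ((ξ + j) + (ξ + j)) * suc ((ξ + l) + (ξ + l)) + suc ((ξ + i) + (ξ + i)) * suc ((ξ + l) + (ξ + l)))
        lem = ℕ-solve-∀

  g-supp-x : ∀ w i j → Supp (λ x → g x w i j)
  g-supp-x w i j x l = g-vanish x w i j (ℕ.≤-trans l (subst (x ≤_) (sym (e x w i j)) (ℕ.m≤m+n x _)))
    where
    e : ∀ x w i j → i * j + suc w * (suc x + i + j) ≡ x + (suc i + j + i * j + w * (suc x + i + j))
    e = ℕ-solve-∀

  g-supp-w : ∀ x i j → Supp (λ w → g x w i j)
  g-supp-w x i j w l = g-vanish x w i j (ℕ.≤-trans l (subst (w ≤_) (sym (e x w i j)) (ℕ.m≤m+n w _)))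
    where
    e : ∀ x w i j → i * j + suc w * (suc x + i + j) ≡ w + (suc x + i + j + i * j + w * (x + i + j))
    e = ℕ-solve-∀

  g-supp-i : ∀ x w j → Supp (λ i → g x w i j)
  g-supp-i x w j i l = g-vanish x w i j (ℕ.≤-trans l (subst (i ≤_) (sym (e x w i j)) (ℕ.m≤m+n i _)))
    where
    e : ∀ x w i j → i * j + suc w * (suc x + i + j) ≡ i + (suc x + j + i * j + w * (suc x + i + j))
    e = ℕ-solve-∀

  K₁ Γ : ℤ
  K₁ = ∑⁴ λ w y i j → v (w + i) (w + j) y w
  Γ  = ∑⁴ λ w x i j → g x w i j

  -- The case p ≥ w is p = w + i, that is, a = x + 2i.
  le≡τ+K₁ : le ≡ τ +ᶻ K₁
  le≡τ+K₁ = trans (∑-≡+ {h = λ y → ∑³ λ w i j → v (w + i) (w + j) y w} λ y → ∑-≡+ λ w →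
      trans (∑-split w (λ p → ∑ λ j → v p (w + j) y w) λ p l → sumTo-zero B λ j → v-supp-p (w + j) y w p l)
            (cong (_+ᶻ ∑² (λ i j → v (w + i) (w + j) y w)) (sym (sumTo-swap B w λ j p → v p (w + j) y w))))
    (cong (τ +ᶻ_) (∑⁴-swap₁₂ (λ y w i j → v (w + i) (w + j) y w)))

  -- The case w ≥ x is c ≥ x, the part of the sum that u does not reach; w < x leaves a positive y =
  -- x - w.
  Γ≡S₀+K₁ : Γ ≡ S₀ +ᶻ K₁
  Γ≡S₀+K₁ = trans (∑²-compare (λ w x → ∑² (g x w))
      (λ w x l → sumTo-zero B λ i → sumTo-zero B λ j → g-supp-x w i j x l)
      (λ x w l → sumTo-zero B λ i → sumTo-zero B λ j → g-supp-w x i j w l))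
    (cong₂ _+ᶻ_
      (trans (∑-odd (λ x → ∑³ λ l → g x (x + l))
          (λ x l → sumTo-zero B λ k → sumTo-zero B λ i → sumTo-zero B λ j → g-supp-x (x + k) i j x l)
          (λ n → sumTo-zero B λ l → sumTo-zero B λ i → sumTo-zero B λ j → g-even n (suc (n + n) + l) i j))
        (trans (∑⁴-swap₂₃ (λ ξ l i j → g (ξ + ξ) (ξ + ξ + l) i j))
          (trans (∑⁴-swap₃₄ (λ ξ i l j → g (ξ + ξ) (ξ + ξ + l) i j))
            (∑⁴-cong λ ξ i j l → g≡s ξ i j l))))
      (∑⁴-cong g≡v))

  -- A linear consequence of the relations between the pieces. Everything on the right can be
  -- rewritten over paths: `Γ` and `D₄` up to boundary terms and symmetry, and the middle bracket as
  -- the difference of the parts q ≥ w and q < w of `U`.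
  S-formula : S +ᶻ S ≡ (Γ +ᶻ Γ) +ᶻ (le -ᶻ (τ +ᶻ gg)) -ᶻ (D₄ +ᶻ D₄)
  S-formula = begin
    S +ᶻ S
      ≡⟨ cong (λ t → t +ᶻ t) (trans S-split (cong₂ (λ a b → S₀ +ᶻ ((a +ᶻ (a +ᶻ a)) +ᶻ b)) R₃≡ρ σ₃≡σ₃′)) ⟩
    (S₀ +ᶻ ((ρ +ᶻ (ρ +ᶻ ρ)) +ᶻ σ₃′)) +ᶻ (S₀ +ᶻ ((ρ +ᶻ (ρ +ᶻ ρ)) +ᶻ σ₃′))
      ≡⟨ combine ρ κ₂ κ₃ σ₃′ D₄ τ leN S₀ K₁
           (trans (sym le≡leN+ρ+κ₂) le≡τ+K₁)
           (trans (cong₂ (λ a b → a +ᶻ (τ +ᶻ b)) (sym le≡leN+ρ+κ₂) (sym gg≡))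
             (trans (sym U-split) (trans U≡N+N (cong (λ t → t +ᶻ t) N-split)))) ⟩
    ((S₀ +ᶻ K₁) +ᶻ (S₀ +ᶻ K₁)) +ᶻ ((leN +ᶻ (ρ +ᶻ κ₂)) -ᶻ (τ +ᶻ (κ₃ +ᶻ (σ₃′ +ᶻ ((κ₃ +ᶻ κ₃) +ᶻ D₄))))) -ᶻ (D₄ +ᶻ D₄)
      ≡⟨ sym (cong₂ (λ a b → a +ᶻ b -ᶻ (D₄ +ᶻ D₄)) (cong (λ t → t +ᶻ t) Γ≡S₀+K₁)
           (cong₂ (λ a b → a -ᶻ (τ +ᶻ b)) le≡leN+ρ+κ₂ gg≡)) ⟩
    (Γ +ᶻ Γ) +ᶻ (le -ᶻ (τ +ᶻ gg)) -ᶻ (D₄ +ᶻ D₄) ∎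
    where
    open ≡-Reasoning
    combine : ∀ ρ k₂ k₃ σ d τ n s₀ k₁ → n +ᶻ (ρ +ᶻ k₂) ≡ τ +ᶻ k₁ →
      (n +ᶻ (ρ +ᶻ k₂)) +ᶻ (τ +ᶻ (k₃ +ᶻ (σ +ᶻ ((k₃ +ᶻ k₃) +ᶻ d)))) ≡ (n +ᶻ (k₂ +ᶻ k₃)) +ᶻ (n +ᶻ (k₂ +ᶻ k₃)) →
      (s₀ +ᶻ ((ρ +ᶻ (ρ +ᶻ ρ)) +ᶻ σ)) +ᶻ (s₀ +ᶻ ((ρ +ᶻ (ρ +ᶻ ρ)) +ᶻ σ)) ≡
      ((s₀ +ᶻ k₁) +ᶻ (s₀ +ᶻ k₁)) +ᶻ ((n +ᶻ (ρ +ᶻ k₂)) -ᶻ (τ +ᶻ (k₃ +ᶻ (σ +ᶻ ((k₃ +ᶻ k₃) +ᶻ d))))) -ᶻ (d +ᶻ d)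
    combine ρ k₂ k₃ σ d τ n s₀ k₁ e₁ e₂ = trans (lem ρ k₂ k₃ σ d τ n s₀ k₁)
      -- The coefficients 2 and 3 eliminate K₁ and τ, after which both sides equal 2 S₀ + 6 ρ + 2 σ.
      (trans (cong₂ (λ a b → rhs +ᶻ (pos 2 *ᶻ a +ᶻ pos 3 *ᶻ b)) (ℤ.i≡j⇒i-j≡0 e₁) (ℤ.i≡j⇒i-j≡0 e₂)) (ℤ.+-identityʳ _))
      where
      rhs : ℤ
      rhs = ((s₀ +ᶻ k₁) +ᶻ (s₀ +ᶻ k₁)) +ᶻ ((n +ᶻ (ρ +ᶻ k₂)) -ᶻ (τ +ᶻ (k₃ +ᶻ (σ +ᶻ ((k₃ +ᶻ k₃) +ᶻ d))))) -ᶻ (d +ᶻ d)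
      lem : ∀ ρ k₂ k₃ σ d τ n s₀ k₁ →
        (s₀ +ᶻ ((ρ +ᶻ (ρ +ᶻ ρ)) +ᶻ σ)) +ᶻ (s₀ +ᶻ ((ρ +ᶻ (ρ +ᶻ ρ)) +ᶻ σ)) ≡
        (((s₀ +ᶻ k₁) +ᶻ (s₀ +ᶻ k₁)) +ᶻ ((n +ᶻ (ρ +ᶻ k₂)) -ᶻ (τ +ᶻ (k₃ +ᶻ (σ +ᶻ ((k₃ +ᶻ k₃) +ᶻ d))))) -ᶻ (d +ᶻ d)) +ᶻ
        (pos 2 *ᶻ ((n +ᶻ (ρ +ᶻ k₂)) -ᶻ (τ +ᶻ k₁)) +ᶻ
         pos 3 *ᶻ (((n +ᶻ (ρ +ᶻ k₂)) +ᶻ (τ +ᶻ (k₃ +ᶻ (σ +ᶻ ((k₃ +ᶻ k₃) +ᶻ d))))) -ᶻ ((n +ᶻ (k₂ +ᶻ k₃)) +ᶻ (n +ᶻ (k₂ +ᶻ k₃)))))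
      lem = ℤ-solve-∀

-- Kronecker deltas and the weights on paths

δ : ℕ → ℕ → ℤ
δ m n with m ≟ n
... | yes _ = 1ℤ
... | no  _ = 0ℤ

δ-≢ : ∀ {m n} → m ≢ n → δ m n ≡ 0ℤ
δ-≢ {m} {n} m≢n with m ≟ n
... | yes e = ⊥-elim (m≢n e)
... | no  _ = refl

δ-refl : ∀ n → δ n n ≡ 1ℤ
δ-refl n with n ≟ n
... | yes _ = refl
... | no ne = ⊥-elim (ne refl)

δ-subst : ∀ m n (f : ℕ → ℤ) → δ m n *ᶻ f m ≡ δ m n *ᶻ f n
δ-subst m n f with m ≟ n
... | yes refl = refl
... | no  _    = refl

δ-*4 : ∀ m n → δ (4 * m) (4 * n) ≡ δ m n
δ-*4 m n with m ≟ n
... | yes refl = δ-refl (4 * m)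
... | no m≢n   = δ-≢ λ e → m≢n (ℕ.*-cancelˡ-≡ m n 4 e)

double-zero : ∀ i → i +ᶻ i ≡ 0ℤ → i ≡ 0ℤ
double-zero i e = ℤ.*-cancelˡ-≡ (pos 2) i 0ℤ (trans (lem i) e)
  where
  lem : ∀ i → pos 2 *ᶻ i ≡ i +ᶻ i
  lem = ℤ-solve-∀

-- The weights are interpreted both in ℤ and in the syntax of the ring solver; the Booleans are the parities of the integers.
-- Sums of h over pq + yw = M vanish; h is chosen such that sorting such a sum by q ≤ w or q > w, which turns it into a sum
-- over the paths ab + bc + cd = M, cancels the remaining weights up to reversal of the paths.
record Operations (R : Set) : Set where
  infixl 6 _⊕_
  infixl 7 _⊗_
  infix  8 ⊖_
  field
    _⊕_ _⊗_ : R → R → R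
    ⊖_      : R → R
    k       : ℤ → R

module Weights {R : Set} (ops : Operations R) where
  open Operations ops

  F : R → R → R
  F Q x = Q ⊕ (⊖ (x ⊗ x))

  path : R → R → R → R → R
  path a b c d = a ⊗ b ⊕ b ⊗ c ⊕ c ⊗ d

  -- `hD` is the weight in `u`. `t₁` and `t₂` are those of the interior of `Γ` and of `D₄` in path
  -- coordinates, where x becomes d - a and a + b + c + d respectively.
  hD t₁ t₂ h₁ h₂ h₃ h₄ h : Bool → Bool → Bool → Bool → R → R → R → R → R
  hD P Q Y W p q y w = k ⟦ P ⟧ ⊗ k ⟦ Q ⟧ ⊗ (k ⟦ Y xor W ⟧ ⊗ F (p ⊗ q ⊕ y ⊗ w) (y ⊕ w))
  t₁ A B C D a b c d = k ⟦ A xor C ⟧ ⊗ k ⟦ B xor C ⟧ ⊗ (k ⟦ A xor D ⟧ ⊗ F (path a b c d) (d ⊕ (⊖ a)))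
  t₂ A B C D a b c d = k ⟦ B xor C ⟧ ⊗ k ⟦ D ⟧ ⊗ (k ⟦ (A xor B) xor (C xor D) ⟧ ⊗ F (path a b c d) (a ⊕ b ⊕ (c ⊕ d)))
  h₁ P Q Y W p q y w = k ⟦ not Q ⟧ ⊗ k ⟦ P ⟧ ⊗ (k ⟦ Y ⟧ ⊗ k ⟦ W ⟧) ⊗ (k (pos 3) ⊗ (q ⊗ q ⊕ (⊖ (q ⊗ p)) ⊕ (⊖ (p ⊗ p)) ⊕ y ⊗ w))
  h₂ P Q Y W p q y w = k ⟦ not Q ⟧ ⊗ k ⟦ not P ⟧ ⊗ (k ⟦ Y ⟧ ⊗ k ⟦ W ⟧) ⊗ (k (pos 4) ⊗ (q ⊗ q))
  h₃ P Q Y W p q y w = k ⟦ not Q ⟧ ⊗ k ⟦ P ⟧ ⊗ (k ⟦ Y ⟧ ⊗ k ⟦ W ⟧) ⊗ (k (pos 4) ⊗ (p ⊗ w) ⊕ k (pos 2) ⊗ (w ⊗ w))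
  h₄ P Q Y W p q y w = k ⟦ not P ⟧ ⊗ k ⟦ Q ⟧ ⊗ (k ⟦ Y ⟧ ⊗ k ⟦ W ⟧) ⊗ (k (pos 2) ⊗ (w ⊗ w) ⊕ (⊖ (k (pos 4) ⊗ (q ⊗ w))))
  -- h₁ and h₂ are antisymmetrised in (p, q), h₃ and h₄ in (y, w).
  h P Q Y W p q y w =
    (h₁ P Q Y W p q y w ⊕ h₂ P Q Y W p q y w) ⊕ (⊖ (h₁ Q P Y W q p y w ⊕ h₂ Q P Y W q p y w)) ⊕
    ((h₃ P Q Y W p q y w ⊕ h₄ P Q Y W p q y w) ⊕ (⊖ (h₃ P Q W Y p q w y ⊕ h₄ P Q W Y p q w y)))

  -- The substitutions (p, q, y, w) = (b, c + a, d, c) with q > w, and (a, b, c, b + d) with q < w.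
  -- Both turn pq + yw into ab + bc + cd.
  up down : (Bool → Bool → Bool → Bool → R → R → R → R → R) → Bool → Bool → Bool → Bool → R → R → R → R → R
  up   f A B C D a b c d = f B (C xor A) D C b (c ⊕ a) d c
  down f A B C D a b c d = f A B C (B xor D) a b c (b ⊕ d)

  total : Bool → Bool → Bool → Bool → R → R → R → R → R
  total A B C D a b c d =
    t₁ A B C D a b c d ⊕ (⊖ t₂ A B C D a b c d) ⊕ up hD A B C D a b c d ⊕ (⊖ down hD A B C D a b c d) ⊕
    (⊖ (up h A B C D a b c d ⊕ down h A B C D a b c d))

  -- The ties q = w contribute -h and `hD`, the latter with p and y exchanged, which preserves q (p
  -- + y). Four times the summand for b = x < a is added. `boundary′` is the value after
  -- cancellation.
  boundary boundary′ : Bool → Bool → Bool → R → R → R → R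
  boundary P Q Y p q y =
    (⊖ h P Q Y Q p q y q) ⊕ hD Y Q P Q y q p q ⊕
    k (pos 4) ⊗ (k ⟦ Q xor P ⟧ ⊗ k ⟦ Q ⟧ ⊗ (k ⟦ Y ⟧ ⊗ F (q ⊗ (p ⊕ y)) y))
  boundary′ P Q Y p q y = k (pos 2) ⊗ (k ⟦ Q ⟧ ⊗ (k ⟦ not P ⟧ ⊗ k ⟦ Y ⟧ ⊗ (p ⊗ p ⊕ (⊖ ((q ⊕ (⊖ y)) ⊗ (q ⊕ (⊖ y)))))))

integers : Operations ℤ
integers = record { _⊕_ = _+ᶻ_; _⊗_ = _*ᶻ_; ⊖_ = -ᶻ_; k = λ i → i }

open Weights integers public

module _ where
  open +-*-Solver using (Polynomial; solve; _:+_; _:*_; :-_; _:=_; con)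
  private
    polynomials : ∀ n → Operations (Polynomial n)
    polynomials n = record { _⊕_ = _:+_; _⊗_ = _:*_; ⊖_ = :-_; k = con }

    module Syntax {n : ℕ} = Weights (polynomials n)

    claim : Bool → Bool → Bool → Bool → Polynomial 4 → Polynomial 4 → Polynomial 4 → Polynomial 4 → _
    claim A B C D a b c d = Syntax.total A B C D a b c d :+ Syntax.total D C B A d c b a := con 0ℤ

  -- Once the parities are fixed, all indicators are constants and a polynomial identity in a, b, c,
  -- d remains.
  total-reversal : ∀ A B C D a b c d → total A B C D a b c d +ᶻ total D C B A d c b a ≡ 0ℤ
  total-reversal true true true true = solve 4 (claim true true true true) refl
  total-reversal true true true false = solve 4 (claim true true true false) refl
  total-reversal true true false true = solve 4 (claim true true false true) refl
  total-reversal true true false false = solve 4 (claim true true false false) refl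
  total-reversal true false true true = solve 4 (claim true false true true) refl
  total-reversal true false true false = solve 4 (claim true false true false) refl
  total-reversal true false false true = solve 4 (claim true false false true) refl
  total-reversal true false false false = solve 4 (claim true false false false) refl
  total-reversal false true true true = solve 4 (claim false true true true) refl
  total-reversal false true true false = solve 4 (claim false true true false) refl
  total-reversal false true false true = solve 4 (claim false true false true) refl
  total-reversal false true false false = solve 4 (claim false true false false) refl
  total-reversal false false true true = solve 4 (claim false false true true) refl
  total-reversal false false true false = solve 4 (claim false false true false) refl
  total-reversal false false false true = solve 4 (claim false false false true) refl
  total-reversal false false false false = solve 4 (claim false false false false) refl

  private
    claim₁ claim₂ : Bool → Bool → Bool → Bool → Polynomial 4 → Polynomial 4 → Polynomial 4 → Polynomial 4 → _
    claim₁ A B C D a b c d = Syntax.t₁ A B C D a b c d := Syntax.t₁ D C B A d c b a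
    claim₂ A B C D a b c d = Syntax.t₂ A B C D a b c d := Syntax.t₂ D C B A d c b a

    claim₃ : Bool → Bool → Bool → Polynomial 3 → Polynomial 3 → Polynomial 3 → _
    claim₃ P Q Y p q y = Syntax.boundary P Q Y p q y := Syntax.boundary′ P Q Y p q y

  t₁-reversal : ∀ A B C D a b c d → t₁ A B C D a b c d ≡ t₁ D C B A d c b a
  t₁-reversal true true true true = solve 4 (claim₁ true true true true) refl
  t₁-reversal true true true false = solve 4 (claim₁ true true true false) refl
  t₁-reversal true true false true = solve 4 (claim₁ true true false true) refl
  t₁-reversal true true false false = solve 4 (claim₁ true true false false) refl
  t₁-reversal true false true true = solve 4 (claim₁ true false true true) refl
  t₁-reversal true false true false = solve 4 (claim₁ true false true false) refl
  t₁-reversal true false false true = solve 4 (claim₁ true false false true) refl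
  t₁-reversal true false false false = solve 4 (claim₁ true false false false) refl
  t₁-reversal false true true true = solve 4 (claim₁ false true true true) refl
  t₁-reversal false true true false = solve 4 (claim₁ false true true false) refl
  t₁-reversal false true false true = solve 4 (claim₁ false true false true) refl
  t₁-reversal false true false false = solve 4 (claim₁ false true false false) refl
  t₁-reversal false false true true = solve 4 (claim₁ false false true true) refl
  t₁-reversal false false true false = solve 4 (claim₁ false false true false) refl
  t₁-reversal false false false true = solve 4 (claim₁ false false false true) refl
  t₁-reversal false false false false = solve 4 (claim₁ false false false false) refl

  t₂-reversal : ∀ A B C D a b c d → t₂ A B C D a b c d ≡ t₂ D C B A d c b a
  t₂-reversal true true true true = solve 4 (claim₂ true true true true) refl
  t₂-reversal true true true false = solve 4 (claim₂ true true true false) refl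
  t₂-reversal true true false true = solve 4 (claim₂ true true false true) refl
  t₂-reversal true true false false = solve 4 (claim₂ true true false false) refl
  t₂-reversal true false true true = solve 4 (claim₂ true false true true) refl
  t₂-reversal true false true false = solve 4 (claim₂ true false true false) refl
  t₂-reversal true false false true = solve 4 (claim₂ true false false true) refl
  t₂-reversal true false false false = solve 4 (claim₂ true false false false) refl
  t₂-reversal false true true true = solve 4 (claim₂ false true true true) refl
  t₂-reversal false true true false = solve 4 (claim₂ false true true false) refl
  t₂-reversal false true false true = solve 4 (claim₂ false true false true) refl
  t₂-reversal false true false false = solve 4 (claim₂ false true false false) refl
  t₂-reversal false false true true = solve 4 (claim₂ false false true true) refl
  t₂-reversal false false true false = solve 4 (claim₂ false false true false) refl
  t₂-reversal false false false true = solve 4 (claim₂ false false false true) refl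
  t₂-reversal false false false false = solve 4 (claim₂ false false false false) refl

  boundary≡ : ∀ P Q Y p q y → boundary P Q Y p q y ≡ boundary′ P Q Y p q y
  boundary≡ true true true = solve 3 (claim₃ true true true) refl
  boundary≡ true true false = solve 3 (claim₃ true true false) refl
  boundary≡ true false true = solve 3 (claim₃ true false true) refl
  boundary≡ true false false = solve 3 (claim₃ true false false) refl
  boundary≡ false true true = solve 3 (claim₃ false true true) refl
  boundary≡ false true false = solve 3 (claim₃ false true false) refl
  boundary≡ false false true = solve 3 (claim₃ false false true) refl
  boundary≡ false false false = solve 3 (claim₃ false false false) refl

xor-cancel : ∀ A B → A xor (A xor B) ≡ B
xor-cancel true  true  = refl
xor-cancel true  false = refl
xor-cancel false B     = refl

t₁-ends : ∀ A B C a b c → t₁ A B C A a b c a ≡ 0ℤ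
t₁-ends A B C a b c rewrite xor-same A = ℤ.*-zeroʳ (⟦ A xor C ⟧ *ᶻ ⟦ B xor C ⟧)

t₂-middle : ∀ A B D a b d → t₂ A B B D a b b d ≡ 0ℤ
t₂-middle A B D a b d rewrite xor-same B = refl

Weight : Set
Weight = Bool → Bool → Bool → Bool → ℤ → ℤ → ℤ → ℤ → ℤ

at : Weight → ℕ → ℕ → ℕ → ℕ → ℤ
at f a b c d = f (odd a) (odd b) (odd c) (odd d) (pos a) (pos b) (pos c) (pos d)

pos-*+* : ∀ p q y w → pos (p * q + y * w) ≡ pos p *ᶻ pos q +ᶻ pos y *ᶻ pos w
pos-*+* p q y w = cong₂ _+ᶻ_ (ℤ.pos-* p q) (ℤ.pos-* y w)

pathℕ : ℕ → ℕ → ℕ → ℕ → ℕ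
pathℕ a b c d = a * b + b * c + c * d

pos-path : ∀ a b c d → pos (pathℕ a b c d) ≡ path (pos a) (pos b) (pos c) (pos d)
pos-path a b c d = cong₂ _+ᶻ_ (pos-*+* a b b c) (ℤ.pos-* c d)

data Halved : ℕ → Set where
  even : ∀ n → Halved (n + n)
  odd′ : ∀ n → Halved (suc (n + n))

halve : ∀ m → Halved m
halve zero = even 0
halve (suc m) with halve m
... | even n = odd′ n
... | odd′ n = subst Halved (cong suc (ℕ.+-suc n n)) (even (suc n))

-- Only the even numbers 2k with 1 ≤ k ≤ n contribute, each with 4k + c.
sum-even : ∀ n c → sumTo (n + n) (λ p → ⟦ not (odd (suc p)) ⟧ *ᶻ (pos 2 *ᶻ pos (suc p) +ᶻ c)) ≡
  pos n *ᶻ (pos 2 *ᶻ (pos n +ᶻ 1ℤ) +ᶻ c)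
sum-even zero    c = refl
sum-even (suc n) c rewrite ℕ.+-suc n n = begin
  sumTo (suc (suc (n + n))) f  ≡⟨ sumTo-last (suc (n + n)) f ⟩
  sumTo (suc (n + n)) f +ᶻ f (suc (n + n))  ≡⟨ cong (_+ᶻ f (suc (n + n))) (sumTo-last (n + n) f) ⟩
  sumTo (n + n) f +ᶻ f (n + n) +ᶻ f (suc (n + n))
    ≡⟨ cong₂ _+ᶻ_ (cong₂ _+ᶻ_ (sum-even n c) (cong (λ b → ⟦ not (not b) ⟧ *ᶻ (pos 2 *ᶻ pos (suc (n + n)) +ᶻ c)) (odd-double n)))
                  (cong (λ b → ⟦ not (not (not b)) ⟧ *ᶻ (pos 2 *ᶻ pos (suc (suc (n + n))) +ᶻ c)) (odd-double n)) ⟩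
  pos n *ᶻ (pos 2 *ᶻ (pos n +ᶻ 1ℤ) +ᶻ c) +ᶻ 0ℤ +ᶻ 1ℤ *ᶻ (pos 2 *ᶻ (pos 2 +ᶻ (pos n +ᶻ pos n)) +ᶻ c)
    ≡⟨ lem (pos n) c ⟩
  (1ℤ +ᶻ pos n) *ᶻ (pos 2 *ᶻ (1ℤ +ᶻ pos n +ᶻ 1ℤ) +ᶻ c) ∎
  where
  open ≡-Reasoning
  f : ℕ → ℤ
  f p = ⟦ not (odd (suc p)) ⟧ *ᶻ (pos 2 *ᶻ pos (suc p) +ᶻ c)
  lem : ∀ n c → n *ᶻ (pos 2 *ᶻ (n +ᶻ 1ℤ) +ᶻ c) +ᶻ 0ℤ +ᶻ 1ℤ *ᶻ (pos 2 *ᶻ (pos 2 +ᶻ (n +ᶻ n)) +ᶻ c) ≡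
    (1ℤ +ᶻ n) *ᶻ (pos 2 *ᶻ (1ℤ +ᶻ n +ᶻ 1ℤ) +ᶻ c)
  lem = ℤ-solve-∀

⟦⟧-not-xor : ∀ P Y → ⟦ not P ⟧ *ᶻ ⟦ Y ⟧ ≡ ⟦ not P ⟧ *ᶻ ⟦ P xor Y ⟧
⟦⟧-not-xor true  Y = refl
⟦⟧-not-xor false Y = refl

-- The recurrence for the weight M - x²

module Recurrence (M B : ℕ) (M<B : M < B) where

  Δ : ℕ → ℤ
  Δ = δ M

  Δ-supp : ∀ n → B ≤ n → Δ n ≡ 0ℤ
  Δ-supp n B≤n = δ-≢ {M} {n} λ { refl → ℕ.<⇒≱ M<B B≤n }

  G₄ : ℕ → ℕ → ℤ
  G₄ n x = δ (4 * M) n *ᶻ F (pos M) (pos x)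

  G₄-supp : ∀ n x → 4 * B ≤ n → G₄ n x ≡ 0ℤ
  G₄-supp n x l = cong (_*ᶻ F (pos M) (pos x)) (δ-≢ {4 * M} {n} λ { refl → ℕ.<⇒≱ M<B (ℕ.*-cancelˡ-≤ 4 l) })

  open Box B public
  open Decomposition B G₄ G₄-supp

  -- On the support of the delta M equals n, so the weight may be taken to be n - x². This is a
  -- polynomial in the summation variables, as the ring solver needs.
  G≡ : ∀ n x → G n x ≡ Δ n *ᶻ F (pos n) (pos x)
  G≡ n x = trans (cong (_*ᶻ F (pos M) (pos x)) (δ-*4 M n)) (δ-subst M n (λ t → F (pos t) (pos x)))

  opaque
    Δ⟨_⟩_ : ℕ → ℤ → ℤ
    Δ⟨ n ⟩ i = Δ n *ᶻ i

    Δ-vanish : ∀ n i → B ≤ n → Δ⟨ n ⟩ i ≡ 0ℤ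
    Δ-vanish n i l = cong (_*ᶻ i) (Δ-supp n l)

    Δ-zero : ∀ n → Δ⟨ n ⟩ 0ℤ ≡ 0ℤ
    Δ-zero n = ℤ.*-zeroʳ (Δ n)

    Δ-+ : ∀ n i j → Δ⟨ n ⟩ (i +ᶻ j) ≡ Δ⟨ n ⟩ i +ᶻ Δ⟨ n ⟩ j
    Δ-+ n i j = ℤ.*-distribˡ-+ (Δ n) i j

    Δ-neg : ∀ n i → Δ⟨ n ⟩ (-ᶻ i) ≡ -ᶻ Δ⟨ n ⟩ i
    Δ-neg n i = sym (ℤ.neg-distribʳ-* (Δ n) i)

    Δ-* : ∀ n i j → Δ⟨ n ⟩ (i *ᶻ j) ≡ i *ᶻ Δ⟨ n ⟩ j
    Δ-* n i j = lem (Δ n) i j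
      where
      lem : ∀ d i j → d *ᶻ (i *ᶻ j) ≡ i *ᶻ (d *ᶻ j)
      lem = ℤ-solve-∀

    weighted-G : ∀ c d e n x → c *ᶻ d *ᶻ (e *ᶻ G n x) ≡ Δ⟨ n ⟩ (c *ᶻ d *ᶻ (e *ᶻ F (pos n) (pos x)))
    weighted-G c d e n x = trans (cong (λ t → c *ᶻ d *ᶻ (e *ᶻ t)) (G≡ n x)) (lem c d e (Δ n) (F (pos n) (pos x)))
      where
      lem : ∀ c d e D f → c *ᶻ d *ᶻ (e *ᶻ (D *ᶻ f)) ≡ D *ᶻ (c *ᶻ d *ᶻ (e *ᶻ f))
      lem = ℤ-solve-∀

  opaque
    unfolding u

    u≡ : ∀ p q y w → u p q y w ≡ Δ⟨ p * q + y * w ⟩ at hD p q y w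
    u≡ p q y w = trans (weighted-G (χ p) (χ q) (χ (y + w)) (p * q + y * w) (y + w))
      (cong₂ (λ e n → Δ⟨ p * q + y * w ⟩ (χ p *ᶻ χ q *ᶻ (⟦ e ⟧ *ᶻ F n (pos (y + w))))) (odd-+ y w) (pos-*+* p q y w))

  Uterm Pterm : (ℕ → ℕ → ℕ → ℕ → ℤ) → ℕ → ℕ → ℕ → ℕ → ℤ
  Uterm f p q y w = Δ⟨ suc p * suc q + suc y * suc w ⟩ f (suc p) (suc q) (suc y) (suc w)
  Pterm f a b c d = Δ⟨ pathℕ (suc a) (suc b) (suc c) (suc d) ⟩ f (suc a) (suc b) (suc c) (suc d)

  Tterm : (ℕ → ℕ → ℕ → ℤ) → ℕ → ℕ → ℕ → ℤ
  Tterm f p q y = Δ⟨ suc q * (suc p + suc y) ⟩ f (suc p) (suc q) (suc y)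

  Usum Psum : (ℕ → ℕ → ℕ → ℕ → ℤ) → ℤ
  Usum f = ∑⁴ (Uterm f)
  Psum f = ∑⁴ (Pterm f)

  Tsum : (ℕ → ℕ → ℕ → ℤ) → ℤ
  Tsum f = ∑³ (Tterm f)

  Uterm-supp-w : ∀ f p q y → Supp (Uterm f p q y)
  Uterm-supp-w f p q y w l = Δ-vanish _ _ (ℕ.≤-trans l (ℕ.≤-trans (ℕ.≤-trans (ℕ.n≤1+n w)
    (ℕ.m≤n*m (suc w) (suc y))) (ℕ.m≤n+m (suc y * suc w) (suc p * suc q))))

  Uterm-supp-q : ∀ f p y w → Supp (λ q → Uterm f p q y w)
  Uterm-supp-q f p y w q l = Δ-vanish _ _ (ℕ.≤-trans l (ℕ.≤-trans (ℕ.≤-trans (ℕ.n≤1+n q)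
    (ℕ.m≤n*m (suc q) (suc p))) (ℕ.m≤m+n (suc p * suc q) (suc y * suc w))))

  leSum gtSum : (ℕ → ℕ → ℕ → ℕ → ℤ) → ℤ
  leSum f = ∑⁴ λ p y w j → Uterm f p (w + j) y w
  gtSum f = ∑⁴ λ p y q d → Uterm f p q y (suc (q + d))

  Usum-split : ∀ f → Usum f ≡ leSum f +ᶻ gtSum f
  Usum-split f = ∑-≡+ λ p → trans (∑³-swap₁₂ (Uterm f p)) (∑-≡+ λ y →
    ∑²-compare (λ q w → Uterm f p q y w) (λ q → Uterm-supp-w f p q y) (λ w → Uterm-supp-q f p y w))

  -- Ties give q (p + y) = M. For q = w + a, the equation p (w + a) + yw = ap + pw + wy yields the
  -- path (a, p, w, y).
  leSum-path : ∀ f → leSum f ≡ Tsum (λ p q y → f p q y q) +ᶻ Psum (λ a b c d → f b (c + a) d c)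
  leSum-path f = trans (∑-≡+ {h = λ p → ∑³ λ y w v → Uterm f p (w + suc v) y w} λ p → trans (∑-≡+ λ y → ∑-≡+ λ w →
      trans (∑-split₀ (λ j → Uterm f p (w + j) y w) λ j l → Uterm-supp-q f p y w (w + j) (ℕ.≤-trans l (ℕ.m≤n+m j w)))
        (cong (_+ᶻ ∑ λ v → Uterm f p (w + suc v) y w)
          (trans (cong (λ q → Uterm f p q y w) (ℕ.+-identityʳ w))
            (cong (Δ⟨_⟩ f (suc p) (suc w) (suc y) (suc w)) (e₁ p w y)))))
      (cong (_+ᶻ ∑³ λ y w v → Uterm f p (w + suc v) y w) (∑-swap (λ y w → Tterm (λ p q y → f p q y q) p w y))))
    (cong (Tsum (λ p q y → f p q y q) +ᶻ_) (begin
      ∑⁴ (λ p y w v → Uterm f p (w + suc v) y w)  ≡⟨ ∑⁴-swap₂₃ (λ p y w v → Uterm f p (w + suc v) y w) ⟩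
      ∑⁴ (λ p w y v → Uterm f p (w + suc v) y w)  ≡⟨ ∑⁴-swap₃₄ (λ p w y v → Uterm f p (w + suc v) y w) ⟩
      ∑⁴ (λ p w v y → Uterm f p (w + suc v) y w)  ≡⟨ ∑⁴-swap₂₃ (λ p w v y → Uterm f p (w + suc v) y w) ⟩
      ∑⁴ (λ p v w y → Uterm f p (w + suc v) y w)  ≡⟨ ∑⁴-swap₁₂ (λ p v w y → Uterm f p (w + suc v) y w) ⟩
      ∑⁴ (λ v p w y → Uterm f p (w + suc v) y w)
        ≡⟨ (∑⁴-cong λ a b c d → cong (Δ⟨_⟩ f (suc b) (suc c + suc a) (suc d) (suc c)) (e₂ (suc a) (suc b) (suc c) (suc d))) ⟩
      Psum (λ a b c d → f b (c + a) d c) ∎))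
    where
    open ≡-Reasoning
    e₁ : ∀ p w y → suc p * suc w + suc y * suc w ≡ suc w * (suc p + suc y)
    e₁ = ℕ-solve-∀
    e₂ : ∀ a b c d → b * (c + a) + d * c ≡ a * b + b * c + c * d
    e₂ = ℕ-solve-∀

  -- For w = q + d, the equation pq + y (q + d) = pq + qy + yd yields the path (p, q, y, d).
  gtSum-path : ∀ f → gtSum f ≡ Psum (λ a b c d → f a b c (b + d))
  gtSum-path f = trans (∑⁴-swap₂₃ (λ p y q d → Uterm f p q y (suc (q + d))))
    (∑⁴-cong λ a b c d → trans (cong (λ t → Uterm f a b c t) (sym (ℕ.+-suc b d)))
      (cong (Δ⟨_⟩ f (suc a) (suc b) (suc c) (suc b + suc d)) (e (suc a) (suc b) (suc c) (suc d))))
    where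
    e : ∀ a b c d → a * b + c * (b + d) ≡ a * b + b * c + c * d
    e = ℕ-solve-∀

  le≡ : le ≡ leSum (at hD)
  le≡ = trans (∑⁴-cong λ y w p j → u≡ (suc p) (suc (w + j)) (suc y) (suc w))
    (trans (∑⁴-swap₂₃ (λ y w p j → Uterm (at hD) p (w + j) y w))
           (∑⁴-swap₁₂ (λ y p w j → Uterm (at hD) p (w + j) y w)))

  U≡Usum : U ≡ Usum (at hD)
  U≡Usum = trans (∑⁴-cong λ y w p q → u≡ (suc p) (suc q) (suc y) (suc w)) (begin
    ∑⁴ (λ y w p q → Uterm (at hD) p q y w) ≡⟨ ∑⁴-swap₂₃ (λ y w p q → Uterm (at hD) p q y w) ⟩
    ∑⁴ (λ y p w q → Uterm (at hD) p q y w) ≡⟨ ∑⁴-swap₁₂ (λ y p w q → Uterm (at hD) p q y w) ⟩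
    ∑⁴ (λ p y w q → Uterm (at hD) p q y w) ≡⟨ ∑⁴-swap₃₄ (λ p y w q → Uterm (at hD) p q y w) ⟩
    ∑⁴ (λ p y q w → Uterm (at hD) p q y w) ≡⟨ ∑⁴-swap₂₃ (λ p y q w → Uterm (at hD) p q y w) ⟩
    Usum (at hD) ∎)
    where open ≡-Reasoning

  -- Cancelling the common part q ≥ w from two splittings of `U` avoids a separate matching of `τ`
  -- and `gg`.
  gt≡ : τ +ᶻ gg ≡ gtSum (at hD)
  gt≡ = ∙-cancelˡ le (τ +ᶻ gg) (gtSum (at hD)) (trans (sym U-split) (trans U≡Usum
    (trans (Usum-split (at hD)) (cong (_+ᶻ gtSum (at hD)) (sym le≡)))))

  Pterm-supp-d : ∀ f a b c → Supp (Pterm f a b c)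
  Pterm-supp-d f a b c d l = Δ-vanish _ _ (ℕ.≤-trans l (ℕ.≤-trans (ℕ.≤-trans (ℕ.n≤1+n d)
    (ℕ.m≤n*m (suc d) (suc c))) (ℕ.m≤n+m (suc c * suc d) (suc a * suc b + suc b * suc c))))

  Pterm-supp-a : ∀ f b c d → Supp (λ a → Pterm f a b c d)
  Pterm-supp-a f b c d a l = Δ-vanish _ _ (ℕ.≤-trans l (ℕ.≤-trans (ℕ.≤-trans (ℕ.≤-trans (ℕ.n≤1+n a)
    (ℕ.m≤m*n (suc a) (suc b))) (ℕ.m≤m+n (suc a * suc b) (suc b * suc c)))
    (ℕ.m≤m+n (suc a * suc b + suc b * suc c) (suc c * suc d))))

  Pterm-supp-b : ∀ f a c d → Supp (λ b → Pterm f a b c d)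
  Pterm-supp-b f a c d b l = Δ-vanish _ _ (ℕ.≤-trans l (ℕ.≤-trans (ℕ.≤-trans (ℕ.≤-trans (ℕ.n≤1+n b)
    (ℕ.m≤n*m (suc b) (suc a))) (ℕ.m≤m+n (suc a * suc b) (suc b * suc c)))
    (ℕ.m≤m+n (suc a * suc b + suc b * suc c) (suc c * suc d))))

  Pterm-supp-c : ∀ f a b d → Supp (λ c → Pterm f a b c d)
  Pterm-supp-c f a b d c l = Δ-vanish _ _ (ℕ.≤-trans l (ℕ.≤-trans (ℕ.≤-trans (ℕ.n≤1+n c)
    (ℕ.m≤m*n (suc c) (suc d))) (ℕ.m≤n+m (suc c * suc d) (suc a * suc b + suc b * suc c))))

  ∑⁴-reverse : ∀ f → ∑⁴ f ≡ ∑⁴ (λ d c b a → f a b c d)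
  ∑⁴-reverse f = begin
    ∑⁴ (λ a b c d → f a b c d) ≡⟨ ∑⁴-swap₁₂ (λ a b c d → f a b c d) ⟩
    ∑⁴ (λ b a c d → f a b c d) ≡⟨ ∑⁴-swap₂₃ (λ b a c d → f a b c d) ⟩
    ∑⁴ (λ b c a d → f a b c d) ≡⟨ ∑⁴-swap₃₄ (λ b c a d → f a b c d) ⟩
    ∑⁴ (λ b c d a → f a b c d) ≡⟨ ∑⁴-swap₁₂ (λ b c d a → f a b c d) ⟩
    ∑⁴ (λ c b d a → f a b c d) ≡⟨ ∑⁴-swap₂₃ (λ c b d a → f a b c d) ⟩
    ∑⁴ (λ c d b a → f a b c d) ≡⟨ ∑⁴-swap₁₂ (λ c d b a → f a b c d) ⟩
    ∑⁴ (λ d c b a → f a b c d) ∎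
    where open ≡-Reasoning

  path-reverse : ∀ a b c d → pathℕ a b c d ≡ pathℕ d c b a
  path-reverse = lem
    where
    lem : ∀ a b c d → a * b + b * c + c * d ≡ d * c + c * b + b * a
    lem = ℕ-solve-∀

  Psum-reverse : ∀ f → Psum f ≡ Psum (λ a b c d → f d c b a)
  Psum-reverse f = trans (∑⁴-reverse (Pterm f))
    (∑⁴-cong λ d c b a → cong (Δ⟨_⟩ f (suc a) (suc b) (suc c) (suc d)) (path-reverse (suc a) (suc b) (suc c) (suc d)))

  Pterm-reverse : ∀ f → (∀ a b c d → f a b c d ≡ f d c b a) → ∀ a b c d → Pterm f a b c d ≡ Pterm f d c b a
  Pterm-reverse f r a b c d = cong₂ Δ⟨_⟩_ (path-reverse (suc a) (suc b) (suc c) (suc d)) (r (suc a) (suc b) (suc c) (suc d))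

  -- Reversal exchanges a < d with a > d, and a = d contributes nothing. It removes the restriction
  -- d > a that the coordinates of `Γ°` impose.
  half-ends : ∀ f → (∀ a b c d → f a b c d ≡ f d c b a) → (∀ a b c → f a b c a ≡ 0ℤ) →
    Psum f ≡ ∑⁴ (λ b c a e → Pterm f a b c (suc (a + e))) +ᶻ ∑⁴ (λ b c a e → Pterm f a b c (suc (a + e)))
  half-ends f r z = begin
    ∑⁴ (λ a b c d → Pterm f a b c d)  ≡⟨ ∑⁴-swap₁₂ (λ a b c d → Pterm f a b c d) ⟩
    ∑⁴ (λ b a c d → Pterm f a b c d)  ≡⟨ ∑⁴-swap₂₃ (λ b a c d → Pterm f a b c d) ⟩
    ∑⁴ (λ b c a d → Pterm f a b c d)
      ≡⟨ (∑-≡+ λ b → ∑-≡+ λ c → ∑²-compare (λ a d → Pterm f a b c d) (λ a → Pterm-supp-d f a b c) (λ d → Pterm-supp-a f b c d)) ⟩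
    ∑⁴ (λ b c d j → Pterm f (d + j) b c d) +ᶻ X
      ≡⟨ cong (_+ᶻ X) (trans (∑³-cong λ b c d → trans
           (∑-split₀ (λ j → Pterm f (d + j) b c d) λ j l → Pterm-supp-a f b c d (d + j) (ℕ.≤-trans l (ℕ.m≤n+m j d)))
           (trans (cong (_+ᶻ ∑ λ j → Pterm f (d + suc j) b c d)
                    (trans (cong (λ t → Pterm f t b c d) (ℕ.+-identityʳ d))
                      (trans (cong (Δ⟨ _ ⟩_) (z (suc d) (suc b) (suc c))) (Δ-zero _))))
             (trans (ℤ.+-identityˡ _)
               (∑-cong λ j → trans (Pterm-reverse f r (d + suc j) b c d) (cong (Pterm f d c b) (ℕ.+-suc d j))))))
           (∑⁴-swap₁₂ (λ b c d j → Pterm f d c b (suc (d + j))))) ⟩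
    X +ᶻ X ∎
    where
    open ≡-Reasoning
    X : ℤ
    X = ∑⁴ λ b c a e → Pterm f a b c (suc (a + e))

  -- The same with the middle entries, for `D₄`, where c > b.
  half-middle : ∀ f → (∀ a b c d → f a b c d ≡ f d c b a) → (∀ a b d → f a b b d ≡ 0ℤ) →
    Psum f ≡ ∑⁴ (λ a d b e → Pterm f a b (suc (b + e)) d) +ᶻ ∑⁴ (λ a d b e → Pterm f a b (suc (b + e)) d)
  half-middle f r z = begin
    ∑⁴ (λ a b c d → Pterm f a b c d)  ≡⟨ ∑⁴-swap₃₄ (λ a b c d → Pterm f a b c d) ⟩
    ∑⁴ (λ a b d c → Pterm f a b c d)  ≡⟨ ∑⁴-swap₂₃ (λ a b d c → Pterm f a b c d) ⟩
    ∑⁴ (λ a d b c → Pterm f a b c d)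
      ≡⟨ (∑-≡+ λ a → ∑-≡+ λ d → ∑²-compare (λ b c → Pterm f a b c d) (λ b → Pterm-supp-c f a b d) (λ c → Pterm-supp-b f a c d)) ⟩
    ∑⁴ (λ a d c j → Pterm f a (c + j) c d) +ᶻ X
      ≡⟨ cong (_+ᶻ X) (trans (∑³-cong λ a d c → trans
           (∑-split₀ (λ j → Pterm f a (c + j) c d) λ j l → Pterm-supp-b f a c d (c + j) (ℕ.≤-trans l (ℕ.m≤n+m j c)))
           (trans (cong (_+ᶻ ∑ λ j → Pterm f a (c + suc j) c d)
                    (trans (cong (λ t → Pterm f a t c d) (ℕ.+-identityʳ c))
                      (trans (cong (Δ⟨ _ ⟩_) (z (suc a) (suc c) (suc d))) (Δ-zero _))))
             (trans (ℤ.+-identityˡ _)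
               (∑-cong λ j → trans (Pterm-reverse f r a (c + suc j) c d) (cong (λ t → Pterm f d c t a) (ℕ.+-suc c j))))))
           (∑⁴-swap₁₂ (λ a d c j → Pterm f d c (suc (c + j)) a))) ⟩
    X +ᶻ X ∎
    where
    open ≡-Reasoning
    X : ℤ
    X = ∑⁴ λ a d b e → Pterm f a b (suc (b + e)) d

  -- The boundary pieces b = x < a and a = b = x of `Γ`, and its interior a, b > x. By symmetry the
  -- first occurs twice in `Γ`.
  Y₄ Y₅ Γ° : ℤ
  Y₄ = ∑³ λ w x i → g x w (suc i) 0
  Y₅ = ∑² λ w x → g x w 0 0
  Γ° = ∑⁴ λ w x i j → g x w (suc i) (suc j)

  Γ-split : Γ ≡ (Y₅ +ᶻ Y₄) +ᶻ (Y₄ +ᶻ Γ°)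
  Γ-split = trans (∑-≡+ {g = λ w → ∑ λ x → g x w 0 0 +ᶻ ∑ λ i → g x w (suc i) 0}
                         {h = λ w → ∑ λ x → ∑ (λ i → g x w (suc i) 0) +ᶻ ∑² λ i j → g x w (suc i) (suc j)}
                   λ w → ∑-≡+ λ x → inner x w)
    (cong₂ _+ᶻ_ (∑-≡+ λ w → ∑-+ (λ x → g x w 0 0) (λ x → ∑ λ i → g x w (suc i) 0))
                (∑-≡+ λ w → ∑-+ (λ x → ∑ λ i → g x w (suc i) 0) (λ x → ∑² λ i j → g x w (suc i) (suc j))))
    where
    g-supp-j : ∀ x w i → Supp (g x w i)
    g-supp-j x w i j l = trans (g-swap x w i j) (g-supp-i x w i j l)
    inner : ∀ x w → ∑² (g x w) ≡ (g x w 0 0 +ᶻ ∑ (λ i → g x w (suc i) 0)) +ᶻ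
      (∑ (λ i → g x w (suc i) 0) +ᶻ ∑² (λ i j → g x w (suc i) (suc j)))
    inner x w = trans (∑-split₀ (λ i → ∑ (g x w i)) λ i l → sumTo-zero B λ j → g-supp-i x w j i l)
      (cong₂ _+ᶻ_
        (trans (∑-split₀ (g x w 0) (g-supp-j x w 0)) (cong (g x w 0 0 +ᶻ_) (∑-cong λ j → g-swap x w 0 (suc j))))
        (∑-≡+ λ i → ∑-split₀ (g x w (suc i)) (g-supp-j x w (suc i))))

  opaque
    unfolding g u

    -- With the path (i, j, w, i + x), ij + w (x + i + j) = ij + jw + w (i + x), and x is the
    -- difference of the ends.
    g≡Pterm : ∀ w x i j → g x w (suc i) (suc j) ≡ Pterm (at t₁) i j w (suc (i + x))
    g≡Pterm w x i j = trans (weighted-G (χ (suc w + suc i)) (χ (suc w + suc j)) (χ (suc x)) n (suc x))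
      (cong₂ (λ n r → Δ⟨ n ⟩ r) (e w x i j)
        (cong₂ _*ᶻ_
          (cong₂ _*ᶻ_ (cong ⟦_⟧ (trans (odd-+ (suc w) (suc i)) (xor-comm (odd (suc w)) (odd (suc i)))))
                      (cong ⟦_⟧ (trans (odd-+ (suc w) (suc j)) (xor-comm (odd (suc w)) (odd (suc j))))))
          (cong₂ _*ᶻ_ (cong ⟦_⟧ (sym (trans (cong (λ t → odd (suc i) xor odd (suc t)) (sym (ℕ.+-suc i x)))
                                       (trans (cong (odd (suc i) xor_) (odd-+ (suc i) (suc x))) (xor-cancel (odd (suc i)) (odd (suc x)))))))
            (cong₂ F (trans (cong pos (e w x i j)) (pos-path (suc i) (suc j) (suc w) (suc (suc (i + x)))))
              (sym (trans (cong (λ t → pos (suc t) -ᶻ pos (suc i)) (sym (ℕ.+-suc i x))) (lem (pos (suc i)) (pos (suc x)))))))))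
      where
      n : ℕ
      n = suc i * suc j + suc w * (suc x + suc i + suc j)
      e : ∀ w x i j → suc i * suc j + suc w * (suc x + suc i + suc j) ≡ suc i * suc j + suc j * suc w + suc w * suc (suc (i + x))
      e = ℕ-solve-∀
      lem : ∀ a b → a +ᶻ b -ᶻ a ≡ b
      lem = ℤ-solve-∀

    -- The path is (t, y, y + p, q) for w = p + q + y + t: then pq + yw = ty + y (y + p) + (y + p)
    -- q.
    v≡Pterm : ∀ a d b e → v e d b (suc (suc (suc (e + d + b + a)))) ≡ Pterm (at t₂) a b (suc (b + e)) d
    v≡Pterm a d b e = trans (weighted-G (χ (suc e)) (χ (suc d)) (χ x) n x)
      (cong₂ (λ n r → Δ⟨ n ⟩ r) (e₁ a d b e)
        (cong₂ _*ᶻ_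
          (cong (_*ᶻ χ (suc d)) (cong ⟦_⟧ (sym (trans (cong (λ t → odd (suc b) xor odd (suc t)) (sym (ℕ.+-suc b e)))
                                       (trans (cong (odd (suc b) xor_) (odd-+ (suc b) (suc e))) (xor-cancel (odd (suc b)) (odd (suc e))))))))
          (cong₂ _*ᶻ_
            (cong ⟦_⟧ (trans (cong odd (e₂ a d b e)) (trans (odd-+ (suc a + suc b) (suc (suc (b + e)) + suc d))
              (cong₂ _xor_ (odd-+ (suc a) (suc b)) (odd-+ (suc (suc (b + e))) (suc d))))))
            (cong₂ F (trans (cong pos (e₁ a d b e)) (pos-path (suc a) (suc b) (suc (suc (b + e))) (suc d)))
                     (cong pos (e₂ a d b e))))))
      where
      n x : ℕ
      n = suc e * suc d + suc b * suc (suc (suc (suc (e + d + b + a))))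
      x = suc b + suc (suc (suc (suc (e + d + b + a))))
      e₁ : ∀ a d b e → suc e * suc d + suc b * suc (suc (suc (suc (e + d + b + a)))) ≡
        suc a * suc b + suc b * suc (suc (b + e)) + suc (suc (b + e)) * suc d
      e₁ = ℕ-solve-∀
      e₂ : ∀ a d b e → suc b + suc (suc (suc (suc (e + d + b + a)))) ≡ suc a + suc b + (suc (suc (b + e)) + suc d)
      e₂ = ℕ-solve-∀

  Γ°+Γ° : Γ° +ᶻ Γ° ≡ Psum (at t₁)
  Γ°+Γ° = trans (cong (λ t → t +ᶻ t) (begin
      ∑⁴ (λ w x i j → g x w (suc i) (suc j)) ≡⟨ (∑⁴-cong λ w x i j → g≡Pterm w x i j) ⟩
      ∑⁴ (λ w x i j → T i j w x)  ≡⟨ ∑⁴-swap₃₄ (λ w x i j → T i j w x) ⟩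
      ∑⁴ (λ w x j i → T i j w x)  ≡⟨ ∑⁴-swap₂₃ (λ w x j i → T i j w x) ⟩
      ∑⁴ (λ w j x i → T i j w x)  ≡⟨ ∑⁴-swap₁₂ (λ w j x i → T i j w x) ⟩
      ∑⁴ (λ j w x i → T i j w x)  ≡⟨ ∑⁴-swap₃₄ (λ j w x i → T i j w x) ⟩
      ∑⁴ (λ j w i x → T i j w x) ∎))
    (sym (half-ends (at t₁) (λ a b c d → t₁-reversal (odd a) (odd b) (odd c) (odd d) (pos a) (pos b) (pos c) (pos d))
      λ a b c → t₁-ends (odd a) (odd b) (odd c) (pos a) (pos b) (pos c)))
    where
    open ≡-Reasoning
    T : ℕ → ℕ → ℕ → ℕ → ℤ
    T i j w x = Pterm (at t₁) i j w (suc (i + x))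

  D₄+D₄ : D₄ +ᶻ D₄ ≡ Psum (at t₂)
  D₄+D₄ = trans (cong (λ t → t +ᶻ t) (begin
      ∑⁴ (λ y t p q → v p q y (suc (suc (suc (p + q + y + t))))) ≡⟨ (∑⁴-cong λ b a e d → v≡Pterm a d b e) ⟩
      ∑⁴ (λ b a e d → T a b e d)  ≡⟨ ∑⁴-swap₁₂ (λ b a e d → T a b e d) ⟩
      ∑⁴ (λ a b e d → T a b e d)  ≡⟨ ∑⁴-swap₃₄ (λ a b e d → T a b e d) ⟩
      ∑⁴ (λ a b d e → T a b e d)  ≡⟨ ∑⁴-swap₂₃ (λ a b d e → T a b e d) ⟩
      ∑⁴ (λ a d b e → T a b e d) ∎))
    (sym (half-middle (at t₂) (λ a b c d → t₂-reversal (odd a) (odd b) (odd c) (odd d) (pos a) (pos b) (pos c) (pos d))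
      λ a b d → t₂-middle (odd a) (odd b) (odd d) (pos a) (pos b) (pos d)))
    where
    open ≡-Reasoning
    T : ℕ → ℕ → ℕ → ℕ → ℤ
    T a b e d = Pterm (at t₂) a b (suc (b + e)) d

  ∑⁴-neg : ∀ f → ∑⁴ (λ a b c d → -ᶻ f a b c d) ≡ -ᶻ ∑⁴ f
  ∑⁴-neg f = trans (∑³-cong λ a b c → sumTo-neg B (f a b c)) (trans (∑²-cong λ a b → sumTo-neg B (λ c → ∑ (f a b c)))
    (trans (∑-cong λ a → sumTo-neg B (λ b → ∑² (f a b))) (sumTo-neg B (λ a → ∑³ (f a)))))

  Psum-cong : ∀ {f f′} → (∀ a b c d → f a b c d ≡ f′ a b c d) → Psum f ≡ Psum f′
  Psum-cong e = ∑⁴-cong λ a b c d → cong (Δ⟨ _ ⟩_) (e (suc a) (suc b) (suc c) (suc d))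

  Usum-+ : ∀ f f′ → Usum (λ p q y w → f p q y w +ᶻ f′ p q y w) ≡ Usum f +ᶻ Usum f′
  Usum-+ f f′ = trans (∑⁴-cong λ p q y w → Δ-+ _ _ _) (∑⁴-+ (Uterm f) (Uterm f′))

  Psum-+ : ∀ f f′ → Psum (λ a b c d → f a b c d +ᶻ f′ a b c d) ≡ Psum f +ᶻ Psum f′
  Psum-+ f f′ = trans (∑⁴-cong λ a b c d → Δ-+ _ _ _) (∑⁴-+ (Pterm f) (Pterm f′))

  Usum-neg : ∀ f → Usum (λ p q y w → -ᶻ f p q y w) ≡ -ᶻ Usum f
  Usum-neg f = trans (∑⁴-cong λ p q y w → Δ-neg _ _) (∑⁴-neg (Uterm f))

  Psum-neg : ∀ f → Psum (λ a b c d → -ᶻ f a b c d) ≡ -ᶻ Psum f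
  Psum-neg f = trans (∑⁴-cong λ a b c d → Δ-neg _ _) (∑⁴-neg (Pterm f))

  Usum-swapˡ : ∀ f → Usum f ≡ Usum (λ p q y w → f q p y w)
  Usum-swapˡ f = trans (∑⁴-swap₁₂ (Uterm f)) (∑⁴-cong λ q p y w →
    cong (λ n → Δ⟨ n + suc y * suc w ⟩ f (suc p) (suc q) (suc y) (suc w)) (ℕ.*-comm (suc p) (suc q)))

  Usum-swapʳ : ∀ f → Usum f ≡ Usum (λ p q y w → f p q w y)
  Usum-swapʳ f = trans (∑⁴-swap₃₄ (Uterm f)) (∑⁴-cong λ p q w y →
    cong (λ n → Δ⟨ suc p * suc q + n ⟩ f (suc p) (suc q) (suc y) (suc w)) (ℕ.*-comm (suc y) (suc w)))

  Usum-antisym : ∀ f f′ → Usum f ≡ Usum f′ → Usum (λ p q y w → f p q y w +ᶻ -ᶻ f′ p q y w) ≡ 0ℤ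
  Usum-antisym f f′ e = trans (Usum-+ f (λ p q y w → -ᶻ f′ p q y w))
    (trans (cong₂ _+ᶻ_ e (Usum-neg f′)) (ℤ.+-inverseʳ (Usum f′)))

  Usum-h : Usum (at h) ≡ 0ℤ
  Usum-h = trans (Usum-+ (λ p q y w → a p q y w +ᶻ -ᶻ a q p y w) (λ p q y w → b p q y w +ᶻ -ᶻ b p q w y))
    (cong₂ _+ᶻ_ (Usum-antisym a (λ p q y w → a q p y w) (Usum-swapˡ a))
                (Usum-antisym b (λ p q y w → b p q w y) (Usum-swapʳ b)))
    where
    a b : ℕ → ℕ → ℕ → ℕ → ℤ
    a p q y w = at h₁ p q y w +ᶻ at h₂ p q y w
    b p q y w = at h₃ p q y w +ᶻ at h₄ p q y w

  Psum-total : Psum (at total) ≡ 0ℤ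
  Psum-total = double-zero (Psum (at total)) (trans (cong (Psum (at total) +ᶻ_) (Psum-reverse (at total)))
    (trans (sym (Psum-+ (at total) (λ a b c d → at total d c b a)))
      (sumTo-zero B λ a → sumTo-zero B λ b → sumTo-zero B λ c → sumTo-zero B λ d → trans
        (cong (Δ⟨ pathℕ (suc a) (suc b) (suc c) (suc d) ⟩_) (total-reversal (odd (suc a)) (odd (suc b)) (odd (suc c)) (odd (suc d)) (pos (suc a)) (pos (suc b)) (pos (suc c)) (pos (suc d))))
        (Δ-zero _))))

  at-up : ∀ f a b c d → at f b (c + a) d c ≡ at (up f) a b c d
  at-up f a b c d = cong (λ t → f (odd b) t (odd d) (odd c) (pos b) (pos (c + a)) (pos d) (pos c)) (odd-+ c a)

  at-down : ∀ f a b c d → at f a b c (b + d) ≡ at (down f) a b c d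
  at-down f a b c d = cong (λ t → f (odd a) (odd b) (odd c) t (pos a) (pos b) (pos c) (pos (b + d))) (odd-+ b d)

  tie : Weight → ℕ → ℕ → ℕ → ℤ
  tie f p q y = at f p q y q

  leSum≡ : ∀ f → leSum (at f) ≡ Tsum (tie f) +ᶻ Psum (at (up f))
  leSum≡ f = trans (leSum-path (at f)) (cong (Tsum (tie f) +ᶻ_) (Psum-cong (at-up f)))

  gtSum≡ : ∀ f → gtSum (at f) ≡ Psum (at (down f))
  gtSum≡ f = trans (gtSum-path (at f)) (Psum-cong (at-down f))

  Psum-total-split : Psum (at total) ≡
    Psum (at t₁) +ᶻ -ᶻ Psum (at t₂) +ᶻ Psum (at (up hD)) +ᶻ -ᶻ Psum (at (down hD)) +ᶻ
    -ᶻ (Psum (at (up h)) +ᶻ Psum (at (down h)))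
  Psum-total-split = trans (Psum-+ a₄ (λ a b c d → -ᶻ a₅ a b c d)) (cong₂ _+ᶻ_
    (trans (Psum-+ a₃ (λ a b c d → -ᶻ at (down hD) a b c d)) (cong₂ _+ᶻ_
      (trans (Psum-+ a₂ (at (up hD))) (cong (_+ᶻ Psum (at (up hD)))
        (trans (Psum-+ (at t₁) (λ a b c d → -ᶻ at t₂ a b c d)) (cong (Psum (at t₁) +ᶻ_) (Psum-neg (at t₂))))))
      (Psum-neg (at (down hD)))))
    (trans (Psum-neg a₅) (cong -ᶻ_ (Psum-+ (at (up h)) (at (down h))))))
    where
    a₂ a₃ a₄ a₅ : ℕ → ℕ → ℕ → ℕ → ℤ
    a₂ a b c d = at t₁ a b c d +ᶻ -ᶻ at t₂ a b c d
    a₃ a b c d = a₂ a b c d +ᶻ at (up hD) a b c d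
    a₄ a b c d = a₃ a b c d +ᶻ -ᶻ at (down hD) a b c d
    a₅ a b c d = at (up h) a b c d +ᶻ at (down h) a b c d

  -- The vanishing sum of h consists of a tie part and two path parts. Subtracting it completes the
  -- path sums to that of `total`, which is zero, so only ties and boundary pieces of `Γ` survive.
  S-boundary : S +ᶻ S ≡ (-ᶻ Tsum (tie h) +ᶻ Tsum (tie hD) +ᶻ pos 4 *ᶻ Y₄) +ᶻ (Y₅ +ᶻ Y₅)
  S-boundary = begin
    S +ᶻ S
      ≡⟨ S-formula ⟩
    (Γ +ᶻ Γ) +ᶻ (le -ᶻ (τ +ᶻ gg)) -ᶻ (D₄ +ᶻ D₄)
      ≡⟨ cong₂ (λ a b → (a +ᶻ a) +ᶻ b -ᶻ (D₄ +ᶻ D₄)) Γ-split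
           (cong₂ _-ᶻ_ (trans le≡ (leSum≡ hD)) (trans gt≡ (gtSum≡ hD))) ⟩
    (((Y₅ +ᶻ Y₄) +ᶻ (Y₄ +ᶻ Γ°)) +ᶻ ((Y₅ +ᶻ Y₄) +ᶻ (Y₄ +ᶻ Γ°))) +ᶻ
      ((Tsum (tie hD) +ᶻ Psum (at (up hD))) -ᶻ Psum (at (down hD))) -ᶻ (D₄ +ᶻ D₄)
      ≡⟨ lem₁ Y₄ Y₅ Γ° (Tsum (tie hD)) (Psum (at (up hD))) (Psum (at (down hD))) (D₄ +ᶻ D₄) ⟩
    (Tsum (tie hD) +ᶻ pos 4 *ᶻ Y₄ +ᶻ (Y₅ +ᶻ Y₅)) +ᶻ
      ((Γ° +ᶻ Γ°) +ᶻ -ᶻ (D₄ +ᶻ D₄) +ᶻ Psum (at (up hD)) +ᶻ -ᶻ Psum (at (down hD)))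
      ≡⟨ cong₂ (λ a b → (Tsum (tie hD) +ᶻ pos 4 *ᶻ Y₄ +ᶻ (Y₅ +ᶻ Y₅)) +ᶻ (a +ᶻ -ᶻ b +ᶻ Psum (at (up hD)) +ᶻ -ᶻ Psum (at (down hD)))) Γ°+Γ° D₄+D₄ ⟩
    (Tsum (tie hD) +ᶻ pos 4 *ᶻ Y₄ +ᶻ (Y₅ +ᶻ Y₅)) +ᶻ
      (Psum (at t₁) +ᶻ -ᶻ Psum (at t₂) +ᶻ Psum (at (up hD)) +ᶻ -ᶻ Psum (at (down hD)))
      ≡⟨ lem₂ (Tsum (tie hD)) (pos 4 *ᶻ Y₄) (Y₅ +ᶻ Y₅) (Psum (at t₁) +ᶻ -ᶻ Psum (at t₂) +ᶻ Psum (at (up hD)) +ᶻ -ᶻ Psum (at (down hD)))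
           (Psum (at (up h))) (Psum (at (down h))) (Tsum (tie h)) ⟩
    ((-ᶻ Tsum (tie h) +ᶻ Tsum (tie hD) +ᶻ pos 4 *ᶻ Y₄) +ᶻ (Y₅ +ᶻ Y₅)) +ᶻ
      ((Psum (at t₁) +ᶻ -ᶻ Psum (at t₂) +ᶻ Psum (at (up hD)) +ᶻ -ᶻ Psum (at (down hD)) +ᶻ -ᶻ (Psum (at (up h)) +ᶻ Psum (at (down h)))) +ᶻ
       (Tsum (tie h) +ᶻ Psum (at (up h)) +ᶻ Psum (at (down h))))
      ≡⟨ cong₂ (λ a b → ((-ᶻ Tsum (tie h) +ᶻ Tsum (tie hD) +ᶻ pos 4 *ᶻ Y₄) +ᶻ (Y₅ +ᶻ Y₅)) +ᶻ (a +ᶻ b))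
           (trans (sym Psum-total-split) Psum-total)
           (trans (sym (trans (Usum-split (at h)) (cong₂ _+ᶻ_ (leSum≡ h) (gtSum≡ h)))) Usum-h) ⟩
    ((-ᶻ Tsum (tie h) +ᶻ Tsum (tie hD) +ᶻ pos 4 *ᶻ Y₄) +ᶻ (Y₅ +ᶻ Y₅)) +ᶻ 0ℤ
      ≡⟨ ℤ.+-identityʳ _ ⟩
    (-ᶻ Tsum (tie h) +ᶻ Tsum (tie hD) +ᶻ pos 4 *ᶻ Y₄) +ᶻ (Y₅ +ᶻ Y₅) ∎
    where
    open ≡-Reasoning
    lem₁ : ∀ y₄ y₅ γ t a b d → (((y₅ +ᶻ y₄) +ᶻ (y₄ +ᶻ γ)) +ᶻ ((y₅ +ᶻ y₄) +ᶻ (y₄ +ᶻ γ))) +ᶻ ((t +ᶻ a) -ᶻ b) -ᶻ d ≡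
      (t +ᶻ pos 4 *ᶻ y₄ +ᶻ (y₅ +ᶻ y₅)) +ᶻ ((γ +ᶻ γ) +ᶻ -ᶻ d +ᶻ a +ᶻ -ᶻ b)
    lem₁ = ℤ-solve-∀
    lem₂ : ∀ t y₄ y₅ a b c t′ → (t +ᶻ y₄ +ᶻ y₅) +ᶻ a ≡
      ((-ᶻ t′ +ᶻ t +ᶻ y₄) +ᶻ y₅) +ᶻ ((a +ᶻ -ᶻ (b +ᶻ c)) +ᶻ (t′ +ᶻ b +ᶻ c))
    lem₂ = ℤ-solve-∀

  Tsum-cong : ∀ {f f′} → (∀ p q y → f p q y ≡ f′ p q y) → Tsum f ≡ Tsum f′
  Tsum-cong e = ∑³-cong λ p q y → cong (Δ⟨ _ ⟩_) (e (suc p) (suc q) (suc y))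

  Tsum-+ : ∀ f f′ → Tsum (λ p q y → f p q y +ᶻ f′ p q y) ≡ Tsum f +ᶻ Tsum f′
  Tsum-+ f f′ = trans (∑³-cong λ p q y → Δ-+ _ _ _) (∑³-+ (Tterm f) (Tterm f′))

  Tsum-neg : ∀ f → Tsum (λ p q y → -ᶻ f p q y) ≡ -ᶻ Tsum f
  Tsum-neg f = trans (∑³-cong λ p q y → Δ-neg _ _) (trans (∑²-cong λ p q → sumTo-neg B (Tterm f p q))
    (trans (∑-cong λ p → sumTo-neg B (λ q → ∑ (Tterm f p q))) (sumTo-neg B (λ p → ∑² (Tterm f p)))))

  Tsum-*ˡ : ∀ c f → Tsum (λ p q y → c *ᶻ f p q y) ≡ c *ᶻ Tsum f
  Tsum-*ˡ c f = trans (∑³-cong λ p q y → Δ-* (suc q * (suc p + suc y)) c (f (suc p) (suc q) (suc y))) (trans (∑²-cong λ p q → sumTo-*ˡ B c (Tterm f p q))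
    (trans (∑-cong λ p → sumTo-*ˡ B c (λ q → ∑ (Tterm f p q))) (sumTo-*ˡ B c (λ p → ∑² (Tterm f p)))))

  Tsum-swap : ∀ f → Tsum f ≡ Tsum (λ p q y → f y q p)
  Tsum-swap f = begin
    ∑³ (λ p q y → Tterm f p q y)  ≡⟨ ∑³-swap₁₂ (λ p q y → Tterm f p q y) ⟩
    ∑³ (λ q p y → Tterm f p q y)  ≡⟨ ∑³-swap₂₃ (λ q p y → Tterm f p q y) ⟩
    ∑³ (λ q y p → Tterm f p q y)  ≡⟨ ∑³-swap₁₂ (λ q y p → Tterm f p q y) ⟩
    ∑³ (λ y q p → Tterm f p q y)  ≡⟨ (∑³-cong λ p q y → cong (λ n → Δ⟨ suc q * n ⟩ f (suc y) (suc q) (suc p)) (ℕ.+-comm (suc y) (suc p))) ⟩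
    Tsum (λ p q y → f y q p) ∎
    where open ≡-Reasoning

  at₃ : (Bool → Bool → Bool → ℤ → ℤ → ℤ → ℤ) → ℕ → ℕ → ℕ → ℤ
  at₃ f p q y = f (odd p) (odd q) (odd y) (pos p) (pos q) (pos y)

  y₄ : Bool → Bool → Bool → ℤ → ℤ → ℤ → ℤ
  y₄ P Q Y p q y = ⟦ Q xor P ⟧ *ᶻ ⟦ Q ⟧ *ᶻ (⟦ Y ⟧ *ᶻ F (q *ᶻ (p +ᶻ y)) y)

  opaque
    unfolding g u

    g≡Tterm : ∀ w x i → g x w (suc i) 0 ≡ Tterm (at₃ y₄) i w x
    g≡Tterm w x i = trans (weighted-G (χ (suc w + suc i)) (χ (suc w + 0)) (χ (suc x)) (suc i * 0 + suc w * (suc x + suc i + 0)) (suc x))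
      (cong₂ (λ n r → Δ⟨ n ⟩ r) (e w x i)
        (cong₂ _*ᶻ_ (cong₂ (λ a b → ⟦ a ⟧ *ᶻ ⟦ b ⟧) (odd-+ (suc w) (suc i)) (cong odd (ℕ.+-identityʳ (suc w))))
          (cong (λ t → χ (suc x) *ᶻ F t (pos (suc x))) (trans (cong pos (e w x i)) (ℤ.pos-* (suc w) (suc i + suc x))))))
      where
      e : ∀ w x i → suc i * 0 + suc w * (suc x + suc i + 0) ≡ suc w * (suc i + suc x)
      e = ℕ-solve-∀

    g≡Δ : ∀ w x → g x w 0 0 ≡ Δ⟨ suc w * suc x ⟩ (χ (suc w) *ᶻ χ (suc x) *ᶻ F (pos (suc w) *ᶻ pos (suc x)) (pos (suc x)))
    g≡Δ w x = trans (weighted-G (χ (suc w + 0)) (χ (suc w + 0)) (χ (suc x)) (suc w * (suc x + 0 + 0)) (suc x))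
      (cong₂ (λ n r → Δ⟨ n ⟩ r) (e w x)
        (trans (cong₂ (λ a b → ⟦ a ⟧ *ᶻ ⟦ a ⟧ *ᶻ (χ (suc x) *ᶻ F b (pos (suc x)))) (cong odd (ℕ.+-identityʳ (suc w)))
                 (trans (cong pos (e w x)) (ℤ.pos-* (suc w) (suc x))))
          (lem (odd (suc w)) (χ (suc x)) (F (pos (suc w) *ᶻ pos (suc x)) (pos (suc x))))))
      where
      e : ∀ w x → suc w * (suc x + 0 + 0) ≡ suc w * suc x
      e = ℕ-solve-∀
      lem : ∀ b c f → ⟦ b ⟧ *ᶻ ⟦ b ⟧ *ᶻ (c *ᶻ f) ≡ ⟦ b ⟧ *ᶻ c *ᶻ f
      lem true  c f = trans (ℤ.*-identityˡ (c *ᶻ f)) (cong (_*ᶻ f) (sym (ℤ.*-identityˡ c)))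
      lem false c f = refl

  Y₄≡ : Y₄ ≡ Tsum (at₃ y₄)
  Y₄≡ = begin
    ∑³ (λ w x i → g x w (suc i) 0)  ≡⟨ (∑³-cong λ w x i → g≡Tterm w x i) ⟩
    ∑³ (λ w x i → Tterm (at₃ y₄) i w x)  ≡⟨ ∑³-swap₂₃ (λ w x i → Tterm (at₃ y₄) i w x) ⟩
    ∑³ (λ w i x → Tterm (at₃ y₄) i w x)  ≡⟨ ∑³-swap₁₂ (λ w i x → Tterm (at₃ y₄) i w x) ⟩
    ∑³ (λ i w x → Tterm (at₃ y₄) i w x) ∎
    where open ≡-Reasoning

  boundary-sum : -ᶻ Tsum (tie h) +ᶻ Tsum (tie hD) +ᶻ pos 4 *ᶻ Y₄ ≡ Tsum (at₃ boundary′)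
  boundary-sum = begin
    -ᶻ Tsum (tie h) +ᶻ Tsum (tie hD) +ᶻ pos 4 *ᶻ Y₄
      -- Exchanging p and y in the second sum makes the cancellation hold term by term.
      ≡⟨ cong₂ _+ᶻ_ (cong₂ _+ᶻ_ (sym (Tsum-neg (tie h))) (Tsum-swap (tie hD)))
                    (trans (cong (pos 4 *ᶻ_) Y₄≡) (sym (Tsum-*ˡ (pos 4) (at₃ y₄)))) ⟩
    Tsum (λ p q y → -ᶻ tie h p q y) +ᶻ Tsum (λ p q y → tie hD y q p) +ᶻ Tsum (λ p q y → pos 4 *ᶻ at₃ y₄ p q y)
      ≡⟨ sym (trans (Tsum-+ (λ p q y → -ᶻ tie h p q y +ᶻ tie hD y q p) (λ p q y → pos 4 *ᶻ at₃ y₄ p q y))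
           (cong (_+ᶻ Tsum (λ p q y → pos 4 *ᶻ at₃ y₄ p q y)) (Tsum-+ (λ p q y → -ᶻ tie h p q y) (λ p q y → tie hD y q p)))) ⟩
    Tsum (at₃ boundary)
      ≡⟨ (Tsum-cong λ p q y → boundary≡ (odd p) (odd q) (odd y) (pos p) (pos q) (pos y)) ⟩
    Tsum (at₃ boundary′) ∎
    where open ≡-Reasoning

  opaque
    unfolding Δ⟨_⟩_

    Δ-sumTo : ∀ k n f → sumTo k (λ p → Δ⟨ n ⟩ f p) ≡ Δ⟨ n ⟩ sumTo k f
    Δ-sumTo k n f = sumTo-*ˡ k (Δ n) f

  -- Put m = p + y, which is odd for even p and odd y. Then p² - (q - y)² = (m - q)(2p + q - m) is
  -- linear in p, and the sum over even p < m is elementary.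
  boundary-eval : Tsum (at₃ boundary′) ≡ ∑² λ q m → Δ⟨ suc q * suc m ⟩
    (χ (suc q) *ᶻ χ (suc m) *ᶻ ((pos (suc m) -ᶻ pos (suc q)) *ᶻ (pos m *ᶻ (pos (suc q) +ᶻ 1ℤ))))
  boundary-eval = begin
    ∑³ (λ p q y → Tterm (at₃ boundary′) p q y)
      ≡⟨ ∑³-swap₁₂ (λ p q y → Tterm (at₃ boundary′) p q y) ⟩
    ∑³ (λ q p y → Tterm (at₃ boundary′) p q y)
      ≡⟨ (∑³-cong λ q p y → match q p y) ⟩
    ∑³ (λ q p y → f q p (suc (p + y)))
      ≡⟨ (∑-cong λ q → sym (∑-below-diag (f q) λ p m l → Δ-vanish _ _
            (ℕ.≤-trans l (ℕ.≤-trans (ℕ.n≤1+n m) (ℕ.m≤n*m (suc m) (suc q)))))) ⟩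
    ∑² (λ q m → sumTo m λ p → f q p m)
      ≡⟨ (∑²-cong λ q m → trans (Δ-sumTo m (suc q * suc m) (β q m)) (cong (Δ⟨ suc q * suc m ⟩_) (eval q m))) ⟩
    ∑² (λ q m → Δ⟨ suc q * suc m ⟩
      (χ (suc q) *ᶻ χ (suc m) *ᶻ ((pos (suc m) -ᶻ pos (suc q)) *ᶻ (pos m *ᶻ (pos (suc q) +ᶻ 1ℤ))))) ∎
    where
    open ≡-Reasoning
    K : ℕ → ℕ → ℤ
    K q m = pos 2 *ᶻ (χ (suc q) *ᶻ (χ (suc m) *ᶻ (pos (suc m) -ᶻ pos (suc q))))
    β : ℕ → ℕ → ℕ → ℤ
    β q m p = K q m *ᶻ (⟦ not (odd (suc p)) ⟧ *ᶻ (pos 2 *ᶻ pos (suc p) +ᶻ (pos (suc q) -ᶻ pos (suc m))))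
    f : ℕ → ℕ → ℕ → ℤ
    f q p m = Δ⟨ suc q * suc m ⟩ β q m p
    lem₁ : ∀ c P Y p q y → pos 2 *ᶻ (c *ᶻ (P *ᶻ Y *ᶻ (p *ᶻ p +ᶻ -ᶻ ((q +ᶻ -ᶻ y) *ᶻ (q +ᶻ -ᶻ y))))) ≡
      pos 2 *ᶻ c *ᶻ ((p +ᶻ y) -ᶻ q) *ᶻ (P *ᶻ Y) *ᶻ (pos 2 *ᶻ p +ᶻ (q -ᶻ (p +ᶻ y)))
    lem₁ = ℤ-solve-∀
    lem₂ : ∀ c P m k e → pos 2 *ᶻ c *ᶻ m *ᶻ (P *ᶻ k) *ᶻ e ≡ pos 2 *ᶻ (c *ᶻ (k *ᶻ m)) *ᶻ (P *ᶻ e)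
    lem₂ = ℤ-solve-∀
    match : ∀ q p y → Tterm (at₃ boundary′) p q y ≡ f q p (suc (p + y))
    match q p y = trans (cong (Δ⟨ suc q * (suc p + suc y) ⟩_) (begin
        at₃ boundary′ (suc p) (suc q) (suc y)
          ≡⟨ lem₁ (χ (suc q)) ⟦ not (odd (suc p)) ⟧ (χ (suc y)) (pos (suc p)) (pos (suc q)) (pos (suc y)) ⟩
        pos 2 *ᶻ χ (suc q) *ᶻ (pos (suc p + suc y) -ᶻ pos (suc q)) *ᶻ (⟦ not (odd (suc p)) ⟧ *ᶻ χ (suc y)) *ᶻ
          (pos 2 *ᶻ pos (suc p) +ᶻ (pos (suc q) -ᶻ pos (suc p + suc y)))
          ≡⟨ cong (λ t → pos 2 *ᶻ χ (suc q) *ᶻ (pos (suc p + suc y) -ᶻ pos (suc q)) *ᶻ t *ᶻ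
                (pos 2 *ᶻ pos (suc p) +ᶻ (pos (suc q) -ᶻ pos (suc p + suc y))))
               (trans (⟦⟧-not-xor (odd (suc p)) (odd (suc y)))
                      (cong (λ t → ⟦ not (odd (suc p)) ⟧ *ᶻ ⟦ t ⟧) (sym (odd-+ (suc p) (suc y))))) ⟩
        pos 2 *ᶻ χ (suc q) *ᶻ (pos (suc p + suc y) -ᶻ pos (suc q)) *ᶻ (⟦ not (odd (suc p)) ⟧ *ᶻ χ (suc p + suc y)) *ᶻ
          (pos 2 *ᶻ pos (suc p) +ᶻ (pos (suc q) -ᶻ pos (suc p + suc y)))
          ≡⟨ lem₂ (χ (suc q)) ⟦ not (odd (suc p)) ⟧ (pos (suc p + suc y) -ᶻ pos (suc q)) (χ (suc p + suc y))
               (pos 2 *ᶻ pos (suc p) +ᶻ (pos (suc q) -ᶻ pos (suc p + suc y))) ⟩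
        β q (p + suc y) p ∎))
      (cong (f q p) (ℕ.+-suc p y))
    lem₃ : ∀ c n q → pos 2 *ᶻ (c *ᶻ (1ℤ *ᶻ ((1ℤ +ᶻ (n +ᶻ n)) -ᶻ q))) *ᶻ (n *ᶻ (pos 2 *ᶻ (n +ᶻ 1ℤ) +ᶻ (q -ᶻ (1ℤ +ᶻ (n +ᶻ n))))) ≡
      c *ᶻ 1ℤ *ᶻ (((1ℤ +ᶻ (n +ᶻ n)) -ᶻ q) *ᶻ ((n +ᶻ n) *ᶻ (q +ᶻ 1ℤ)))
    lem₃ = ℤ-solve-∀
    lem₄ : ∀ c m s t → pos 2 *ᶻ (c *ᶻ (0ℤ *ᶻ m)) *ᶻ s ≡ c *ᶻ 0ℤ *ᶻ t
    lem₄ = ℤ-solve-∀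
    eval : ∀ q m → sumTo m (β q m) ≡
      χ (suc q) *ᶻ χ (suc m) *ᶻ ((pos (suc m) -ᶻ pos (suc q)) *ᶻ (pos m *ᶻ (pos (suc q) +ᶻ 1ℤ)))
    eval q m = trans (sumTo-*ˡ m (K q m) _) (go m (halve m))
      where
      go : ∀ m → Halved m → K q m *ᶻ sumTo m (λ p → ⟦ not (odd (suc p)) ⟧ *ᶻ (pos 2 *ᶻ pos (suc p) +ᶻ (pos (suc q) -ᶻ pos (suc m)))) ≡
        χ (suc q) *ᶻ χ (suc m) *ᶻ ((pos (suc m) -ᶻ pos (suc q)) *ᶻ (pos m *ᶻ (pos (suc q) +ᶻ 1ℤ)))
      go _ (even n) rewrite sum-even n (pos (suc q) -ᶻ pos (suc (n + n))) | odd-double n = lem₃ (χ (suc q)) (pos n) (pos (suc q))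
      go _ (odd′ n) rewrite odd-double n = lem₄ (χ (suc q)) (pos (suc (suc (n + n))) -ᶻ pos (suc q)) _ _

  -- For qm = M the summand is (m - q)(m - 1)(q + 1) + 2 (qm - m²), up to parity factors. Adding its
  -- value with q and m exchanged gives 2 (m - q)² - 2 (m - q)² = 0.
  boundary-zero : Tsum (at₃ boundary′) +ᶻ (Y₅ +ᶻ Y₅) ≡ 0ℤ
  boundary-zero = trans (cong₂ (λ a b → a +ᶻ (b +ᶻ b)) boundary-eval (∑²-cong g≡Δ))
      (trans (sym (trans (∑²-+ A (λ q m → C q m +ᶻ C q m)) (cong (∑² A +ᶻ_) (∑²-+ C C))))
        (double-zero (∑² T) (trans (cong (∑² T +ᶻ_) (∑-swap T)) (trans (sym (∑²-+ T (λ m q → T q m)))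
          (sumTo-zero B λ q → sumTo-zero B λ m → antisym q m)))))
    where
    a c : ℕ → ℕ → ℤ
    a q m = χ (suc q) *ᶻ χ (suc m) *ᶻ ((pos (suc m) -ᶻ pos (suc q)) *ᶻ (pos m *ᶻ (pos (suc q) +ᶻ 1ℤ)))
    c q m = χ (suc q) *ᶻ χ (suc m) *ᶻ F (pos (suc q) *ᶻ pos (suc m)) (pos (suc m))
    A C T : ℕ → ℕ → ℤ
    A q m = Δ⟨ suc q * suc m ⟩ a q m
    C q m = Δ⟨ suc q * suc m ⟩ c q m
    T q m = A q m +ᶻ (C q m +ᶻ C q m)
    lem : ∀ x y q m →
      (x *ᶻ y *ᶻ (((1ℤ +ᶻ m) -ᶻ (1ℤ +ᶻ q)) *ᶻ (m *ᶻ ((1ℤ +ᶻ q) +ᶻ 1ℤ))) +ᶻ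
        (x *ᶻ y *ᶻ ((1ℤ +ᶻ q) *ᶻ (1ℤ +ᶻ m) +ᶻ -ᶻ ((1ℤ +ᶻ m) *ᶻ (1ℤ +ᶻ m))) +ᶻ x *ᶻ y *ᶻ ((1ℤ +ᶻ q) *ᶻ (1ℤ +ᶻ m) +ᶻ -ᶻ ((1ℤ +ᶻ m) *ᶻ (1ℤ +ᶻ m))))) +ᶻ
      (y *ᶻ x *ᶻ (((1ℤ +ᶻ q) -ᶻ (1ℤ +ᶻ m)) *ᶻ (q *ᶻ ((1ℤ +ᶻ m) +ᶻ 1ℤ))) +ᶻ
        (y *ᶻ x *ᶻ ((1ℤ +ᶻ m) *ᶻ (1ℤ +ᶻ q) +ᶻ -ᶻ ((1ℤ +ᶻ q) *ᶻ (1ℤ +ᶻ q))) +ᶻ y *ᶻ x *ᶻ ((1ℤ +ᶻ m) *ᶻ (1ℤ +ᶻ q) +ᶻ -ᶻ ((1ℤ +ᶻ q) *ᶻ (1ℤ +ᶻ q))))) ≡ 0ℤ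
    lem = ℤ-solve-∀
    collect : ∀ n i j → Δ⟨ n ⟩ i +ᶻ (Δ⟨ n ⟩ j +ᶻ Δ⟨ n ⟩ j) ≡ Δ⟨ n ⟩ (i +ᶻ (j +ᶻ j))
    collect n i j = sym (trans (Δ-+ n i (j +ᶻ j)) (cong (Δ⟨ n ⟩ i +ᶻ_) (Δ-+ n j j)))
    antisym : ∀ q m → T q m +ᶻ T m q ≡ 0ℤ
    antisym q m = trans (cong₂ _+ᶻ_ (collect (suc q * suc m) (a q m) (c q m))
        (trans (collect (suc m * suc q) (a m q) (c m q)) (cong (Δ⟨_⟩ (a m q +ᶻ (c m q +ᶻ c m q))) (ℕ.*-comm (suc m) (suc q)))))
      (trans (sym (Δ-+ (suc q * suc m) (a q m +ᶻ (c q m +ᶻ c q m)) (a m q +ᶻ (c m q +ᶻ c m q))))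
        (trans (cong (Δ⟨ suc q * suc m ⟩_) (lem (χ (suc q)) (χ (suc m)) (pos q) (pos m))) (Δ-zero (suc q * suc m))))

  S≡0 : S ≡ 0ℤ
  S≡0 = double-zero S (trans S-boundary (trans (cong (_+ᶻ (Y₅ +ᶻ Y₅)) boundary-sum) boundary-zero))

-- Truncated subtraction does no harm here: for k > m it yields 0, which differs from the positive
-- `suc n`.
δ-∸ : ∀ m k n → δ m (k + suc n) ≡ δ (m ∸ k) (suc n)
δ-∸ m k n with k ≤? m
... | yes k≤m = go (m ∸ k ≟ suc n)
  where
  go : _ → δ m (k + suc n) ≡ δ (m ∸ k) (suc n)
  go (yes e) = trans (cong (λ t → δ t (k + suc n)) (trans (sym (ℕ.m+[n∸m]≡n k≤m)) (cong (k +_) e)))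
    (trans (δ-refl (k + suc n)) (sym (trans (cong (λ t → δ t (suc n)) e) (δ-refl (suc n)))))
  go (no ne) = trans (δ-≢ {m} λ e → ne (trans (cong (_∸ k) e) (ℕ.m+n∸m≡n k (suc n)))) (sym (δ-≢ {m ∸ k} ne))
... | no k≰m = trans (δ-≢ {m} λ e → k≰m (subst (k ≤_) (sym e) (ℕ.m≤m+n k (suc n))))
    (sym (δ-≢ {m ∸ k} λ e → 0≢suc (trans (sym (ℕ.m≤n⇒m∸n≡0 (ℕ.<⇒≤ (ℕ.≰⇒> k≰m)))) e)))
  where
  0≢suc : 0 ≢ suc n
  0≢suc ()

sumTo-witness : ∀ k f → sumTo k f ≢ 0ℤ → ∃ λ n → f n ≢ 0ℤ
sumTo-witness zero    f ne = ⊥-elim (ne refl)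
sumTo-witness (suc k) f ne with f 0 ℤ.≟ 0ℤ
... | no f0   = 0 , f0
... | yes f0 with sumTo-witness k (f ∘ suc) (λ e → ne (cong₂ _+ᶻ_ f0 e))
...   | n , fn = suc n , fn

sumTo-nonneg : ∀ k f → (∀ n → 0ℤ ℤ.≤ f n) → 0ℤ ℤ.≤ sumTo k f
sumTo-nonneg zero    f p = ℤ.≤-refl
sumTo-nonneg (suc k) f p = ℤ.+-mono-≤ (p 0) (sumTo-nonneg k (f ∘ suc) (p ∘ suc))

sumTo-term : ∀ k f → (∀ n → 0ℤ ℤ.≤ f n) → ∀ n → n < k → f n ℤ.≤ sumTo k f
sumTo-term (suc k) f p zero    _         = subst (ℤ._≤ f 0 +ᶻ sumTo k (f ∘ suc)) (ℤ.+-identityʳ (f 0))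
  (ℤ.+-monoʳ-≤ (f 0) (sumTo-nonneg k (f ∘ suc) (p ∘ suc)))
sumTo-term (suc k) f p (suc n) (s≤s n<k) = ℤ.≤-trans (sumTo-term k (f ∘ suc) (p ∘ suc) n n<k)
  (subst (ℤ._≤ f 0 +ᶻ sumTo k (f ∘ suc)) (ℤ.+-identityˡ _) (ℤ.+-monoˡ-≤ (sumTo k (f ∘ suc)) (p 0)))

*-≡0 : ∀ c {i} → i ≡ 0ℤ → c *ᶻ i ≡ 0ℤ
*-≡0 c refl = ℤ.*-zeroʳ c

-- Comparing the two counts through the recurrence

tri : ℕ → ℕ
tri zero    = 0
tri (suc n) = suc n + tri n

odd-square : ∀ n → suc (n + n) * suc (n + n) ≡ suc (8 * tri n)
odd-square zero    = refl
odd-square (suc n) = trans (e n) (trans (cong (8 * suc n +_) (odd-square n)) (e′ n (tri n)))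
  where
  e : ∀ n → suc (suc n + suc n) * suc (suc n + suc n) ≡ 8 * suc n + suc (n + n) * suc (n + n)
  e = ℕ-solve-∀
  e′ : ∀ n t → 8 * suc n + suc (8 * t) ≡ suc (8 * (suc n + t))
  e′ = ℕ-solve-∀

sq : ℕ → ℕ
sq n = suc (n + n) * suc (n + n)

products : ℕ → ℕ → ℕ → ℕ
products α β γ = suc (α + α) * suc (β + β) + suc (β + β) * suc (γ + γ) + suc (α + α) * suc (γ + γ)

module _ (B : ℕ) where
  open Box B

  Recurrent : (ℕ → ℤ) → Set
  Recurrent f = ∀ M → M < B → ∑ (λ ξ → F (pos M) (pos (suc (ξ + ξ))) *ᶻ f (4 * M ∸ suc (ξ + ξ) * suc (ξ + ξ))) ≡ 0ℤ

  -- Take M = 2N + 1. As x² = 8 T + 1 with T triangular, 4M - x² = 8 (N - T) + 3, so only smaller N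
  -- occur besides x = 1. The coefficient at x = 1 is M - 1 = 2N, which vanishes only for N = 0;
  -- hence the value at 3 is prescribed. Arguments past the range truncate to 0, where f vanishes.
  recurrent-unique : ∀ f → Recurrent f → f 0 ≡ 0ℤ → f 3 ≡ 0ℤ → ∀ N → suc (N + N) < B → f (8 * N + 3) ≡ 0ℤ
  recurrent-unique f r f0 f3 = <-rec _ step
    where
    arg : ∀ N ξ → 4 * suc (N + N) ∸ suc (ξ + ξ) * suc (ξ + ξ) ≡ 8 * N + 3 ∸ 8 * tri ξ
    arg N ξ = cong₂ _∸_ (lem N) (odd-square ξ)
      where
      lem : ∀ N → 4 * suc (N + N) ≡ suc (8 * N + 3)
      lem = ℕ-solve-∀
    step : ∀ N → (∀ {K} → K < N → suc (K + K) < B → f (8 * K + 3) ≡ 0ℤ) → suc (N + N) < B → f (8 * N + 3) ≡ 0ℤ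
    step zero    ih lt = f3
    step (suc N) ih lt = ℤ.*-cancelˡ-≡ (pos (suc N + suc N)) (f (8 * suc N + 3)) 0ℤ (begin
      pos (suc N + suc N) *ᶻ f (8 * suc N + 3)
        ≡⟨ cong₂ _*ᶻ_ (lem (pos (suc N + suc N))) (cong f (sym (arg (suc N) 0))) ⟩
      t 0
        ≡⟨ sym (ℤ.+-identityʳ (t 0)) ⟩
      t 0 +ᶻ 0ℤ
        ≡⟨ cong (t 0 +ᶻ_) (sym (sumTo-zero B λ ξ → *-≡0 (F (pos (suc (suc N + suc N))) (pos (suc (suc ξ + suc ξ)))) (rest ξ))) ⟩
      t 0 +ᶻ ∑ (t ∘ suc)
        ≡⟨ sym (∑-split₀ t λ ξ B≤ξ → *-≡0 (F (pos (suc (suc N + suc N))) (pos (suc (ξ + ξ)))) (far ξ B≤ξ)) ⟩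
      ∑ t
        ≡⟨ r (suc (suc N + suc N)) lt ⟩
      0ℤ
        ≡⟨ sym (ℤ.*-zeroʳ (pos (suc N + suc N))) ⟩
      pos (suc N + suc N) *ᶻ 0ℤ ∎)
      where
      open ≡-Reasoning
      t : ℕ → ℤ
      t ξ = F (pos (suc (suc N + suc N))) (pos (suc (ξ + ξ))) *ᶻ f (4 * suc (suc N + suc N) ∸ suc (ξ + ξ) * suc (ξ + ξ))
      lem : ∀ n → n ≡ (1ℤ +ᶻ n) +ᶻ -ᶻ (1ℤ *ᶻ 1ℤ)
      lem = ℤ-solve-∀
      beyond : ∀ ξ → suc N < tri ξ → f (8 * suc N + 3 ∸ 8 * tri ξ) ≡ 0ℤ
      beyond ξ l = trans (cong f (ℕ.m≤n⇒m∸n≡0 (ℕ.≤-trans (ℕ.+-monoʳ-≤ (8 * suc N) (s≤s (s≤s (s≤s (z≤n {5}))))) (ℕ.≤-trans (ℕ.≤-reflexive (e N)) (ℕ.*-monoʳ-≤ 8 l))))) f0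
        where
        e : ∀ N → 8 * suc N + 8 ≡ 8 * suc (suc N)
        e = ℕ-solve-∀
      ξ≤tri : ∀ ξ → ξ ≤ tri ξ
      ξ≤tri zero    = z≤n
      ξ≤tri (suc ξ) = ℕ.m≤m+n (suc ξ) (tri ξ)
      far : ∀ ξ → B ≤ ξ → f (4 * suc (suc N + suc N) ∸ suc (ξ + ξ) * suc (ξ + ξ)) ≡ 0ℤ
      far ξ B≤ξ = trans (cong f (arg (suc N) ξ)) (beyond ξ (ℕ.≤-trans (ℕ.≤-trans (ℕ.≤-trans (s≤s (ℕ.m≤m+n (suc N) (suc N))) (ℕ.≤-trans (ℕ.n≤1+n _) lt)) B≤ξ) (ξ≤tri ξ)))
      rest : ∀ ξ → f (4 * suc (suc N + suc N) ∸ suc (suc ξ + suc ξ) * suc (suc ξ + suc ξ)) ≡ 0ℤ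
      rest ξ with tri (suc ξ) ≤? suc N
      ... | no  nle = trans (cong f (arg (suc N) (suc ξ))) (beyond (suc ξ) (ℕ.≰⇒> nle))
      ... | yes le  = trans (cong f (trans (arg (suc N) (suc ξ)) (e (suc N) (tri (suc ξ)) le)))
          (ih K<N (ℕ.≤-trans (s≤s (s≤s (ℕ.+-mono-≤ (ℕ.<⇒≤ K<N) (ℕ.<⇒≤ K<N)))) lt))
        where
        K<N : suc N ∸ tri (suc ξ) < suc N
        K<N = s≤s (ℕ.m∸n≤m N (ξ + tri ξ))
        e : ∀ n t → t ≤ n → 8 * n + 3 ∸ 8 * t ≡ 8 * (n ∸ t) + 3
        e n t t≤n = trans (ℕ.+-∸-comm 3 (ℕ.*-monoʳ-≤ 8 t≤n)) (cong (_+ 3) (sym (ℕ.*-distribˡ-∸ 8 n t)))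

  opaque
    classes squares : ℕ → ℤ
    classes n = ∑³ λ α β γ → χ (suc (α + γ)) *ᶻ χ (suc (β + γ)) *ᶻ δ n (products α β γ)
    squares n = ∑³ λ α β γ → δ n (sq α + sq β + sq γ)

  ∑³-*ˡ : ∀ c f → ∑³ (λ a b d → c *ᶻ f a b d) ≡ c *ᶻ ∑³ f
  ∑³-*ˡ c f = trans (∑²-cong λ a b → sumTo-*ˡ B c (f a b)) (trans (∑-cong λ a → sumTo-*ˡ B c (λ b → ∑ (f a b))) (sumTo-*ˡ B c (λ a → ∑² (f a))))

  opaque
    unfolding classes squares

    -- Moving x² across the delta turns the sum into `S` for the weight of `Recurrence`.
    classes-recurrent : Recurrent classes
    classes-recurrent M M<B = trans (∑-cong λ ξ → trans (sym (∑³-*ˡ (φ ξ) _)) (∑³-cong λ α β γ → term ξ α β γ)) (R.S≡0)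
      where
      module R = Recurrence M B M<B
      module D = Decomposition B R.G₄ R.G₄-supp
      φ : ℕ → ℤ
      φ ξ = F (pos M) (pos (suc (ξ + ξ)))
      opaque
        unfolding D.s
        term : ∀ ξ α β γ → φ ξ *ᶻ (χ (suc (α + γ)) *ᶻ χ (suc (β + γ)) *ᶻ δ (4 * M ∸ sq ξ) (products α β γ)) ≡ D.s ξ α β γ
        term ξ α β γ = trans (lem (φ ξ) (χ (suc (α + γ)) *ᶻ χ (suc (β + γ))) (δ (4 * M ∸ sq ξ) (products α β γ)))
          (cong (λ t → χ (suc (α + γ)) *ᶻ χ (suc (β + γ)) *ᶻ (t *ᶻ φ ξ)) (sym (δ-∸ (4 * M) (sq ξ) _)))
          where
          lem : ∀ a b c → a *ᶻ (b *ᶻ c) ≡ b *ᶻ (c *ᶻ a)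
          lem = ℤ-solve-∀

  opaque
    unfolding classes squares

    -- Symmetrising over the four squares replaces the weight M − x² by M − (x² + a² + b² + c²)/4 = 0.
    squares-recurrent : Recurrent squares
    squares-recurrent M M<B = trans (∑-cong λ ξ → trans (sym (∑³-*ˡ (φ ξ) (λ α β γ → δ (4 * M ∸ sq ξ) (sq α + sq β + sq γ))))
        (∑³-cong λ α β γ → cong (φ ξ *ᶻ_) (sym (δ-∸ (4 * M) (sq ξ) _)))) X≡0
      where
      open ≡-Reasoning
      φ : ℕ → ℤ
      φ ξ = F (pos M) (pos (suc (ξ + ξ)))
      d : ℕ → ℕ → ℕ → ℕ → ℤ
      d ξ α β γ = δ (4 * M) (sq ξ + (sq α + sq β + sq γ))
      X : ℤ
      X = ∑⁴ λ ξ α β γ → φ ξ *ᶻ d ξ α β γ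
      X₂ : X ≡ ∑⁴ λ ξ α β γ → φ α *ᶻ d ξ α β γ
      X₂ = trans (∑⁴-swap₁₂ (λ ξ α β γ → φ ξ *ᶻ d ξ α β γ)) (∑⁴-cong λ ξ α β γ → cong (λ n → φ α *ᶻ δ (4 * M) n) (e (sq ξ) (sq α) (sq β) (sq γ)))
        where
        e : ∀ x a b c → a + (x + b + c) ≡ x + (a + b + c)
        e = ℕ-solve-∀
      X₃ : X ≡ ∑⁴ λ ξ α β γ → φ β *ᶻ d ξ α β γ
      X₃ = trans X₂ (trans (∑⁴-swap₂₃ (λ ξ α β γ → φ α *ᶻ d ξ α β γ)) (∑⁴-cong λ ξ α β γ → cong (λ n → φ β *ᶻ δ (4 * M) (sq ξ + (n + sq γ))) (ℕ.+-comm (sq β) (sq α))))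
      X₄ : X ≡ ∑⁴ λ ξ α β γ → φ γ *ᶻ d ξ α β γ
      X₄ = trans X₃ (trans (∑⁴-swap₃₄ (λ ξ α β γ → φ β *ᶻ d ξ α β γ)) (∑⁴-cong λ ξ α β γ → cong (λ n → φ γ *ᶻ δ (4 * M) (sq ξ + n)) (e (sq α) (sq β) (sq γ))))
        where
        e : ∀ a b c → a + c + b ≡ a + b + c
        e = ℕ-solve-∀
      pos-sq : ∀ n → pos (sq n) ≡ pos (suc (n + n)) *ᶻ pos (suc (n + n))
      pos-sq n = ℤ.pos-* (suc (n + n)) (suc (n + n))
      lem : ∀ m x a b c e → ((m +ᶻ -ᶻ (x *ᶻ x)) *ᶻ e +ᶻ (m +ᶻ -ᶻ (a *ᶻ a)) *ᶻ e) +ᶻ ((m +ᶻ -ᶻ (b *ᶻ b)) *ᶻ e +ᶻ (m +ᶻ -ᶻ (c *ᶻ c)) *ᶻ e) ≡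
        e *ᶻ (pos 4 *ᶻ m +ᶻ -ᶻ (x *ᶻ x +ᶻ (a *ᶻ a +ᶻ b *ᶻ b +ᶻ c *ᶻ c)))
      lem = ℤ-solve-∀
      pointwise : ∀ ξ α β γ → (φ ξ *ᶻ d ξ α β γ +ᶻ φ α *ᶻ d ξ α β γ) +ᶻ (φ β *ᶻ d ξ α β γ +ᶻ φ γ *ᶻ d ξ α β γ) ≡ 0ℤ
      pointwise ξ α β γ = begin
        (φ ξ *ᶻ d ξ α β γ +ᶻ φ α *ᶻ d ξ α β γ) +ᶻ (φ β *ᶻ d ξ α β γ +ᶻ φ γ *ᶻ d ξ α β γ)
          ≡⟨ lem (pos M) (pos (suc (ξ + ξ))) (pos (suc (α + α))) (pos (suc (β + β))) (pos (suc (γ + γ))) (d ξ α β γ) ⟩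
        d ξ α β γ *ᶻ (pos 4 *ᶻ pos M +ᶻ -ᶻ (pos (suc (ξ + ξ)) *ᶻ pos (suc (ξ + ξ)) +ᶻ
          (pos (suc (α + α)) *ᶻ pos (suc (α + α)) +ᶻ pos (suc (β + β)) *ᶻ pos (suc (β + β)) +ᶻ pos (suc (γ + γ)) *ᶻ pos (suc (γ + γ)))))
          ≡⟨ sym (cong₂ (λ a b → d ξ α β γ *ᶻ (a +ᶻ -ᶻ b)) (ℤ.pos-* 4 M)
               (cong₂ _+ᶻ_ (pos-sq ξ) (cong₂ _+ᶻ_ (cong₂ _+ᶻ_ (pos-sq α) (pos-sq β)) (pos-sq γ)))) ⟩
        d ξ α β γ *ᶻ (pos (4 * M) +ᶻ -ᶻ pos (sq ξ + (sq α + sq β + sq γ)))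
          ≡⟨ δ-subst (4 * M) (sq ξ + (sq α + sq β + sq γ)) (λ n → pos n +ᶻ -ᶻ pos (sq ξ + (sq α + sq β + sq γ))) ⟩
        d ξ α β γ *ᶻ (pos (sq ξ + (sq α + sq β + sq γ)) +ᶻ -ᶻ pos (sq ξ + (sq α + sq β + sq γ)))
          ≡⟨ cong (d ξ α β γ *ᶻ_) (ℤ.+-inverseʳ (pos (sq ξ + (sq α + sq β + sq γ)))) ⟩
        d ξ α β γ *ᶻ 0ℤ
          ≡⟨ ℤ.*-zeroʳ (d ξ α β γ) ⟩
        0ℤ ∎
      X≡0 : X ≡ 0ℤ
      X≡0 = double-zero X (double-zero (X +ᶻ X) (begin
        (X +ᶻ X) +ᶻ (X +ᶻ X)
          ≡⟨ cong₂ _+ᶻ_ (cong (X +ᶻ_) X₂) (cong₂ _+ᶻ_ X₃ X₄) ⟩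
        (X +ᶻ ∑⁴ (λ ξ α β γ → φ α *ᶻ d ξ α β γ)) +ᶻ (∑⁴ (λ ξ α β γ → φ β *ᶻ d ξ α β γ) +ᶻ ∑⁴ (λ ξ α β γ → φ γ *ᶻ d ξ α β γ))
          ≡⟨ sym (trans (∑⁴-+ _ _) (cong₂ _+ᶻ_ (∑⁴-+ (λ ξ α β γ → φ ξ *ᶻ d ξ α β γ) (λ ξ α β γ → φ α *ᶻ d ξ α β γ))
            (∑⁴-+ (λ ξ α β γ → φ β *ᶻ d ξ α β γ) (λ ξ α β γ → φ γ *ᶻ d ξ α β γ)))) ⟩
        ∑⁴ (λ ξ α β γ → (φ ξ *ᶻ d ξ α β γ +ᶻ φ α *ᶻ d ξ α β γ) +ᶻ (φ β *ᶻ d ξ α β γ +ᶻ φ γ *ᶻ d ξ α β γ))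
          ≡⟨ (sumTo-zero B λ ξ → sumTo-zero B λ α → sumTo-zero B λ β → sumTo-zero B λ γ → pointwise ξ α β γ) ⟩
        0ℤ ∎))

  recurrent-- : ∀ f g → Recurrent f → Recurrent g → Recurrent (λ n → f n +ᶻ -ᶻ g n)
  recurrent-- f g rf rg M M<B = trans (∑-cong λ ξ → lem (φ ξ) (f (4 * M ∸ sq ξ)) (g (4 * M ∸ sq ξ)))
    (trans (∑-+ (λ ξ → φ ξ *ᶻ f (4 * M ∸ sq ξ)) (λ ξ → -ᶻ (φ ξ *ᶻ g (4 * M ∸ sq ξ))))
      (cong₂ _+ᶻ_ (rf M M<B) (trans (sumTo-neg B (λ ξ → φ ξ *ᶻ g (4 * M ∸ sq ξ))) (cong -ᶻ_ (rg M M<B)))))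
    where
    φ : ℕ → ℤ
    φ ξ = F (pos M) (pos (suc (ξ + ξ)))
    lem : ∀ c a b → c *ᶻ (a +ᶻ -ᶻ b) ≡ c *ᶻ a +ᶻ -ᶻ (c *ᶻ b)
    lem = ℤ-solve-∀

sumTo-head : ∀ k f → (∀ n → f (suc n) ≡ 0ℤ) → sumTo (suc k) f ≡ f 0
sumTo-head k f e = trans (cong (f 0 +ᶻ_) (sumTo-zero k e)) (ℤ.+-identityʳ (f 0))

∑³-origin : ∀ k f → (∀ a b c → f (suc a) b c ≡ 0ℤ) → (∀ b c → f 0 (suc b) c ≡ 0ℤ) → (∀ c → f 0 0 (suc c) ≡ 0ℤ) →
  Box.∑³ (suc k) f ≡ f 0 0 0
∑³-origin k f e₁ e₂ e₃ = trans
  (sumTo-head k (λ a → Box.∑² (suc k) (f a)) λ a → sumTo-zero (suc k) λ b → sumTo-zero (suc k) (e₁ a b))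
  (trans (sumTo-head k (λ b → Box.∑ (suc k) (f 0 b)) λ b → sumTo-zero (suc k) (e₂ b)) (sumTo-head k (f 0 0) e₃))

opaque
  unfolding classes squares

  classes-0 : ∀ B → classes B 0 ≡ 0ℤ
  classes-0 B = sumTo-zero B λ α → sumTo-zero B λ β → sumTo-zero B λ γ →
    *-≡0 (χ (suc (α + γ)) *ᶻ χ (suc (β + γ))) (δ-≢ {0} {products α β γ} λ ())

  squares-0 : ∀ B → squares B 0 ≡ 0ℤ
  squares-0 B = sumTo-zero B λ α → sumTo-zero B λ β → sumTo-zero B λ γ → δ-≢ {0} {sq α + sq β + sq γ} λ ()

  -- Only a = b = c = 1 contributes: an entry of at least 3 makes ab + bc + ca at least 7.
  classes-3 : ∀ k → classes (suc k) 3 ≡ 1ℤ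
  classes-3 k = ∑³-origin k (λ α β γ → χ (suc (α + γ)) *ᶻ χ (suc (β + γ)) *ᶻ δ 3 (products α β γ))
    (λ α β γ → *-≡0 (χ (suc (suc α + γ)) *ᶻ χ (suc (β + γ))) (δ-≢ {3} {products (suc α) β γ} λ e → 3≢7+ (trans e (e₁ α β γ))))
    (λ β γ → *-≡0 (χ (suc γ) *ᶻ χ (suc (suc β + γ))) (δ-≢ {3} {products 0 (suc β) γ} λ e → 3≢7+ (trans e (e₂ β γ))))
    (λ γ → *-≡0 (χ (suc (suc γ)) *ᶻ χ (suc (suc γ))) (δ-≢ {3} {products 0 0 (suc γ)} λ e → 3≢7+ (trans e (e₃ γ))))
    where
    3≢7+ : ∀ {n} → 3 ≢ 7 + n
    3≢7+ ()
    e₁ : ∀ α β γ → suc (suc α + suc α) * suc (β + β) + suc (β + β) * suc (γ + γ) + suc (suc α + suc α) * suc (γ + γ) ≡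
      7 + (4 * α + 8 * β + 8 * γ + 4 * (α * β) + 4 * (β * γ) + 4 * (α * γ))
    e₁ = ℕ-solve-∀
    e₂ : ∀ β γ → 1 * suc (suc β + suc β) + suc (suc β + suc β) * suc (γ + γ) + 1 * suc (γ + γ) ≡ 7 + (4 * β + 8 * γ + 4 * (β * γ))
    e₂ = ℕ-solve-∀
    e₃ : ∀ γ → 1 * 1 + 1 * suc (suc γ + suc γ) + 1 * suc (suc γ + suc γ) ≡ 7 + 4 * γ
    e₃ = ℕ-solve-∀

  squares-3 : ∀ k → squares (suc k) 3 ≡ 1ℤ
  squares-3 k = ∑³-origin k (λ α β γ → δ 3 (sq α + sq β + sq γ))
    (λ α β γ → δ-≢ {3} {sq (suc α) + sq β + sq γ} λ e → 3≢9+ (trans e (e₁ α (β + β) (γ + γ))))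
    (λ β γ → δ-≢ {3} {sq 0 + sq (suc β) + sq γ} λ e → 3≢9+ (trans e (e₂ β (γ + γ))))
    (λ γ → δ-≢ {3} {sq 0 + sq 0 + sq (suc γ)} λ e → 3≢9+ (trans e (e₃ γ)))
    where
    3≢9+ : ∀ {n} → 3 ≢ 9 + n
    3≢9+ ()
    e₁ : ∀ α b c → suc (suc α + suc α) * suc (suc α + suc α) + suc b * suc b + suc c * suc c ≡
      9 + (12 * α + 4 * (α * α) + suc b * suc b + suc c * suc c)
    e₁ = ℕ-solve-∀
    e₂ : ∀ β c → 1 * 1 + suc (suc β + suc β) * suc (suc β + suc β) + suc c * suc c ≡ 9 + (1 + 12 * β + 4 * (β * β) + suc c * suc c)
    e₂ = ℕ-solve-∀
    e₃ : ∀ γ → 1 * 1 + 1 * 1 + suc (suc γ + suc γ) * suc (suc γ + suc γ) ≡ 9 + (2 + 12 * γ + 4 * (γ * γ))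
    e₃ = ℕ-solve-∀

classes≡squares : ∀ B N → suc (N + N) < B → classes B (8 * N + 3) ≡ squares B (8 * N + 3)
classes≡squares B@(suc k) N lt = ℤ.i-j≡0⇒i≡j (classes B (8 * N + 3)) (squares B (8 * N + 3))
  (recurrent-unique B (λ n → classes B n +ᶻ -ᶻ squares B n)
    (recurrent-- B (classes B) (squares B) (classes-recurrent B) (squares-recurrent B))
    (cong₂ (λ a b → a +ᶻ -ᶻ b) (classes-0 B) (squares-0 B))
    (cong₂ (λ a b → a +ᶻ -ᶻ b) (classes-3 k) (squares-3 k))
    N lt)

-- Positivity and the theorem on 8N + 3

⟦⟧⟦⟧δ-nonneg : ∀ P Q m n → 0ℤ ℤ.≤ ⟦ P ⟧ *ᶻ ⟦ Q ⟧ *ᶻ δ m n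
⟦⟧⟦⟧δ-nonneg P Q m n with m ≟ n
⟦⟧⟦⟧δ-nonneg true  true  m n | yes _ = ℤ.+≤+ z≤n
⟦⟧⟦⟧δ-nonneg true  false m n | yes _ = ℤ.+≤+ z≤n
⟦⟧⟦⟧δ-nonneg false Q     m n | yes _ = ℤ.+≤+ z≤n
⟦⟧⟦⟧δ-nonneg P     Q     m n | no _  = ℤ.≤-reflexive (sym (ℤ.*-zeroʳ (⟦ P ⟧ *ᶻ ⟦ Q ⟧)))

module _ (B N : ℕ) (lt : suc (N + N) < B) where
  open Box B

  opaque
    unfolding classes

    -- The term a = c = 1, b = 4N + 1 is positive.
    classes-pos : 1ℤ ℤ.≤ classes B (8 * N + 3)
    classes-pos = ℤ.≤-trans (ℤ.≤-trans (ℤ.≤-trans (ℤ.≤-reflexive (sym value))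
        (sumTo-term B (λ γ → t 0 (N + N) γ) (λ γ → nn 0 (N + N) γ) 0 (ℕ.≤-trans (s≤s z≤n) lt)))
        (sumTo-term B (λ β → ∑ (t 0 β)) (λ β → sumTo-nonneg B (t 0 β) (nn 0 β)) (N + N) (ℕ.≤-trans (ℕ.n≤1+n _) lt)))
        (sumTo-term B (λ α → ∑² (t α)) (λ α → sumTo-nonneg B (λ β → ∑ (t α β)) λ β → sumTo-nonneg B (t α β) (nn α β)) 0 (ℕ.≤-trans (s≤s z≤n) lt))
      where
      t : ℕ → ℕ → ℕ → ℤ
      t α β γ = χ (suc (α + γ)) *ᶻ χ (suc (β + γ)) *ᶻ δ (8 * N + 3) (products α β γ)
      nn : ∀ α β γ → 0ℤ ℤ.≤ t α β γ
      nn α β γ = ⟦⟧⟦⟧δ-nonneg (odd (suc (α + γ))) (odd (suc (β + γ))) (8 * N + 3) (products α β γ)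
      e : ∀ N → 1 * suc ((N + N) + (N + N)) + suc ((N + N) + (N + N)) * 1 + 1 * 1 ≡ 8 * N + 3
      e = ℕ-solve-∀
      value : t 0 (N + N) 0 ≡ 1ℤ
      value = trans (cong₂ (λ a b → 1ℤ *ᶻ a *ᶻ δ (8 * N + 3) b) (trans (cong (χ ∘ suc) (ℕ.+-identityʳ (N + N))) (χ-odd N)) (e N))
        (cong (1ℤ *ᶻ 1ℤ *ᶻ_) (δ-refl (8 * N + 3)))

  opaque
    unfolding squares

    squares-witness : squares B (8 * N + 3) ≢ 0ℤ → ∃ λ a → ∃ λ b → ∃ λ c → a * a + b * b + c * c ≡ 8 * N + 3
    squares-witness n₀ with sumTo-witness B (λ α → ∑² λ β γ → δ (8 * N + 3) (sq α + sq β + sq γ)) n₀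
    ... | α , n₁ with sumTo-witness B (λ β → ∑ λ γ → δ (8 * N + 3) (sq α + sq β + sq γ)) n₁
    ...   | β , n₂ with sumTo-witness B (λ γ → δ (8 * N + 3) (sq α + sq β + sq γ)) n₂
    ...     | γ , n₃ with 8 * N + 3 ≟ sq α + sq β + sq γ
    ...       | yes e = suc (α + α) , suc (β + β) , suc (γ + γ) , sym e
    ...       | no ne = ⊥-elim (n₃ refl)

  squares-pos : ∃ λ a → ∃ λ b → ∃ λ c → a * a + b * b + c * c ≡ 8 * N + 3
  squares-pos = squares-witness λ e → 1≰0 (subst (1ℤ ℤ.≤_) (trans (classes≡squares B N lt) e) classes-pos)
    where
    1≰0 : ¬ 1ℤ ℤ.≤ 0ℤ
    1≰0 (ℤ.+≤+ ())

opaque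
  three-squares : ∀ N → ∃ λ a → ∃ λ b → ∃ λ c → a * a + b * b + c * c ≡ 8 * N + 3
  three-squares N = squares-pos (2 + (N + N)) N ℕ.≤-refl

-- Four squares up to a square factor

pos-sum-squares : ∀ a b c → pos (a * a + b * b + c * c) ≡ pos a *ᶻ pos a +ᶻ pos b *ᶻ pos b +ᶻ pos c *ᶻ pos c
pos-sum-squares a b c = cong₂ _+ᶻ_ (cong₂ _+ᶻ_ (ℤ.pos-* a a) (ℤ.pos-* b b)) (ℤ.pos-* c c)

i*j≢0 : ∀ {i j} → i ≢ 0ℤ → j ≢ 0ℤ → i *ᶻ j ≢ 0ℤ
i*j≢0 {i} i≢0 j≢0 e = [ i≢0 , j≢0 ]′ (ℤ.i*j≡0⇒i≡0∨j≡0 i e)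

-- Since 4 (2m + 1) = 1 + (8m + 3), the extra summand 1 also serves as the nonzero square r².
four-squares-odd : ∀ m → FourSquares (suc (m + m))
four-squares-odd m with three-squares m
... | a , b , c , e = pos 2 , 1ℤ , pos a , pos b , pos c , (λ ()) , (λ ()) , (begin
  pos 2 *ᶻ pos 2 *ᶻ pos (suc (m + m))  ≡⟨ sym (ℤ.pos-* 4 (suc (m + m))) ⟩
  pos (4 * suc (m + m))  ≡⟨ cong pos (trans (lem m) (cong suc (sym e))) ⟩
  1ℤ +ᶻ pos (a * a + b * b + c * c)  ≡⟨ cong (1ℤ +ᶻ_) (pos-sum-squares a b c) ⟩
  1ℤ +ᶻ (pos a *ᶻ pos a +ᶻ pos b *ᶻ pos b +ᶻ pos c *ᶻ pos c) ≡⟨ lem′ (pos a *ᶻ pos a) (pos b *ᶻ pos b) (pos c *ᶻ pos c) ⟩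
  1ℤ *ᶻ 1ℤ +ᶻ pos a *ᶻ pos a +ᶻ pos b *ᶻ pos b +ᶻ pos c *ᶻ pos c ∎)
  where
  open ≡-Reasoning
  lem : ∀ m → 4 * suc (m + m) ≡ suc (8 * m + 3)
  lem = ℕ-solve-∀
  lem′ : ∀ a b c → 1ℤ +ᶻ (a +ᶻ b +ᶻ c) ≡ 1ℤ *ᶻ 1ℤ +ᶻ a +ᶻ b +ᶻ c
  lem′ = ℤ-solve-∀

-- By 2 (r² + a²) = (r + a)² + (r - a)², and likewise for b and c. As r is nonzero, so is one of r +
-- a and r - a, and that one becomes the new r.
four-squares-double : ∀ m → FourSquares m → FourSquares (m + m)
four-squares-double m (k , r , a , b , c , k≢0 , r≢0 , e) with r +ᶻ a ℤ.≟ 0ℤ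
... | no r+a≢0 = k , r +ᶻ a , r -ᶻ a , b +ᶻ c , b -ᶻ c , k≢0 , r+a≢0 ,
  trans (lem k (pos m)) (trans (cong (λ t → t +ᶻ t) e) (lem′ r a b c))
  where
  lem : ∀ k m → k *ᶻ k *ᶻ (m +ᶻ m) ≡ k *ᶻ k *ᶻ m +ᶻ k *ᶻ k *ᶻ m
  lem = ℤ-solve-∀
  lem′ : ∀ r a b c → (r *ᶻ r +ᶻ a *ᶻ a +ᶻ b *ᶻ b +ᶻ c *ᶻ c) +ᶻ (r *ᶻ r +ᶻ a *ᶻ a +ᶻ b *ᶻ b +ᶻ c *ᶻ c) ≡
    (r +ᶻ a) *ᶻ (r +ᶻ a) +ᶻ (r -ᶻ a) *ᶻ (r -ᶻ a) +ᶻ (b +ᶻ c) *ᶻ (b +ᶻ c) +ᶻ (b -ᶻ c) *ᶻ (b -ᶻ c)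
  lem′ = ℤ-solve-∀
... | yes r+a≡0 = k , r -ᶻ a , r +ᶻ a , b +ᶻ c , b -ᶻ c , k≢0 , r-a≢0 ,
  trans (lem k (pos m)) (trans (cong (λ t → t +ᶻ t) e) (lem′ r a b c))
  where
  lem : ∀ k m → k *ᶻ k *ᶻ (m +ᶻ m) ≡ k *ᶻ k *ᶻ m +ᶻ k *ᶻ k *ᶻ m
  lem = ℤ-solve-∀
  lem′ : ∀ r a b c → (r *ᶻ r +ᶻ a *ᶻ a +ᶻ b *ᶻ b +ᶻ c *ᶻ c) +ᶻ (r *ᶻ r +ᶻ a *ᶻ a +ᶻ b *ᶻ b +ᶻ c *ᶻ c) ≡
    (r -ᶻ a) *ᶻ (r -ᶻ a) +ᶻ (r +ᶻ a) *ᶻ (r +ᶻ a) +ᶻ (b +ᶻ c) *ᶻ (b +ᶻ c) +ᶻ (b -ᶻ c) *ᶻ (b -ᶻ c)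
  lem′ = ℤ-solve-∀
  lem″ : ∀ r a → pos 2 *ᶻ r ≡ (r -ᶻ a) +ᶻ (r +ᶻ a)
  lem″ = ℤ-solve-∀
  r-a≢0 : r -ᶻ a ≢ 0ℤ
  r-a≢0 z = r≢0 (ℤ.*-cancelˡ-≡ (pos 2) r 0ℤ (trans (lem″ r a) (cong₂ _+ᶻ_ z r+a≡0)))

opaque
  four-squares : ∀ n → FourSquares (suc n)
  four-squares n = <-rec (λ n → FourSquares (suc n)) (λ n ih → step n (halve n) ih) n
    where
    step : ∀ n → Halved n → (∀ {m} → m < n → FourSquares (suc m)) → FourSquares (suc n)
    step _ (even m) ih = four-squares-odd m
    step _ (odd′ m) ih = subst FourSquares (cong suc (ℕ.+-suc m m)) (four-squares-double (suc m) (ih (s≤s (ℕ.m≤m+n m m))))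

-- The ternary equation n (Z² - (4t + 1) X²) = a² + b² + c²

dot : ℤ → ℤ → ℤ → ℤ → ℤ → ℤ → ℤ
dot a₁ a₂ a₃ b₁ b₂ b₃ = a₁ *ᶻ b₁ +ᶻ a₂ *ᶻ b₂ +ᶻ a₃ *ᶻ b₃

norm : ℤ → ℤ → ℤ → ℤ
norm a₁ a₂ a₃ = dot a₁ a₂ a₃ a₁ a₂ a₃

-- The map comes from the action w + z√−c ↦ (γ + √−c)(w + z√−c)(γ̄ − √−c) / 2 on quaternions over ℚ(√−c),
-- where c = |γ|² and γ = r + g: it multiplies the norm |w|² − c z² by c r².
module Similitude (r g₁ g₂ g₃ z w₁ w₂ w₃ : ℤ) where
  c z′ p₁ p₂ p₃ : ℤ
  c  = r *ᶻ r +ᶻ norm g₁ g₂ g₃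
  z′ = z *ᶻ c +ᶻ dot g₁ g₂ g₃ w₁ w₂ w₃
  p₁ = r *ᶻ w₁ +ᶻ (g₂ *ᶻ w₃ -ᶻ g₃ *ᶻ w₂)
  p₂ = r *ᶻ w₂ +ᶻ (g₃ *ᶻ w₁ -ᶻ g₁ *ᶻ w₃)
  p₃ = r *ᶻ w₃ +ᶻ (g₁ *ᶻ w₂ -ᶻ g₂ *ᶻ w₁)

  identity : norm (r *ᶻ p₁ +ᶻ z′ *ᶻ g₁) (r *ᶻ p₂ +ᶻ z′ *ᶻ g₂) (r *ᶻ p₃ +ᶻ z′ *ᶻ g₃) ≡
    c *ᶻ (z′ *ᶻ z′) -ᶻ c *ᶻ (r *ᶻ r) *ᶻ (c *ᶻ (z *ᶻ z) -ᶻ norm w₁ w₂ w₃)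
  identity = begin
    norm (r *ᶻ p₁ +ᶻ z′ *ᶻ g₁) (r *ᶻ p₂ +ᶻ z′ *ᶻ g₂) (r *ᶻ p₃ +ᶻ z′ *ᶻ g₃)
      ≡⟨ expand r z′ p₁ p₂ p₃ g₁ g₂ g₃ ⟩
    r *ᶻ r *ᶻ norm p₁ p₂ p₃ +ᶻ pos 2 *ᶻ r *ᶻ z′ *ᶻ dot g₁ g₂ g₃ p₁ p₂ p₃ +ᶻ z′ *ᶻ z′ *ᶻ norm g₁ g₂ g₃
      -- The vector p is r w + g × w. As g × w is orthogonal to g and w, |p|² = c |w|² - (g·w)² and
      -- g·p = r (g·w).
      ≡⟨ cong₂ (λ a b → r *ᶻ r *ᶻ a +ᶻ pos 2 *ᶻ r *ᶻ z′ *ᶻ b +ᶻ z′ *ᶻ z′ *ᶻ norm g₁ g₂ g₃)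
           (norm-p r g₁ g₂ g₃ w₁ w₂ w₃) (dot-p r g₁ g₂ g₃ w₁ w₂ w₃) ⟩
    r *ᶻ r *ᶻ (c *ᶻ s -ᶻ d *ᶻ d) +ᶻ pos 2 *ᶻ r *ᶻ z′ *ᶻ (r *ᶻ d) +ᶻ z′ *ᶻ z′ *ᶻ norm g₁ g₂ g₃
      ≡⟨ collect r z (norm g₁ g₂ g₃) d s ⟩
    c *ᶻ (z′ *ᶻ z′) -ᶻ c *ᶻ (r *ᶻ r) *ᶻ (c *ᶻ (z *ᶻ z) -ᶻ s) ∎
    where
    open ≡-Reasoning
    d s : ℤ
    d = dot g₁ g₂ g₃ w₁ w₂ w₃
    s = norm w₁ w₂ w₃
    expand : ∀ r z p₁ p₂ p₃ g₁ g₂ g₃ →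
      (r *ᶻ p₁ +ᶻ z *ᶻ g₁) *ᶻ (r *ᶻ p₁ +ᶻ z *ᶻ g₁) +ᶻ (r *ᶻ p₂ +ᶻ z *ᶻ g₂) *ᶻ (r *ᶻ p₂ +ᶻ z *ᶻ g₂) +ᶻ (r *ᶻ p₃ +ᶻ z *ᶻ g₃) *ᶻ (r *ᶻ p₃ +ᶻ z *ᶻ g₃) ≡
      r *ᶻ r *ᶻ (p₁ *ᶻ p₁ +ᶻ p₂ *ᶻ p₂ +ᶻ p₃ *ᶻ p₃) +ᶻ pos 2 *ᶻ r *ᶻ z *ᶻ (g₁ *ᶻ p₁ +ᶻ g₂ *ᶻ p₂ +ᶻ g₃ *ᶻ p₃) +ᶻ
      z *ᶻ z *ᶻ (g₁ *ᶻ g₁ +ᶻ g₂ *ᶻ g₂ +ᶻ g₃ *ᶻ g₃)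
    expand = ℤ-solve-∀
    norm-p : ∀ r g₁ g₂ g₃ w₁ w₂ w₃ →
      (r *ᶻ w₁ +ᶻ (g₂ *ᶻ w₃ -ᶻ g₃ *ᶻ w₂)) *ᶻ (r *ᶻ w₁ +ᶻ (g₂ *ᶻ w₃ -ᶻ g₃ *ᶻ w₂)) +ᶻ
      (r *ᶻ w₂ +ᶻ (g₃ *ᶻ w₁ -ᶻ g₁ *ᶻ w₃)) *ᶻ (r *ᶻ w₂ +ᶻ (g₃ *ᶻ w₁ -ᶻ g₁ *ᶻ w₃)) +ᶻ
      (r *ᶻ w₃ +ᶻ (g₁ *ᶻ w₂ -ᶻ g₂ *ᶻ w₁)) *ᶻ (r *ᶻ w₃ +ᶻ (g₁ *ᶻ w₂ -ᶻ g₂ *ᶻ w₁)) ≡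
      (r *ᶻ r +ᶻ (g₁ *ᶻ g₁ +ᶻ g₂ *ᶻ g₂ +ᶻ g₃ *ᶻ g₃)) *ᶻ (w₁ *ᶻ w₁ +ᶻ w₂ *ᶻ w₂ +ᶻ w₃ *ᶻ w₃) -ᶻ
      (g₁ *ᶻ w₁ +ᶻ g₂ *ᶻ w₂ +ᶻ g₃ *ᶻ w₃) *ᶻ (g₁ *ᶻ w₁ +ᶻ g₂ *ᶻ w₂ +ᶻ g₃ *ᶻ w₃)
    norm-p = ℤ-solve-∀
    dot-p : ∀ r g₁ g₂ g₃ w₁ w₂ w₃ →
      g₁ *ᶻ (r *ᶻ w₁ +ᶻ (g₂ *ᶻ w₃ -ᶻ g₃ *ᶻ w₂)) +ᶻ g₂ *ᶻ (r *ᶻ w₂ +ᶻ (g₃ *ᶻ w₁ -ᶻ g₁ *ᶻ w₃)) +ᶻ g₃ *ᶻ (r *ᶻ w₃ +ᶻ (g₁ *ᶻ w₂ -ᶻ g₂ *ᶻ w₁)) ≡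
      r *ᶻ (g₁ *ᶻ w₁ +ᶻ g₂ *ᶻ w₂ +ᶻ g₃ *ᶻ w₃)
    dot-p = ℤ-solve-∀
    collect : ∀ r z n d s →
      r *ᶻ r *ᶻ ((r *ᶻ r +ᶻ n) *ᶻ s -ᶻ d *ᶻ d) +ᶻ pos 2 *ᶻ r *ᶻ (z *ᶻ (r *ᶻ r +ᶻ n) +ᶻ d) *ᶻ (r *ᶻ d) +ᶻ
      (z *ᶻ (r *ᶻ r +ᶻ n) +ᶻ d) *ᶻ (z *ᶻ (r *ᶻ r +ᶻ n) +ᶻ d) *ᶻ n ≡
      (r *ᶻ r +ᶻ n) *ᶻ ((z *ᶻ (r *ᶻ r +ᶻ n) +ᶻ d) *ᶻ (z *ᶻ (r *ᶻ r +ᶻ n) +ᶻ d)) -ᶻ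
      (r *ᶻ r +ᶻ n) *ᶻ (r *ᶻ r) *ᶻ ((r *ᶻ r +ᶻ n) *ᶻ (z *ᶻ z) -ᶻ s)
    collect = ℤ-solve-∀

-- The norm of the quaternion (r, g) is k² n. Applied to z and k (a, b, c), for which c z² - |w|² is
-- k² (4t + 1), the similitude yields n (4t + 1) X² with X = k² r. This is where r has to be
-- nonzero.
ternary-from-difference : ∀ t n z a b c → FourSquares n →
  pos n *ᶻ (z *ᶻ z) -ᶻ pos (1 + 4 * t) ≡ norm a b c → Ternary t n
ternary-from-difference t n z a b c (k , r , g₁ , g₂ , g₃ , k≢0 , r≢0 , e) ez =
  k *ᶻ z′ , k *ᶻ (k *ᶻ r) , r *ᶻ p₁ +ᶻ z′ *ᶻ g₁ , r *ᶻ p₂ +ᶻ z′ *ᶻ g₂ , r *ᶻ p₃ +ᶻ z′ *ᶻ g₃ ,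
  i*j≢0 k≢0 (i*j≢0 k≢0 r≢0) , sym (begin
    norm (r *ᶻ p₁ +ᶻ z′ *ᶻ g₁) (r *ᶻ p₂ +ᶻ z′ *ᶻ g₂) (r *ᶻ p₃ +ᶻ z′ *ᶻ g₃)
      ≡⟨ identity ⟩
    c′ *ᶻ (z′ *ᶻ z′) -ᶻ c′ *ᶻ (r *ᶻ r) *ᶻ (c′ *ᶻ (z *ᶻ z) -ᶻ norm (k *ᶻ a) (k *ᶻ b) (k *ᶻ c))
      ≡⟨ cong₂ (λ x y → x *ᶻ (z′ *ᶻ z′) -ᶻ x *ᶻ (r *ᶻ r) *ᶻ (x *ᶻ (z *ᶻ z) -ᶻ y)) (sym e′)
           (trans (scale k a b c) (cong (k *ᶻ k *ᶻ_) (sym ez))) ⟩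
    k *ᶻ k *ᶻ pos n *ᶻ (z′ *ᶻ z′) -ᶻ k *ᶻ k *ᶻ pos n *ᶻ (r *ᶻ r) *ᶻ (k *ᶻ k *ᶻ pos n *ᶻ (z *ᶻ z) -ᶻ k *ᶻ k *ᶻ (pos n *ᶻ (z *ᶻ z) -ᶻ pos (1 + 4 * t)))
      ≡⟨ final k (pos n) z′ r z (pos (1 + 4 * t)) ⟩
    pos n *ᶻ (k *ᶻ z′ *ᶻ (k *ᶻ z′) -ᶻ pos (1 + 4 * t) *ᶻ (k *ᶻ (k *ᶻ r) *ᶻ (k *ᶻ (k *ᶻ r)))) ∎)
  where
  open ≡-Reasoning
  open Similitude r g₁ g₂ g₃ z (k *ᶻ a) (k *ᶻ b) (k *ᶻ c) renaming (c to c′)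
  assoc₄ : ∀ r a b c → r +ᶻ a +ᶻ b +ᶻ c ≡ r +ᶻ (a +ᶻ b +ᶻ c)
  assoc₄ = ℤ-solve-∀
  e′ : k *ᶻ k *ᶻ pos n ≡ c′
  e′ = trans e (assoc₄ (r *ᶻ r) (g₁ *ᶻ g₁) (g₂ *ᶻ g₂) (g₃ *ᶻ g₃))
  scale : ∀ k a b c → k *ᶻ a *ᶻ (k *ᶻ a) +ᶻ k *ᶻ b *ᶻ (k *ᶻ b) +ᶻ k *ᶻ c *ᶻ (k *ᶻ c) ≡ k *ᶻ k *ᶻ (a *ᶻ a +ᶻ b *ᶻ b +ᶻ c *ᶻ c)
  scale = ℤ-solve-∀
  final : ∀ k n z′ r z N →
    k *ᶻ k *ᶻ n *ᶻ (z′ *ᶻ z′) -ᶻ k *ᶻ k *ᶻ n *ᶻ (r *ᶻ r) *ᶻ (k *ᶻ k *ᶻ n *ᶻ (z *ᶻ z) -ᶻ k *ᶻ k *ᶻ (n *ᶻ (z *ᶻ z) -ᶻ N)) ≡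
    n *ᶻ (k *ᶻ z′ *ᶻ (k *ᶻ z′) -ᶻ N *ᶻ (k *ᶻ (k *ᶻ r) *ᶻ (k *ᶻ (k *ᶻ r))))
  final = ℤ-solve-∀

-- Here z = 2(t + 1), and n z² − (4t + 1) = 8K + 3.
ternary-even : ∀ t n K → suc n * (suc t * suc t) ≡ suc t + (K + K) → Ternary t (suc n)
ternary-even t n K eq with three-squares K
... | a , b , c , e = ternary-from-difference t (suc n) (pos 2 *ᶻ pos (suc t)) (pos a) (pos b) (pos c) (four-squares n) (begin
  pos (suc n) *ᶻ (pos 2 *ᶻ pos (suc t) *ᶻ (pos 2 *ᶻ pos (suc t))) -ᶻ pos (1 + 4 * t)
    ≡⟨ cong₂ _-ᶻ_ (lem₁ (pos (suc n)) (pos (suc t))) (cong (1ℤ +ᶻ_) (ℤ.pos-* 4 t)) ⟩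
  pos 4 *ᶻ (pos (suc n) *ᶻ (pos (suc t) *ᶻ pos (suc t))) -ᶻ (1ℤ +ᶻ pos 4 *ᶻ pos t)
    ≡⟨ cong (λ x → pos 4 *ᶻ x -ᶻ (1ℤ +ᶻ pos 4 *ᶻ pos t))
         (trans (sym (trans (ℤ.pos-* (suc n) (suc t * suc t)) (cong (pos (suc n) *ᶻ_) (ℤ.pos-* (suc t) (suc t))))) (cong pos eq)) ⟩
  pos 4 *ᶻ (1ℤ +ᶻ pos t +ᶻ (pos K +ᶻ pos K)) -ᶻ (1ℤ +ᶻ pos 4 *ᶻ pos t)
    ≡⟨ lem₂ (pos t) (pos K) ⟩
  pos 8 *ᶻ pos K +ᶻ pos 3
    ≡⟨ cong (_+ᶻ pos 3) (sym (ℤ.pos-* 8 K)) ⟩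
  pos (8 * K + 3)
    ≡⟨ cong pos (sym e) ⟩
  pos (a * a + b * b + c * c)
    ≡⟨ pos-sum-squares a b c ⟩
  norm (pos a) (pos b) (pos c) ∎)
  where
  open ≡-Reasoning
  lem₁ : ∀ n t → n *ᶻ (pos 2 *ᶻ t *ᶻ (pos 2 *ᶻ t)) ≡ pos 4 *ᶻ (n *ᶻ (t *ᶻ t))
  lem₁ = ℤ-solve-∀
  lem₂ : ∀ t K → pos 4 *ᶻ (1ℤ +ᶻ t +ᶻ (K +ᶻ K)) -ᶻ (1ℤ +ᶻ pos 4 *ᶻ t) ≡ pos 8 *ᶻ K +ᶻ pos 3
  lem₂ = ℤ-solve-∀

-- Triangular numbers meet every residue class mod 8. Raising ζ by 16 adds 8 (2ζ + 17), enough to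
-- raise v by 8 and keep the excess e nonnegative.
tri-residue : ∀ v → ∃ λ ζ → ∃ λ e → tri ζ ≡ v + 8 * e
tri-residue 0 = 0 , 0 , refl
tri-residue 1 = 1 , 0 , refl
tri-residue 2 = 4 , 1 , refl
tri-residue 3 = 2 , 0 , refl
tri-residue 4 = 7 , 3 , refl
tri-residue 5 = 6 , 2 , refl
tri-residue 6 = 3 , 0 , refl
tri-residue 7 = 5 , 1 , refl
tri-residue (suc (suc (suc (suc (suc (suc (suc (suc v)))))))) with tri-residue v
... | ζ , e , eq = 16 + ζ , e + 2 * ζ + 16 , trans (lem₁ ζ (tri ζ)) (trans (cong (λ x → 136 + 16 * ζ + x) eq) (lem₂ v ζ e))
  where
  lem₁ : ∀ ζ x → suc (15 + ζ) + (suc (14 + ζ) + (suc (13 + ζ) + (suc (12 + ζ) + (suc (11 + ζ) + (suc (10 + ζ) + (suc (9 + ζ) + (suc (8 + ζ) +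
    (suc (7 + ζ) + (suc (6 + ζ) + (suc (5 + ζ) + (suc (4 + ζ) + (suc (3 + ζ) + (suc (2 + ζ) + (suc (1 + ζ) + (suc ζ + x))))))))))))))) ≡ 136 + 16 * ζ + x
  lem₁ = ℕ-solve-∀
  lem₂ : ∀ v ζ e → 136 + 16 * ζ + (v + 8 * e) ≡ 8 + v + 8 * (e + 2 * ζ + 16)
  lem₂ = ℕ-solve-∀

-- With n = 2m, m odd and t = 2τ, the choice Z = 2ζ + 1 gives n (Z² − (4t + 1)) = 16 (8K + 3).
ternary-odd : ∀ τ μ → Ternary (τ + τ) (suc (μ + μ) + suc (μ + μ))
-- The excess of `tri ζ` over τ is 3m + 8e, chosen because m · 3m ≡ 3 (mod 8) for odd m.
ternary-odd τ μ with tri-residue (τ + 3 * suc (μ + μ))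
... | ζ , e , eq with three-squares (3 * tri μ + e * suc (μ + μ))
...   | a , b , c , sq = pos (suc (ζ + ζ)) , 1ℤ , pos 4 *ᶻ pos a , pos 4 *ᶻ pos b , pos 4 *ᶻ pos c , (λ ()) , (begin
  pos (m + m) *ᶻ (pos (suc (ζ + ζ)) *ᶻ pos (suc (ζ + ζ)) -ᶻ pos (1 + 4 * (τ + τ)) *ᶻ (1ℤ *ᶻ 1ℤ))
    ≡⟨ cong₂ (λ x y → (pos m +ᶻ pos m) *ᶻ (x -ᶻ y *ᶻ (1ℤ *ᶻ 1ℤ)))
         (trans (sym (ℤ.pos-* (suc (ζ + ζ)) (suc (ζ + ζ)))) (trans (cong pos (odd-square ζ))
           (trans (cong (λ x → pos (suc (8 * x))) eq) (trans (cong pos (lem₀ τ m e)) (cong (λ x → 1ℤ +ᶻ x)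
             (cong₂ _+ᶻ_ (cong₂ _+ᶻ_ (ℤ.pos-* 8 τ) (ℤ.pos-* 24 m)) (ℤ.pos-* 64 e)))))))
         (trans (cong pos (lem₁ τ)) (cong (1ℤ +ᶻ_) (ℤ.pos-* 8 τ))) ⟩
  (pos m +ᶻ pos m) *ᶻ ((1ℤ +ᶻ (pos 8 *ᶻ pos τ +ᶻ pos 24 *ᶻ pos m +ᶻ pos 64 *ᶻ pos e)) -ᶻ (1ℤ +ᶻ pos 8 *ᶻ pos τ) *ᶻ (1ℤ *ᶻ 1ℤ))
    ≡⟨ lem₂ (pos m) (pos τ) (pos e) ⟩
  pos 16 *ᶻ (pos 3 *ᶻ (pos m *ᶻ pos m) +ᶻ pos 8 *ᶻ (pos e *ᶻ pos m))
    ≡⟨ cong (λ x → pos 16 *ᶻ (pos 3 *ᶻ x +ᶻ pos 8 *ᶻ (pos e *ᶻ pos m)))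
         (trans (sym (ℤ.pos-* m m)) (trans (cong pos (odd-square μ)) (cong (1ℤ +ᶻ_) (ℤ.pos-* 8 (tri μ))))) ⟩
  pos 16 *ᶻ (pos 3 *ᶻ (1ℤ +ᶻ pos 8 *ᶻ pos (tri μ)) +ᶻ pos 8 *ᶻ (pos e *ᶻ pos m))
    ≡⟨ lem₃ (pos (tri μ)) (pos e *ᶻ pos m) ⟩
  pos 16 *ᶻ (pos 8 *ᶻ (pos 3 *ᶻ pos (tri μ) +ᶻ pos e *ᶻ pos m) +ᶻ pos 3)
    ≡⟨ cong (λ x → pos 16 *ᶻ (x +ᶻ pos 3)) (sym (trans (ℤ.pos-* 8 (3 * tri μ + e * m))
         (cong (pos 8 *ᶻ_) (cong₂ _+ᶻ_ (ℤ.pos-* 3 (tri μ)) (ℤ.pos-* e m))))) ⟩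
  pos 16 *ᶻ pos (8 * (3 * tri μ + e * m) + 3)
    ≡⟨ cong (pos 16 *ᶻ_) (trans (cong pos (sym sq)) (pos-sum-squares a b c)) ⟩
  pos 16 *ᶻ (pos a *ᶻ pos a +ᶻ pos b *ᶻ pos b +ᶻ pos c *ᶻ pos c)
    ≡⟨ lem₄ (pos a) (pos b) (pos c) ⟩
  pos 4 *ᶻ pos a *ᶻ (pos 4 *ᶻ pos a) +ᶻ pos 4 *ᶻ pos b *ᶻ (pos 4 *ᶻ pos b) +ᶻ pos 4 *ᶻ pos c *ᶻ (pos 4 *ᶻ pos c) ∎)
  where
  open ≡-Reasoning
  m : ℕ
  m = suc (μ + μ)
  lem₀ : ∀ τ m e → suc (8 * (τ + 3 * m + 8 * e)) ≡ 1 + (8 * τ + 24 * m + 64 * e)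
  lem₀ = ℕ-solve-∀
  lem₁ : ∀ τ → 1 + 4 * (τ + τ) ≡ 1 + 8 * τ
  lem₁ = ℕ-solve-∀
  lem₂ : ∀ m τ e → (m +ᶻ m) *ᶻ ((1ℤ +ᶻ (pos 8 *ᶻ τ +ᶻ pos 24 *ᶻ m +ᶻ pos 64 *ᶻ e)) -ᶻ (1ℤ +ᶻ pos 8 *ᶻ τ) *ᶻ (1ℤ *ᶻ 1ℤ)) ≡
    pos 16 *ᶻ (pos 3 *ᶻ (m *ᶻ m) +ᶻ pos 8 *ᶻ (e *ᶻ m))
  lem₂ = ℤ-solve-∀
  lem₃ : ∀ x y → pos 16 *ᶻ (pos 3 *ᶻ (1ℤ +ᶻ pos 8 *ᶻ x) +ᶻ pos 8 *ᶻ y) ≡ pos 16 *ᶻ (pos 8 *ᶻ (pos 3 *ᶻ x +ᶻ y) +ᶻ pos 3)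
  lem₃ = ℤ-solve-∀
  lem₄ : ∀ a b c → pos 16 *ᶻ (a *ᶻ a +ᶻ b *ᶻ b +ᶻ c *ᶻ c) ≡ pos 4 *ᶻ a *ᶻ (pos 4 *ᶻ a) +ᶻ pos 4 *ᶻ b *ᶻ (pos 4 *ᶻ b) +ᶻ pos 4 *ᶻ c *ᶻ (pos 4 *ᶻ c)
  lem₄ = ℤ-solve-∀

ternary-quadruple : ∀ t m → Ternary t m → Ternary t (m + m + (m + m))
ternary-quadruple t m (Z , X , a , b , c , X≢0 , e) = Z , X , pos 2 *ᶻ a , pos 2 *ᶻ b , pos 2 *ᶻ c , X≢0 ,
  trans (lem (pos m) _) (trans (cong (pos 4 *ᶻ_) e) (lem′ a b c))
  where
  lem : ∀ m x → (m +ᶻ m +ᶻ (m +ᶻ m)) *ᶻ x ≡ pos 4 *ᶻ (m *ᶻ x)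
  lem = ℤ-solve-∀
  lem′ : ∀ a b c → pos 4 *ᶻ (a *ᶻ a +ᶻ b *ᶻ b +ᶻ c *ᶻ c) ≡ pos 2 *ᶻ a *ᶻ (pos 2 *ᶻ a) +ᶻ pos 2 *ᶻ b *ᶻ (pos 2 *ᶻ b) +ᶻ pos 2 *ᶻ c *ᶻ (pos 2 *ᶻ c)
  lem′ = ℤ-solve-∀

opaque
  -- Write n for the second argument of `Ternary`. Then (t + 1)(n (t + 1) - 1) is even unless t and
  -- n are both even, which settles the cases of `ternary-even`. For even t and n, either n/2 is odd
  -- or a factor 4 can be removed from n.
  ternary : ∀ t n → Ternary t (suc n)
  ternary t = <-rec (λ n → Ternary t (suc n)) λ n ih → step n (halve n) (halve t) ih
    where
    step : ∀ {t} n → Halved n → Halved t → (∀ {m} → m < n → Ternary t (suc m)) → Ternary t (suc n)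
    step n _ (odd′ τ) ih = ternary-even (suc (τ + τ)) n (suc τ * (2 * n * suc τ + suc (τ + τ))) (lem n τ)
      where
      lem : ∀ n τ → suc n * (suc (suc (τ + τ)) * suc (suc (τ + τ))) ≡
        suc (suc (τ + τ)) + (suc τ * (2 * n * suc τ + suc (τ + τ)) + suc τ * (2 * n * suc τ + suc (τ + τ)))
      lem = ℕ-solve-∀
    step _ (even m) (even τ) ih = ternary-even (τ + τ) (m + m) (suc (τ + τ) * (2 * m * τ + m + τ)) (lem m τ)
      where
      lem : ∀ m τ → suc (m + m) * (suc (τ + τ) * suc (τ + τ)) ≡
        suc (τ + τ) + (suc (τ + τ) * (2 * m * τ + m + τ) + suc (τ + τ) * (2 * m * τ + m + τ))
      lem = ℕ-solve-∀
    step _ (odd′ m) (even τ) ih with halve m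
    ... | even μ = subst (Ternary (τ + τ)) (cong suc (ℕ.+-suc (μ + μ) (μ + μ))) (ternary-odd τ μ)
    ... | odd′ μ = subst (Ternary (τ + τ)) (lem μ) (ternary-quadruple (τ + τ) (suc μ) (ih (s≤s (ℕ.≤-trans (ℕ.m≤m+n μ μ)
          (ℕ.≤-trans (ℕ.n≤1+n (μ + μ)) (ℕ.m≤m+n (suc (μ + μ)) (suc (μ + μ))))))))
      where
      lem : ∀ μ → suc μ + suc μ + (suc μ + suc μ) ≡ suc (suc (suc (μ + μ) + suc (μ + μ)))
      lem = ℕ-solve-∀

theorem4p2 : ∀ (n : ℕ) → 1 ≤ n → ∀ (M m : ℕ) →
    IsUpperCliqueNumber n M → IsLowerCliqueNumber n m → M ≤ m + 3
theorem4p2 n _ = Cliques.clique-gap four-squares ternary n
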